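{- Fix an integer $s\geq 2$. Let $N=\binom{n}{2}$ and let $e_{i,j}$, $i=1,\dots,N$, $j=1,\dots,s$, be $s$ independent uniformly random orderings of the edge set $E(K_n)$ of the complete graph $K_n$ (so for each $j$, $(e_{1,j},\dots,e_{N,j})$ is a uniformly random permutation of $E(K_n)$, independently over $j$). For $I\subseteq[N]$ and $j\in[s]$ let $E_{I,j}=\{e_{i,j}:i\in I\}$. Call $I\subseteq[N]$ a MultiTree if for every $j=1,\dots,s$ the edge set $E_{I,j}$ forms a spanning tree of $K_n$. Let $m^*$ be the smallest $m$ such that $[m]=\{1,\dots,m\}$ contains a MultiTree. Then $m^*=O(n\log n)$ with high probability, i.e. there is a constant $C$ (independent of $n$) such that $\Pr(m^*\le Cn\log n)\to 1$ as $n\to\infty$.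
   Context: With high probability (w.h.p.) means with probability tending to 1 as $n\to\infty$. -}

module Defs where

open import Level using (0ℓ)
open import Data.Nat using (ℕ; suc; _≤_; _<_; _*_)
open import Data.Nat.Combinatorics using (_C_)
open import Data.Nat.Logarithm using (⌊log₂_⌋)
open import Data.Fin using (Fin; toℕ) renaming (_<_ to _<ᶠ_)
open import Data.Product using (Σ; ∃; ∃-syntax; _×_; _,_; proj₁)
open import Data.Sum using (_⊎_)
open import Data.List using (List; []; _∷_; _++_; [_]; length)
open import Data.List.Relation.Unary.All using (All)
open import Data.List.Relation.Unary.Linked using (Linked)
open import Data.List.Membership.Propositional using (_∈_)
open import Data.List.Relation.Unary.Unique.Propositional using (Unique)
open import Data.Vec using (Vec; lookup; toList)
open import Relation.Binary.PropositionalEquality using (_≡_)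
open import Relation.Binary.Construct.Closure.ReflexiveTransitive using (Star)
open import Relation.Nullary using (¬_)

-- A graph on vertex set Fin n, given by its (symmetric) adjacency relation.
Graph : ℕ → Set₁
Graph n = Fin n → Fin n → Set

Connected : ∀ {n} → Graph n → Set
Connected {n} G = (u v : Fin n) → Star G u v

HasCycle : ∀ {n} → Graph n → Set
HasCycle {n} G =
  Σ (Fin n) λ v → Σ (List (Fin n)) λ ws →
    2 ≤ length ws × Unique (v ∷ ws) × Linked G (v ∷ ws ++ [ v ])

SpanningTree : ∀ {n} → Graph n → Set
SpanningTree G = Connected G × ¬ HasCycle G

Edge : ℕ → Set
Edge n = Σ (Fin n × Fin n) λ p → proj₁ p <ᶠ Data.Product.proj₂ p

Joins : ∀ {n} → Edge n → Fin n → Fin n → Set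
Joins e u v = ((u , v) ≡ proj₁ e) ⊎ ((v , u) ≡ proj₁ e)

N : ℕ → ℕ
N n = n C 2

IsOrdering : ∀ {n} → Vec (Edge n) (N n) → Set
IsOrdering {n} o = Unique (toList o) × ((e : Edge n) → e ∈ toList o)

Outcome : ℕ → ℕ → Set
Outcome n s = Vec (Vec (Edge n) (N n)) s

Valid : ∀ {n s} → Outcome n s → Set
Valid ω = All IsOrdering (toList ω)

EdgeGraph : ∀ {n s} → Outcome n s → List (Fin (N n)) → Fin s → Graph n
EdgeGraph ω I j u v = ∃[ i ] (i ∈ I × Joins (lookup (lookup ω j) i) u v)

MultiTree : ∀ {n s} → Outcome n s → List (Fin (N n)) → Set
MultiTree {s = s} ω I = (j : Fin s) → SpanningTree (EdgeGraph ω I j)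

-- [m] = {1,…,m} (0-based: indices i with toℕ i < m) contains a MultiTree
ContainsMultiTree : ∀ {n s} → Outcome n s → ℕ → Set
ContainsMultiTree {n} ω m =
  Σ (List (Fin (N n))) λ I → All (λ i → toℕ i < m) I × MultiTree ω I

MStarAtMost : ∀ {n s} → Outcome n s → ℕ → Set
MStarAtMost ω M = Σ ℕ λ m → m ≤ M × ContainsMultiTree ω m

-- Pr over uniform valid outcomes of  m* ≤ M  is at least k/(k+1):
-- there is a duplicate-free complete list of all valid outcomes and a
-- duplicate-free list of good outcomes with (k+1)·|good| ≥ k·|all|.
ProbAtLeast : ℕ → (n s M : ℕ) → Set
ProbAtLeast k n s M =
  Σ (List (Outcome n s)) λ all →
  Σ (List (Outcome n s)) λ good →
    Unique all × All Valid all × ((ω : Outcome n s) → Valid ω → ω ∈ all) ×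
    Unique good × All (λ ω → Valid ω × MStarAtMost ω M) good ×
    k * length all ≤ suc k * length good

{-# OPTIONS --safe #-}
-- Expose the rows one by one and maintain in each of the s colours a forest, all with the same number of
-- blocks (components); a row is accepted only if its edge joins two blocks of suitable sizes in every colour.
-- Stage k = 8^i starts with all blocks of size in [k, 16k) and must raise all sizes to at least 8k. While
-- some colour has a positive fraction εn of its vertices in small blocks (size < 8k), every such colour joins
-- small blocks to small blocks and every other colour joins medium blocks (size in [8k, 64k)). Afterwards the
-- colour with most vertices in small blocks joins a small block to a medium one, the others join medium
-- blocks. Counting blocks shows that medium blocks always cover a positive fraction of the vertices, so a row
-- is accepted with constant probability in the first phase, and with probability of order m/n when m vertices
-- lie in small blocks in the second; hence a potential contracts by 1 - Ω(k/n) per row, and O((n/k) log n)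
-- rows suffice for the stage up to an error n^(-Ω(1)). The sum over k is O(n log n). When the blocks have
-- linear size, every crossing row is accepted. The one obstruction, a vertex most of whose edges have been used
-- already, is excluded by a second potential, the exponential of the used degree.

module Submission where

open import Defs
open import Data.Nat using (ℕ; zero; suc; _+_; _*_; _∸_; _^_; _≤_; _<_; z≤n; s≤s; s≤s⁻¹; _≤?_; _<?_; ⌊_/2⌋; _/_; >-nonZero)
open import Data.Nat.Properties hiding (_≟_; suc-injective)
open import Data.Nat.Logarithm using (⌊log₂_⌋; ⌊log₂⌋-mono-≤; ⌊log₂[2^n]⌋≡n; ⌊log₂⌊n/2⌋⌋≡⌊log₂n⌋∸1)
open import Data.Nat.Combinatorics using (_C_; nC1≡n; nCk+nC[k+1]≡[n+1]C[k+1])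
open import Data.Nat.DivMod using (m/n*n≤m; m≡m%n+[m/n]*n; m%n<n; n/n≡1; /-monoˡ-≤)
open import Data.Nat.Induction using (<-rec)
open import Data.Nat.Tactic.RingSolver using (solve-∀)
open import Data.Fin using (Fin; zero; suc; toℕ; _≟_)
open import Data.Fin.Properties using (all?; ¬∀⟶∃¬; suc-injective)
open import Data.Product using (∃; ∃-syntax; _×_; _,_; proj₁; proj₂)
open import Data.Sum using (_⊎_; inj₁; inj₂; [_,_]′) renaming (map to ⊎-map)
open import Data.Empty using (⊥; ⊥-elim)
open import Data.Unit using (⊤; tt)
open import Data.List using (List; []; _∷_; _++_; [_]; length; map; concatMap; filter; allFin; replicate; tabulate)
open import Data.List.Properties using (++-identityʳ; map-∘; length-map; length-++; length-replicate; length-tabulate)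
open import Data.List.Relation.Unary.All using (All; []; _∷_)
import Data.List.Relation.Unary.All as All
import Data.List.Relation.Unary.All.Properties as All
open import Data.List.Relation.Unary.Any using (here; there)
open import Data.List.Relation.Unary.AllPairs using (AllPairs; []; _∷_)
import Data.List.Relation.Unary.AllPairs as AllPairs′
import Data.List.Relation.Unary.AllPairs.Properties as AllPairs
open import Data.List.Relation.Unary.Linked using (Linked; []; [-]; _∷_)
import Data.List.Relation.Unary.Linked as Linked
open import Data.List.Relation.Unary.Unique.Propositional using (Unique)
import Data.List.Relation.Unary.Unique.Propositional.Properties as Unique
open import Data.List.Membership.Propositional using (_∈_; _∉_; find; lose)
open import Data.List.Membership.Propositional.Properties using (∈-map⁺; ∈-map⁻; ∈-++⁺ˡ; ∈-++⁺ʳ; ∈-++⁻; ∈-concatMap⁺; ∈-concatMap⁻; ∈-allFin; ∈-filter⁻)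
open import Data.List.Membership.Propositional.Properties.WithK using (unique∧set⇒bag)
open import Data.List.Relation.Binary.BagAndSetEquality using (∼bag⇒↭)
open import Data.List.Relation.Binary.Permutation.Propositional using (_↭_; ↭⇒↭ₛ; ↭-refl; ↭-sym; ↭-trans; ↭-prep; ↭-swap)
open import Data.List.Relation.Binary.Permutation.Propositional.Properties using (∈-resp-↭; drop-∷)
import Data.List.Relation.Binary.Permutation.Setoid.Properties as ↭ₛ
open import Data.Vec using (Vec; []; _∷_; lookup; toList; fromList) renaming (map to mapᵛ; zipWith to zipWithᵛ; replicate to replicateᵛ; head to headᵛ; tail to tailᵛ)
open import Data.Vec.Properties using (lookup-map; lookup-zipWith; lookup-replicate; toList∘fromList)
open import Data.Bool using (if_then_else_)
open import Function using (_∘_; id; case_of_; mk⇔)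
open import Relation.Binary.PropositionalEquality hiding ([_])
open import Relation.Binary.Construct.Closure.ReflexiveTransitive using (Star; ε; _◅_; _◅◅_) renaming (map to mapˢ)
open import Relation.Nullary using (¬_; Dec; yes; no; does; contradiction; _×-dec_; _⊎-dec_; ¬?)
open import Relation.Nullary.Decidable using (dec-true; dec-false)

-- Every accepted row merges two blocks in each colour at once, so a colour that needs no progress
-- must still be able to pay for the others. When only m vertices of a colour lie in small blocks,
-- asking two such colours for progress in the same row would succeed with probability of order
-- (m/n)^2, which is too rare; hence one colour advances at a time and the others spend medium
-- blocks. The danger is that these run out because a few large blocks hold almost all vertices. The
-- common block count prevents it: a colour that merges only small blocks has all sizes below 16k,
-- hence at least n/(16k) blocks, and in the second phase each accepted row lowers k times the count
-- by k and the total small mass by at least k, so that a reserve of n/32 survives. Conditioning on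
-- low used degrees would spoil the uniform draw; instead the potentials are set to zero from the
-- first violation on.

-- Finite sums, indicators and products

∑ : ∀ {A : Set} → List A → (A → ℕ) → ℕ
∑ []       f = 0
∑ (x ∷ xs) f = f x + ∑ xs f

∑-mono : ∀ {A : Set} (xs : List A) {f g : A → ℕ} → (∀ x → x ∈ xs → f x ≤ g x) → ∑ xs f ≤ ∑ xs g
∑-mono []       h = z≤n
∑-mono (x ∷ xs) h = +-mono-≤ (h x (here refl)) (∑-mono xs (λ y y∈ → h y (there y∈)))

∑-cong : ∀ {A : Set} (xs : List A) {f g : A → ℕ} → (∀ x → f x ≡ g x) → ∑ xs f ≡ ∑ xs g
∑-cong []       h = refl
∑-cong (x ∷ xs) h = cong₂ _+_ (h x) (∑-cong xs h)

∑-+ : ∀ {A : Set} (xs : List A) (f g : A → ℕ) → ∑ xs (λ x → f x + g x) ≡ ∑ xs f + ∑ xs g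
∑-+ []       f g = refl
∑-+ (x ∷ xs) f g = trans (cong (f x + g x +_) (∑-+ xs f g)) (interchange (f x) (g x) (∑ xs f) (∑ xs g))
  where
  interchange : ∀ a b c d → a + b + (c + d) ≡ a + c + (b + d)
  interchange = solve-∀

∑-*ˡ : ∀ {A : Set} (xs : List A) (a : ℕ) (f : A → ℕ) → ∑ xs (λ x → a * f x) ≡ a * ∑ xs f
∑-*ˡ []       a f = sym (*-zeroʳ a)
∑-*ˡ (x ∷ xs) a f = trans (cong (a * f x +_) (∑-*ˡ xs a f)) (sym (*-distribˡ-+ a (f x) (∑ xs f)))

∑-*ʳ : ∀ {A : Set} (xs : List A) (a : ℕ) (f : A → ℕ) → ∑ xs (λ x → f x * a) ≡ ∑ xs f * a
∑-*ʳ []       a f = refl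
∑-*ʳ (x ∷ xs) a f = trans (cong (f x * a +_) (∑-*ʳ xs a f)) (sym (*-distribʳ-+ a (f x) (∑ xs f)))

∑-const : ∀ {A : Set} (xs : List A) (a : ℕ) → ∑ xs (λ _ → a) ≡ length xs * a
∑-const []       a = refl
∑-const (x ∷ xs) a = cong (a +_) (∑-const xs a)

∑-zero : ∀ {A : Set} (xs : List A) → ∑ xs (λ _ → 0) ≡ 0
∑-zero xs = trans (∑-const xs 0) (*-zeroʳ (length xs))

∑-++ : ∀ {A : Set} (xs ys : List A) (f : A → ℕ) → ∑ (xs ++ ys) f ≡ ∑ xs f + ∑ ys f
∑-++ []       ys f = refl
∑-++ (x ∷ xs) ys f = trans (cong (f x +_) (∑-++ xs ys f)) (sym (+-assoc (f x) _ _))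

∑-map : ∀ {A B : Set} (h : A → B) (xs : List A) (f : B → ℕ) → ∑ (map h xs) f ≡ ∑ xs (f ∘ h)
∑-map h []       f = refl
∑-map h (x ∷ xs) f = cong (f (h x) +_) (∑-map h xs f)

∑-concatMap : ∀ {A B : Set} (h : A → List B) (xs : List A) (f : B → ℕ) →
              ∑ (concatMap h xs) f ≡ ∑ xs (λ x → ∑ (h x) f)
∑-concatMap h []       f = refl
∑-concatMap h (x ∷ xs) f = trans (∑-++ (h x) _ f) (cong (∑ (h x) f +_) (∑-concatMap h xs f))

∑-comm : ∀ {A B : Set} (xs : List A) (ys : List B) (f : A → B → ℕ) →
         ∑ xs (λ x → ∑ ys (f x)) ≡ ∑ ys (λ y → ∑ xs (λ x → f x y))
∑-comm []       ys f = sym (∑-zero ys)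
∑-comm (x ∷ xs) ys f = trans (cong (∑ ys (f x) +_) (∑-comm xs ys f)) (sym (∑-+ ys (f x) _))

∑-∈ : ∀ {A : Set} {xs : List A} {x} (f : A → ℕ) → x ∈ xs → f x ≤ ∑ xs f
∑-∈ f (here refl) = m≤m+n _ _
∑-∈ f (there x∈)  = ≤-trans (∑-∈ f x∈) (m≤n+m _ _)

𝟙 : ∀ {P : Set} → Dec P → ℕ
𝟙 d = if does d then 1 else 0

𝟙-yes : ∀ {P : Set} (d : Dec P) → P → 𝟙 d ≡ 1
𝟙-yes d p = cong (λ b → if b then 1 else 0) (dec-true d p)

𝟙-no : ∀ {P : Set} (d : Dec P) → ¬ P → 𝟙 d ≡ 0
𝟙-no d ¬p = cong (λ b → if b then 1 else 0) (dec-false d ¬p)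

𝟙≤1 : ∀ {P : Set} (d : Dec P) → 𝟙 d ≤ 1
𝟙≤1 (yes _) = ≤-refl
𝟙≤1 (no  _) = z≤n

𝟙-≤ : ∀ {P : Set} (d : Dec P) {x} → (P → 1 ≤ x) → 𝟙 d ≤ x
𝟙-≤ (yes p) h = h p
𝟙-≤ (no  _) h = z≤n

𝟙-mono : ∀ {P Q : Set} (d : Dec P) (e : Dec Q) → (P → Q) → 𝟙 d ≤ 𝟙 e
𝟙-mono d e h = 𝟙-≤ d (λ p → ≤-reflexive (sym (𝟙-yes e (h p))))

𝟙-cong : ∀ {P Q : Set} (d : Dec P) (e : Dec Q) → (P → Q) → (Q → P) → 𝟙 d ≡ 𝟙 e
𝟙-cong d e f g = ≤-antisym (𝟙-mono d e f) (𝟙-mono e d g)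

∑ᶠ : ∀ {n} → (Fin n → ℕ) → ℕ
∑ᶠ {n} = ∑ (allFin n)

∑-tabulate : ∀ {A : Set} {n} (h : Fin n → A) (f : A → ℕ) → ∑ (tabulate h) f ≡ ∑ᶠ (f ∘ h)
∑-tabulate {n = zero}  h f = refl
∑-tabulate {n = suc n} h f =
  cong (f (h zero) +_) (trans (∑-tabulate (h ∘ suc) f) (sym (∑-tabulate suc (f ∘ h))))

∑ᶠ-suc : ∀ {n} (f : Fin (suc n) → ℕ) → ∑ᶠ f ≡ f zero + ∑ᶠ (f ∘ suc)
∑ᶠ-suc f = cong (f zero +_) (∑-tabulate suc f)

∑ᶠ-mono : ∀ {n} {f g : Fin n → ℕ} → (∀ x → f x ≤ g x) → ∑ᶠ f ≤ ∑ᶠ g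
∑ᶠ-mono {n} h = ∑-mono (allFin n) (λ x _ → h x)

∑ᶠ-const : ∀ {n} a → ∑ᶠ {n} (λ _ → a) ≡ n * a
∑ᶠ-const {n} a = trans (∑-const (allFin n) a) (cong (_* a) (length-tabulate {n = n} id))

≤∑ᶠ : ∀ {n} (f : Fin n → ℕ) x → f x ≤ ∑ᶠ f
≤∑ᶠ f x = ∑-∈ f (∈-allFin x)

∑ᶠ-δ : ∀ {n} (a : Fin n) (g : Fin n → ℕ) → ∑ᶠ (λ v → 𝟙 (v ≟ a) * g v) ≡ g a
∑ᶠ-δ {suc n} zero g = begin
  ∑ᶠ (λ v → 𝟙 (v ≟ zero) * g v)       ≡⟨ ∑ᶠ-suc (λ v → 𝟙 (v ≟ zero) * g v) ⟩
  g zero + 0 + ∑ᶠ (λ (v : Fin n) → 0) ≡⟨ cong (g zero + 0 +_) (∑-zero (allFin n)) ⟩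
  g zero + 0 + 0                      ≡⟨ trans (+-identityʳ _) (+-identityʳ _) ⟩
  g zero                              ∎
  where open ≡-Reasoning
∑ᶠ-δ {suc n} (suc a) g = begin
  ∑ᶠ (λ v → 𝟙 (v ≟ suc a) * g v)           ≡⟨ ∑ᶠ-suc (λ v → 𝟙 (v ≟ suc a) * g v) ⟩
  ∑ᶠ (λ v → 𝟙 (suc v ≟ suc a) * g (suc v)) ≡⟨ ∑-cong (allFin n) (λ v → cong (_* g (suc v)) (𝟙-cong (suc v ≟ suc a) (v ≟ a) suc-injective (cong suc))) ⟩
  ∑ᶠ (λ v → 𝟙 (v ≟ a) * g (suc v))         ≡⟨ ∑ᶠ-δ a (g ∘ suc) ⟩
  g (suc a)                                ∎
  where open ≡-Reasoning

∑ᶠ-𝟙≟ : ∀ {n} (a : Fin n) → ∑ᶠ (λ v → 𝟙 (v ≟ a)) ≡ 1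
∑ᶠ-𝟙≟ a = trans (∑-cong (allFin _) (λ v → sym (*-identityʳ (𝟙 (v ≟ a))))) (∑ᶠ-δ a (λ _ → 1))

∏ᶠ : ∀ {s} → (Fin s → ℕ) → ℕ
∏ᶠ {zero}  h = 1
∏ᶠ {suc s} h = h zero * ∏ᶠ (h ∘ suc)

x[yz]≡y[xz] : ∀ x y z → x * (y * z) ≡ y * (x * z)
x[yz]≡y[xz] = solve-∀

-- Partitions of the vertex set: block sizes, block counts, merging

-- A partition of Fin n is a labelling f : Fin n → Fin n with f (f v) ≡ f v: the label
-- of v is a chosen representative of its block, so blocks correspond to fixed points.

Idem : ∀ {n} → (Fin n → Fin n) → Set
Idem f = ∀ v → f (f v) ≡ f v

size : ∀ {n} → (Fin n → Fin n) → Fin n → ℕ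
size f v = ∑ᶠ (λ u → 𝟙 (f u ≟ f v))

blocks : ∀ {n} → (Fin n → Fin n) → ℕ
blocks f = ∑ᶠ (λ v → 𝟙 (f v ≟ v))

Range : Set
Range = ℕ × ℕ

_∈ᴿ_ : ℕ → Range → Set
x ∈ᴿ (lo , hi) = lo ≤ x × x < hi

_∈ᴿ?_ : ∀ x R → Dec (x ∈ᴿ R)
x ∈ᴿ? (lo , hi) = (lo ≤? x) ×-dec (x <? hi)

mass : ∀ {n} → (Fin n → Fin n) → Range → ℕ
mass f R = ∑ᶠ (λ v → 𝟙 (size f v ∈ᴿ? R))

mass≤n : ∀ {n} (f : Fin n → Fin n) R → mass f R ≤ n
mass≤n {n} f R = ≤-trans (∑ᶠ-mono (λ v → 𝟙≤1 (size f v ∈ᴿ? R))) (≤-reflexive (trans (∑ᶠ-const {n} 1) (*-identityʳ n)))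

size-cong : ∀ {n} (f : Fin n → Fin n) {u v} → f u ≡ f v → size f u ≡ size f v
size-cong f eq = cong (λ w → ∑ᶠ (λ u → 𝟙 (f u ≟ w))) eq

-- Double counting of the pairs (v, ρ) with `ρ ≡ f v`: only fixed points have a nonempty fibre, and
-- that fibre has `size f ρ` elements. This is the passage between sums over vertices and sums over
-- blocks.
∑-fibre : ∀ {n} (f : Fin n → Fin n) → Idem f → (g : Fin n → ℕ) →
          ∑ᶠ (g ∘ f) ≡ ∑ᶠ (λ ρ → 𝟙 (f ρ ≟ ρ) * (g ρ * size f ρ))
∑-fibre {n} f idem g = begin
  ∑ᶠ (g ∘ f)                                       ≡⟨ ∑-cong (allFin n) (λ v → sym (∑ᶠ-δ (f v) g)) ⟩
  ∑ᶠ (λ v → ∑ᶠ (λ ρ → 𝟙 (ρ ≟ f v) * g ρ))          ≡⟨ ∑-comm (allFin n) (allFin n) _ ⟩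
  ∑ᶠ (λ ρ → ∑ᶠ (λ v → 𝟙 (ρ ≟ f v) * g ρ))          ≡⟨ ∑-cong (allFin n) (λ ρ → ∑-*ʳ (allFin n) (g ρ) _) ⟩
  ∑ᶠ (λ ρ → ∑ᶠ (λ v → 𝟙 (ρ ≟ f v)) * g ρ)          ≡⟨ ∑-cong (allFin n) fibre ⟩
  ∑ᶠ (λ ρ → 𝟙 (f ρ ≟ ρ) * (g ρ * size f ρ))        ∎
  where
  open ≡-Reasoning
  fibre : ∀ ρ → ∑ᶠ (λ v → 𝟙 (ρ ≟ f v)) * g ρ ≡ 𝟙 (f ρ ≟ ρ) * (g ρ * size f ρ)
  fibre ρ with f ρ ≟ ρ
  ... | yes eq = trans (cong (_* g ρ) (∑-cong (allFin n) (λ v → 𝟙-cong (ρ ≟ f v) (f v ≟ f ρ) (λ e → sym (trans eq e)) (λ e → sym (trans e eq)))))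
                       (trans (*-comm (size f ρ) (g ρ)) (sym (+-identityʳ _)))
  ... | no neq = cong (_* g ρ) (trans (∑-cong (allFin n) (λ v → 𝟙-no (ρ ≟ f v) (λ e → neq (trans (cong f e) (trans (idem v) (sym e)))))) (∑-zero (allFin n)))

n≤blocks*max : ∀ {n} (f : Fin n → Fin n) → Idem f → ∀ X → (∀ v → size f v ≤ X) → n ≤ X * blocks f
n≤blocks*max {n} f idem X bound = begin
  n                                          ≡⟨ trans (sym (*-identityʳ n)) (sym (∑ᶠ-const {n} 1)) ⟩
  ∑ᶠ {n} (λ _ → 1)                           ≡⟨ ∑-fibre f idem (λ _ → 1) ⟩
  ∑ᶠ (λ ρ → 𝟙 (f ρ ≟ ρ) * (1 * size f ρ))    ≤⟨ ∑ᶠ-mono (λ ρ → *-monoʳ-≤ (𝟙 (f ρ ≟ ρ)) (≤-trans (≤-reflexive (*-identityˡ _)) (bound ρ))) ⟩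
  ∑ᶠ (λ ρ → 𝟙 (f ρ ≟ ρ) * X)                 ≡⟨ ∑-*ʳ (allFin n) X _ ⟩
  blocks f * X                               ≡⟨ *-comm (blocks f) X ⟩
  X * blocks f                               ∎
  where open ≤-Reasoning

-- A charge of `X` per block is spread over its vertices, each paying `g` of its block size. With a
-- step function for `g`, the number of blocks is bounded by the masses of the size classes.
blocks-weight : ∀ {n} (f : Fin n → Fin n) → Idem f → ∀ X (g : ℕ → ℕ) →
                (∀ v → X ≤ g (size f v) * size f v) → X * blocks f ≤ ∑ᶠ (λ v → g (size f v))
blocks-weight {n} f idem X g bound = begin
  X * blocks f                                           ≡⟨ *-comm X (blocks f) ⟩
  blocks f * X                                           ≡⟨ ∑-*ʳ (allFin n) X _ ⟨
  ∑ᶠ (λ ρ → 𝟙 (f ρ ≟ ρ) * X)                             ≤⟨ ∑ᶠ-mono (λ ρ → *-monoʳ-≤ (𝟙 (f ρ ≟ ρ)) (bound ρ)) ⟩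
  ∑ᶠ (λ ρ → 𝟙 (f ρ ≟ ρ) * (g (size f ρ) * size f ρ))     ≡⟨ ∑-fibre f idem (λ ρ → g (size f ρ)) ⟨
  ∑ᶠ (λ v → g (size f (f v)))                            ≡⟨ ∑-cong (allFin n) (λ v → cong g (size-cong f (idem v))) ⟩
  ∑ᶠ (λ v → g (size f v))                                ∎
  where open ≤-Reasoning

blocks-min : ∀ {n} (f : Fin n → Fin n) → Idem f → ∀ k → (∀ v → k ≤ size f v) → k * blocks f ≤ n
blocks-min {n} f idem k bound =
  ≤-trans (blocks-weight f idem k (λ _ → 1) (λ v → ≤-trans (bound v) (≤-reflexive (sym (*-identityˡ _)))))
          (≤-reflexive (trans (∑ᶠ-const {n} 1) (*-identityʳ n)))

-- Each block other than that of `u` supplies `k` vertices outside the block of `u`; the summand `k`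
-- on the right accounts for the block of `u` itself.
outside-block : ∀ {n} (f : Fin n → Fin n) → Idem f → ∀ k → (∀ v → k ≤ size f v) →
                ∀ u → k * blocks f ≤ k + ∑ᶠ (λ v → 𝟙 (¬? (f u ≟ f v)))
outside-block {n} f idem k bound u = begin
  k * blocks f                                              ≡⟨ ∑-*ˡ (allFin n) k _ ⟨
  ∑ᶠ (λ ρ → k * 𝟙 (f ρ ≟ ρ))                                ≤⟨ ∑ᶠ-mono pointwise ⟩
  ∑ᶠ (λ ρ → 𝟙 (ρ ≟ f u) * k + 𝟙 (f ρ ≟ ρ) * (g ρ * size f ρ)) ≡⟨ ∑-+ (allFin n) _ _ ⟩
  ∑ᶠ (λ ρ → 𝟙 (ρ ≟ f u) * k) + ∑ᶠ (λ ρ → 𝟙 (f ρ ≟ ρ) * (g ρ * size f ρ))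
    ≡⟨ cong₂ _+_ (∑ᶠ-δ (f u) (λ _ → k)) (sym (∑-fibre f idem g)) ⟩
  k + ∑ᶠ (λ v → 𝟙 (¬? (f u ≟ f v)))                         ∎
  where
  open ≤-Reasoning
  g : Fin n → ℕ
  g ρ = 𝟙 (¬? (f u ≟ ρ))
  pointwise : ∀ ρ → k * 𝟙 (f ρ ≟ ρ) ≤ 𝟙 (ρ ≟ f u) * k + 𝟙 (f ρ ≟ ρ) * (g ρ * size f ρ)
  pointwise ρ with f ρ ≟ ρ
  ... | no _ = ≤-trans (≤-reflexive (*-zeroʳ k)) z≤n
  ... | yes _ with f u ≟ ρ
  ...   | yes eq = ≤-trans (≤-reflexive (trans (*-comm k 1) (cong (_* k) (sym (𝟙-yes (ρ ≟ f u) (sym eq)))))) (m≤m+n _ _)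
  ...   | no  _  = ≤-trans (≤-trans (≤-reflexive (*-identityʳ k)) (bound ρ)) (≤-trans (≤-reflexive (sym (trans (+-identityʳ _) (+-identityʳ _)))) (m≤n+m _ (𝟙 (ρ ≟ f u) * k)))

merge : ∀ {n} → (Fin n → Fin n) → Fin n → Fin n → Fin n → Fin n
merge f x y u = if does (f u ≟ f x) then f y else f u

module Merge {n} (f : Fin n → Fin n) (x y : Fin n) (fx≢fy : f x ≢ f y) where

  f′ : Fin n → Fin n
  f′ = merge f x y

  merge-in : ∀ u → f u ≡ f x → f′ u ≡ f y
  merge-in u eq = cong (λ b → if b then f y else f u) (dec-true (f u ≟ f x) eq)

  merge-out : ∀ u → f u ≢ f x → f′ u ≡ f u
  merge-out u neq = cong (λ b → if b then f y else f u) (dec-false (f u ≟ f x) neq)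

  merge-resp : ∀ {u v} → f u ≡ f v → f′ u ≡ f′ v
  merge-resp eq = cong (λ w → if does (w ≟ f x) then f y else w) eq

  merge-joins : f′ x ≡ f′ y
  merge-joins = trans (merge-in x refl) (sym (merge-out y (fx≢fy ∘ sym)))

  merge-splits : ∀ {u v} → f′ u ≡ f′ v → f u ≡ f v ⊎ (f u ≡ f x × f v ≡ f y) ⊎ (f u ≡ f y × f v ≡ f x)
  merge-splits {u} {v} eq with f u ≟ f x | f v ≟ f x
  ... | yes a | yes b = inj₁ (trans a (sym b))
  ... | yes a | no  b = inj₂ (inj₁ (a , sym eq))
  ... | no  a | yes b = inj₂ (inj₂ (eq , b))
  ... | no  a | no  b = inj₁ eq

  merge-idem : Idem f → Idem f′
  merge-idem idem v with f v ≟ f x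
  ... | yes _ = trans (merge-out (f y) (λ e → fx≢fy (sym (trans (sym (idem y)) e)))) (idem y)
  ... | no ne = trans (merge-out (f v) (λ e → ne (trans (sym (idem v)) e))) (idem v)

  -- The fixed point `f x` is lost; the merged block keeps the representative `f y`, and all other
  -- fixed points stay.
  merge-blocks : Idem f → suc (blocks f′) ≡ blocks f
  merge-blocks idem = begin
    1 + blocks f′                                    ≡⟨ cong (_+ blocks f′) (∑ᶠ-𝟙≟ (f x)) ⟨
    ∑ᶠ (λ v → 𝟙 (v ≟ f x)) + blocks f′               ≡⟨ ∑-+ (allFin n) _ _ ⟨
    ∑ᶠ (λ v → 𝟙 (v ≟ f x) + 𝟙 (f′ v ≟ v))            ≡⟨ ∑-cong (allFin n) pointwise ⟩
    blocks f                                         ∎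
    where
    open ≡-Reasoning
    pointwise : ∀ v → 𝟙 (v ≟ f x) + 𝟙 (f′ v ≟ v) ≡ 𝟙 (f v ≟ v)
    pointwise v with f v ≟ f x
    ... | yes eq = trans (cong₂ _+_ (𝟙-cong (v ≟ f x) (f v ≟ v) (λ e → trans eq (sym e)) (λ e → trans (sym e) eq)) (𝟙-no (f y ≟ v) no-fix)) (+-identityʳ _)
      where
      no-fix : f y ≢ v
      no-fix e = fx≢fy (trans (sym eq) (trans (cong f (sym e)) (idem y)))
    ... | no neq = cong (_+ 𝟙 (f v ≟ v)) (𝟙-no (v ≟ f x) (λ e → neq (trans (cong f e) (idem x))))

  merge-size-≤ : ∀ v → size f v ≤ size f′ v
  merge-size-≤ v = ∑ᶠ-mono (λ u → 𝟙-mono (f u ≟ f v) (f′ u ≟ f′ v) merge-resp)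

  merge-size-other : ∀ v → f v ≢ f x → f v ≢ f y → size f′ v ≡ size f v
  merge-size-other v nx ny = ∑-cong (allFin n) (λ u → 𝟙-cong (f′ u ≟ f′ v) (f u ≟ f v) to merge-resp)
    where
    to : ∀ {u} → f′ u ≡ f′ v → f u ≡ f v
    to eq with merge-splits eq
    ... | inj₁ e               = e
    ... | inj₂ (inj₁ (_ , e)) = contradiction e ny
    ... | inj₂ (inj₂ (_ , e)) = contradiction e nx

  merge-size-joined : ∀ v → f v ≡ f x ⊎ f v ≡ f y → size f′ v ≡ size f x + size f y
  merge-size-joined v at = trans (∑-cong (allFin n) pointwise) (∑-+ (allFin n) _ _)
    where
    f′v : f′ v ≡ f y
    f′v = [ merge-in v , (λ e → trans (merge-out v (λ e′ → fx≢fy (trans (sym e′) e))) e) ]′ at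
    pointwise : ∀ u → 𝟙 (f′ u ≟ f′ v) ≡ 𝟙 (f u ≟ f x) + 𝟙 (f u ≟ f y)
    pointwise u rewrite f′v with f u ≟ f x
    ... | yes e = trans (𝟙-yes (f y ≟ f y) refl) (cong suc (sym (𝟙-no (f u ≟ f y) (λ e′ → fx≢fy (trans (sym e) e′)))))
    ... | no  _ = refl

  merge-size-bound : ∀ {a b X} → size f x < a → size f y < b → a + b ≤ X → (∀ v → size f v < X) → ∀ v → size f′ v < X
  merge-size-bound {X = X} x<a y<b ab bound v = cases (f v ≟ f x) (f v ≟ f y)
    where
    joined : f v ≡ f x ⊎ f v ≡ f y → size f′ v < X
    joined at = ≤-trans (≤-reflexive (cong suc (merge-size-joined v at))) (≤-trans (+-mono-< x<a y<b) ab)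
    cases : Dec (f v ≡ f x) → Dec (f v ≡ f y) → size f′ v < X
    cases (yes e) _       = joined (inj₁ e)
    cases (no _)  (yes e) = joined (inj₂ e)
    cases (no nx) (no ny) = ≤-trans (≤-reflexive (cong suc (merge-size-other v nx ny))) (bound v)

  mass-small-≤ : ∀ h → mass f′ (0 , h) ≤ mass f (0 , h)
  mass-small-≤ h = ∑ᶠ-mono (λ v → 𝟙-mono (size f′ v ∈ᴿ? (0 , h)) (size f v ∈ᴿ? (0 , h)) (λ (_ , lt) → z≤n , ≤-<-trans (merge-size-≤ v) lt))

  -- The merged block has outgrown the small range, so the whole old block of `z` leaves the small
  -- mass, while no other vertex can enter it.
  mass-small-drop : ∀ h z → f z ≡ f x ⊎ f z ≡ f y → size f z < h → h ≤ size f x + size f y →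
                    size f z + mass f′ (0 , h) ≤ mass f (0 , h)
  mass-small-drop h z at zlt big = ≤-trans (≤-reflexive (sym (∑-+ (allFin n) _ _))) (∑ᶠ-mono pointwise)
    where
    pointwise : ∀ u → 𝟙 (f u ≟ f z) + 𝟙 (size f′ u ∈ᴿ? (0 , h)) ≤ 𝟙 (size f u ∈ᴿ? (0 , h))
    pointwise u with f u ≟ f z
    ... | yes e = ≤-reflexive (trans (cong suc (𝟙-no (size f′ u ∈ᴿ? (0 , h)) (λ (_ , lt) → <⇒≱ lt (≤-trans big (≤-reflexive (sym (merge-size-joined u at′)))))))
                               (sym (𝟙-yes (size f u ∈ᴿ? (0 , h)) (z≤n , ≤-trans (≤-reflexive (cong suc (size-cong f e))) zlt))))
      where
      at′ : f u ≡ f x ⊎ f u ≡ f y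
      at′ = ⊎-map (trans e) (trans e) at
    ... | no _ = 𝟙-mono (size f′ u ∈ᴿ? (0 , h)) (size f u ∈ᴿ? (0 , h)) (λ (_ , lt) → z≤n , ≤-<-trans (merge-size-≤ u) lt)

-- Forests whose components are the blocks of a partition

-- `respects` and `connects` together say that the blocks of `f` are the components of `G`, so
-- connectivity can be read off from the number of blocks.
record Forest {n} (f : Fin n → Fin n) (G : Graph n) : Set where
  field
    respects : ∀ {u v} → G u v → f u ≡ f v
    connects : ∀ {u v} → f u ≡ f v → Star G u v
    acyclic  : ¬ HasCycle G

all≢⇒∉ : ∀ {A : Set} {x : A} {xs} → All (x ≢_) xs → x ∉ xs
all≢⇒∉ all x∈ = All.lookup all x∈ refl

walk-respects : ∀ {n} {f : Fin n → Fin n} {G : Graph n} → (∀ {u v} → G u v → f u ≡ f v) →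
                ∀ {u} us {v} → Linked G (u ∷ us ++ [ v ]) → f u ≡ f v
walk-respects resp []       (e ∷ [-]) = resp e
walk-respects resp (w ∷ ws) (e ∷ es)  = trans (resp e) (walk-respects resp ws es)

module AddEdge {n} (f : Fin n → Fin n) (G G′ : Graph n) (x y : Fin n) (fx≢fy : f x ≢ f y)
               (forest : Forest f G)
               (old : ∀ {u v} → G u v → G′ u v) (new : G′ x y) (new′ : G′ y x)
               (split : ∀ {u v} → G′ u v → G u v ⊎ ((u , v) ≡ (x , y) ⊎ (v , u) ≡ (x , y))) where
  open Forest forest
  open Merge f x y fx≢fy

  End : Fin n → Set
  End a = a ≡ x ⊎ a ≡ y

  New : Fin n → Fin n → Set
  New u v = (u , v) ≡ (x , y) ⊎ (v , u) ≡ (x , y)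

  new-labels : ∀ {u v} → New u v → f u ≢ f v
  new-labels (inj₁ refl) = fx≢fy
  new-labels (inj₂ refl) = fx≢fy ∘ sym

  new-endˡ : ∀ {u v} → New u v → End u
  new-endˡ (inj₁ refl) = inj₁ refl
  new-endˡ (inj₂ refl) = inj₂ refl

  new-endʳ : ∀ {u v} → New u v → End v
  new-endʳ (inj₁ refl) = inj₂ refl
  new-endʳ (inj₂ refl) = inj₁ refl

  other-end : ∀ {u v w} → New u v → New v w → w ≡ u
  other-end (inj₁ refl) (inj₁ refl) = refl
  other-end (inj₁ refl) (inj₂ refl) = refl
  other-end (inj₂ refl) (inj₁ refl) = refl
  other-end (inj₂ refl) (inj₂ refl) = refl

  new-contains : ∀ {a u v} → End a → New u v → a ≡ u ⊎ a ≡ v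
  new-contains (inj₁ refl) (inj₁ refl) = inj₁ refl
  new-contains (inj₁ refl) (inj₂ refl) = inj₂ refl
  new-contains (inj₂ refl) (inj₁ refl) = inj₂ refl
  new-contains (inj₂ refl) (inj₂ refl) = inj₁ refl

  -- An end of the new edge that a walk never visits keeps the walk from using that edge.
  avoiding : ∀ {a} → End a → ∀ {L} → Linked G′ L → a ∉ L → Linked G L
  avoiding end []       a∉ = []
  avoiding end [-]      a∉ = [-]
  avoiding end (e ∷ es) a∉ with split e
  ... | inj₁ g = g ∷ avoiding end es (a∉ ∘ there)
  ... | inj₂ p = contradiction (cases (new-contains end p)) a∉
    where
    cases : ∀ {a u v L} → a ≡ u ⊎ a ≡ v → a ∈ u ∷ v ∷ L
    cases (inj₁ refl) = here refl
    cases (inj₂ refl) = there (here refl)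

  ∉-snoc : ∀ {a v : Fin n} {us} → a ∉ us → a ≢ v → a ∉ us ++ [ v ]
  ∉-snoc {us = us} a∉ a≢v a∈ with ∈-++⁻ us a∈
  ... | inj₁ p        = a∉ p
  ... | inj₂ (here e) = a≢v e

  -- If the first edge, from `u` to `w`, were new, the rest of the walk would avoid `u` and hence
  -- lie in `G`, giving `w` the label of `v`, which is that of `u`; but the ends of the new edge
  -- have different labels. An old first edge preserves the label, and the argument repeats from
  -- `w`.
  closed-walk : ∀ {u} us {v} → Linked G′ (u ∷ us ++ [ v ]) → Unique (u ∷ us) → v ∉ u ∷ us → f u ≡ f v →
                Linked G (u ∷ us ++ [ v ])
  closed-walk [] (e ∷ [-]) uniq v∉ eq with split e
  ... | inj₁ g = g ∷ [-]
  ... | inj₂ p = contradiction eq (new-labels p)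
  closed-walk (w ∷ us) (e ∷ es) (u≢ ∷ uniq) v∉ eq with split e
  ... | inj₁ g = g ∷ closed-walk us es uniq (v∉ ∘ there) (trans (sym (respects g)) eq)
  ... | inj₂ p = contradiction (trans eq (sym (walk-respects respects us (avoiding (new-endˡ p) es (∉-snoc (all≢⇒∉ u≢) (λ e → v∉ (here (sym e)))))))) (new-labels p)

  -- A cycle through the new edge would return to the other component without using that edge again.
  no-cycle : ¬ HasCycle G′
  no-cycle (v , [] , () , _)
  no-cycle (v , _ ∷ [] , s≤s () , _)
  no-cycle (v , w ∷ w′ ∷ ws , len , (v≢ ∷ w≢ ∷ uniq) , e ∷ e′ ∷ es) with split e
  ... | inj₁ g = acyclic (v , w ∷ w′ ∷ ws , len , (v≢ ∷ w≢ ∷ uniq) ,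
                          g ∷ closed-walk (w′ ∷ ws) (e′ ∷ es) (w≢ ∷ uniq) (all≢⇒∉ v≢) (sym (respects g)))
  ... | inj₂ p with split e′
  ...   | inj₂ p′ = all≢⇒∉ v≢ (there (here (sym (other-end p p′))))
  ...   | inj₁ g′ = new-labels p (sym (trans (respects g′) (walk-respects respects ws (avoiding (new-endʳ p) es (∉-snoc (all≢⇒∉ w≢) (λ e → all≢⇒∉ v≢ (here (sym e))))))))

  add-edge : Forest f′ G′
  add-edge = record
    { respects = λ g → case split g of λ where
        (inj₁ g)           → merge-resp (respects g)
        (inj₂ (inj₁ refl)) → merge-joins
        (inj₂ (inj₂ refl)) → sym merge-joins
    ; connects = λ eq → case merge-splits eq of λ where
        (inj₁ e)              → star e
        (inj₂ (inj₁ (a , b))) → star a ◅◅ (new ◅ star (sym b))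
        (inj₂ (inj₂ (a , b))) → star a ◅◅ (new′ ◅ star (sym b))
    ; acyclic  = no-cycle
    }
    where
    star : ∀ {u v} → f u ≡ f v → Star G′ u v
    star e = mapˢ old (connects e)

-- The edges of the complete graph

allEdges : ∀ n → List (Edge n)
allEdges zero    = []
allEdges (suc n) = map (λ i → (zero , suc i) , s≤s z≤n) (allFin n)
                ++ map (λ ((u , v) , lt) → (suc u , suc v) , s≤s lt) (allEdges n)

length-allEdges : ∀ n → length (allEdges n) ≡ N n
length-allEdges zero    = refl
length-allEdges (suc n) = begin
  length (allEdges (suc n))           ≡⟨ length-++ (map _ (allFin n)) ⟩
  length (map _ (allFin n)) + length (map _ (allEdges n))
    ≡⟨ cong₂ _+_ (trans (length-map _ (allFin n)) (length-tabulate {n = n} id)) (trans (length-map _ (allEdges n)) (length-allEdges n)) ⟩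
  n + n C 2                           ≡⟨ cong (_+ n C 2) (nC1≡n n) ⟨
  n C 1 + n C 2                       ≡⟨ nCk+nC[k+1]≡[n+1]C[k+1] n 1 ⟩
  suc n C 2                           ∎
  where open ≡-Reasoning

∈-allEdges : ∀ {n} (e : Edge n) → e ∈ allEdges n
∈-allEdges {suc n} ((zero  , suc v) , s≤s z≤n) = ∈-++⁺ˡ (∈-map⁺ _ (∈-allFin v))
∈-allEdges {suc n} ((suc u , suc v) , s≤s lt)  =
  ∈-++⁺ʳ (map (λ i → (zero , suc i) , s≤s z≤n) (allFin n)) (∈-map⁺ _ (∈-allEdges ((u , v) , lt)))

unique-allEdges : ∀ n → Unique (allEdges n)
unique-allEdges zero    = []
unique-allEdges (suc n) = Unique.++⁺
  (Unique.map⁺ (λ { refl → refl }) (Unique.allFin⁺ n))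
  (Unique.map⁺ (λ { {_ , lt} {_ , lt′} refl → refl }) (unique-allEdges n))
  disjoint
  where
  disjoint : ∀ {e} → ¬ (e ∈ map (λ i → (zero , suc i) , s≤s z≤n) (allFin n) × e ∈ map (λ ((u , v) , lt) → (suc u , suc v) , s≤s lt) (allEdges n))
  disjoint (p , q) with ∈-map⁻ _ p | ∈-map⁻ _ q
  ... | _ , _ , refl | _ , _ , ()

-- An ordered pair is an edge in one of its two directions or lies on the diagonal. Edge counts thus
-- become counts of ordered pairs, in which the two ends range independently.
∑-allEdges : ∀ n (F : Fin n → Fin n → ℕ) →
             ∑ (allEdges n) (λ ((u , v) , _) → F u v + F v u) + ∑ᶠ (λ u → F u u) ≡ ∑ᶠ (λ u → ∑ᶠ (F u))
∑-allEdges zero    F = refl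
∑-allEdges (suc n) F = begin
  ∑ (allEdges (suc n)) (λ ((u , v) , _) → F u v + F v u) + ∑ᶠ (λ u → F u u)
    ≡⟨ cong₂ _+_ (trans (∑-++ (map _ (allFin n)) _ _) (cong₂ _+_ (trans (∑-map _ (allFin n) _) (∑-+ (allFin n) _ _)) (∑-map _ (allEdges n) _))) (∑ᶠ-suc (λ u → F u u)) ⟩
  (∑ᶠ (λ i → F zero (suc i)) + ∑ᶠ (λ i → F (suc i) zero)) + E + (F zero zero + D)
    ≡⟨ rearrange (∑ᶠ (λ i → F zero (suc i))) _ E (F zero zero) D ⟩
  (F zero zero + ∑ᶠ (λ i → F zero (suc i))) + (∑ᶠ (λ i → F (suc i) zero) + (E + D))
    ≡⟨ cong₂ _+_ (sym (∑ᶠ-suc (F zero))) (cong (∑ᶠ (λ i → F (suc i) zero) +_) (∑-allEdges n (λ u v → F (suc u) (suc v)))) ⟩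
  ∑ᶠ (F zero) + (∑ᶠ (λ i → F (suc i) zero) + ∑ᶠ (λ u → ∑ᶠ (λ v → F (suc u) (suc v))))
    ≡⟨ cong (∑ᶠ (F zero) +_) (trans (sym (∑-+ (allFin n) _ _)) (∑-cong (allFin n) (λ u → sym (∑ᶠ-suc (F (suc u)))))) ⟩
  ∑ᶠ (F zero) + ∑ᶠ (λ u → ∑ᶠ (F (suc u)))
    ≡⟨ sym (∑ᶠ-suc (λ u → ∑ᶠ (F u))) ⟩
  ∑ᶠ (λ u → ∑ᶠ (F u)) ∎
  where
  open ≡-Reasoning
  E D : ℕ
  E = ∑ (allEdges n) (λ ((u , v) , _) → F (suc u) (suc v) + F (suc v) (suc u))
  D = ∑ᶠ (λ u → F (suc u) (suc u))
  rearrange : ∀ a b c d e → (a + b) + c + (d + e) ≡ (d + a) + (b + (c + e))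
  rearrange = solve-∀

-- Uniform orderings, exposed row by row

picks : ∀ {A : Set} {p} → Vec A (suc p) → List (A × Vec A p)
picks {p = zero}  (x ∷ [])         = [ x , [] ]
picks {p = suc p} (x ∷ xs) = (x , xs) ∷ map (λ (y , ys) → y , x ∷ ys) (picks xs)

∑-picks : ∀ {A : Set} {p} (v : Vec A (suc p)) (g : A → ℕ) → ∑ (picks v) (g ∘ proj₁) ≡ ∑ (toList v) g
∑-picks {p = zero}  (x ∷ [])         g = refl
∑-picks {p = suc p} (x ∷ xs) g = cong (g x +_) (trans (∑-map _ (picks xs) (g ∘ proj₁)) (∑-picks xs g))

picks-↭ : ∀ {A : Set} {p} (v : Vec A (suc p)) {y ys} → (y , ys) ∈ picks v → toList v ↭ y ∷ toList ys
picks-↭ {p = zero}  (x ∷ [])         (here refl) = ↭-refl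
picks-↭ {p = suc p} (x ∷ xs) (here refl) = ↭-refl
picks-↭ {p = suc p} (x ∷ xs) (there y∈)  with ∈-map⁻ _ y∈
... | (y , ys) , y∈′ , refl = ↭-trans (↭-prep x (picks-↭ xs y∈′)) (↭-swap x y ↭-refl)

∈-picks : ∀ {A : Set} {p} (v : Vec A (suc p)) {y} → y ∈ toList v → ∃ λ ys → (y , ys) ∈ picks v
∈-picks {p = zero}  (x ∷ [])         (here refl) = [] , here refl
∈-picks {p = suc p} (x ∷ xs) (here refl) = xs , here refl
∈-picks {p = suc p} (x ∷ xs) (there y∈) with ∈-picks xs y∈
... | ys , p∈ = x ∷ ys , there (∈-map⁺ _ p∈)

UniqueBy : ∀ {A K : Set} → (A → K) → List A → Set
UniqueBy key = AllPairs (λ a b → key a ≢ key b)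

-- `π` recovers from the key of a result the key of the item that produced it, so results of
-- different items cannot collide.
uniqueBy-concatMap : ∀ {A B K L : Set} {key : A → K} {key′ : B → L} (π : L → K) (h : A → List B) (xs : List A) →
                     UniqueBy key xs → (∀ x → x ∈ xs → UniqueBy key′ (h x)) →
                     (∀ x b → b ∈ h x → π (key′ b) ≡ key x) → UniqueBy key′ (concatMap h xs)
uniqueBy-concatMap π h []       uniq          each at = []
uniqueBy-concatMap π h (x ∷ xs) (x≢ ∷ uniq) each at =
  AllPairs.++⁺ (each x (here refl)) (uniqueBy-concatMap π h xs uniq (λ y y∈ → each y (there y∈)) at)
    (All.tabulate (λ {a} a∈ → All.tabulate (λ {b} b∈ eq → separate a∈ b∈ eq)))
  where
  separate : ∀ {a b} → a ∈ h x → b ∈ concatMap h xs → _ ≡ _ → ⊥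
  separate {a} {b} a∈ b∈ eq with find (∈-concatMap⁻ h {xs = xs} b∈)
  ... | y , y∈ , b∈hy = All.lookup x≢ y∈ (trans (sym (at x a a∈)) (trans (cong π eq) (at y b b∈hy)))

uniqueBy-picks : ∀ {A : Set} {p} (v : Vec A (suc p)) → Unique (toList v) → UniqueBy proj₁ (picks v)
uniqueBy-picks v uniq = AllPairs.map⁻ (subst Unique (sym (map-picks v)) uniq)
  where
  map-picks : ∀ {A : Set} {p} (v : Vec A (suc p)) → map proj₁ (picks v) ≡ toList v
  map-picks {p = zero}  (x ∷ [])         = refl
  map-picks {p = suc p} (x ∷ xs) = cong (x ∷_) (trans (sym (map-∘ (picks xs))) (map-picks xs))

Pools : Set → ℕ → ℕ → Set
Pools A s p = Vec (Vec A p) s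

choices : ∀ {A : Set} {s p} → Pools A s (suc p) → List (Vec (A × Vec A p) s)
choices []      = [ [] ]
choices (v ∷ P) = concatMap (λ y → map (y ∷_) (choices P)) (picks v)

heads : ∀ {A : Set} {s p} → Vec (A × Vec A p) s → Vec A s
heads = mapᵛ proj₁

rests : ∀ {A : Set} {s p} → Vec (A × Vec A p) s → Pools A s p
rests = mapᵛ proj₂

∑-choices-∷ : ∀ {A : Set} {s p} (v : Vec A (suc p)) (P : Pools A s (suc p)) (f : Vec (A × Vec A p) (suc s) → ℕ) →
              ∑ (choices (v ∷ P)) f ≡ ∑ (picks v) (λ y → ∑ (choices P) (λ ys → f (y ∷ ys)))
∑-choices-∷ v P f = trans (∑-concatMap _ (picks v) f) (∑-cong (picks v) (λ y → ∑-map (y ∷_) (choices P) f))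

-- This is the independence of the colours within one row.
∑-choices-∏ : ∀ {A : Set} {s p} (P : Pools A s (suc p)) (g : Fin s → A → ℕ) →
              ∑ (choices P) (λ y → ∏ᶠ (λ j → g j (lookup (heads y) j))) ≡ ∏ᶠ (λ j → ∑ (toList (lookup P j)) (g j))
∑-choices-∏ []      g = refl
∑-choices-∏ (v ∷ P) g = begin
  ∑ (choices (v ∷ P)) _
    ≡⟨ ∑-choices-∷ v P _ ⟩
  ∑ (picks v) (λ y → ∑ (choices P) (λ ys → g zero (proj₁ y) * rest ys))
    ≡⟨ ∑-cong (picks v) (λ y → ∑-*ˡ (choices P) (g zero (proj₁ y)) rest) ⟩
  ∑ (picks v) (λ y → g zero (proj₁ y) * ∑ (choices P) rest)
    ≡⟨ ∑-*ʳ (picks v) (∑ (choices P) rest) _ ⟩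
  ∑ (picks v) (g zero ∘ proj₁) * ∑ (choices P) rest
    ≡⟨ cong₂ _*_ (∑-picks v (g zero)) (∑-choices-∏ P (g ∘ suc)) ⟩
  ∏ᶠ (λ j → ∑ (toList (lookup (v ∷ P) j)) (g j)) ∎
  where
  open ≡-Reasoning
  rest : Vec _ _ → ℕ
  rest ys = ∏ᶠ (λ j → g (suc j) (lookup (heads ys) j))

length-toList : ∀ {A : Set} {p} (v : Vec A p) → length (toList v) ≡ p
length-toList []       = refl
length-toList (x ∷ xs) = cong suc (length-toList xs)

length-picks : ∀ {A : Set} {p} (v : Vec A (suc p)) → length (picks v) ≡ suc p
length-picks {p = zero}  (x ∷ []) = refl
length-picks {p = suc p} (x ∷ xs) = cong suc (trans (length-map _ (picks xs)) (length-picks xs))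

length-choices : ∀ {A : Set} {s p} (P : Pools A s (suc p)) → length (choices P) ≡ suc p ^ s
length-choices []      = refl
length-choices {s = suc s} {p} (v ∷ P) = begin
  length (choices (v ∷ P))                             ≡⟨ trans (sym (*-identityʳ _)) (sym (∑-const (choices (v ∷ P)) 1)) ⟩
  ∑ (choices (v ∷ P)) (λ _ → 1)                        ≡⟨ ∑-choices-∷ v P (λ _ → 1) ⟩
  ∑ (picks v) (λ _ → ∑ (choices P) (λ _ → 1))          ≡⟨ ∑-const (picks v) _ ⟩
  length (picks v) * ∑ (choices P) (λ _ → 1)           ≡⟨ cong₂ _*_ (length-picks v) (trans (∑-const (choices P) 1) (trans (*-identityʳ _) (length-choices P))) ⟩
  suc p ^ suc s                                        ∎
  where open ≡-Reasoning

-- The edge of a uniform row in colour `j` is uniform in pool `j`; the factor `suc p` on the left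
-- replaces a division.
∑-choices-at : ∀ {A : Set} {s p} (P : Pools A s (suc p)) (j : Fin s) (f : A → ℕ) →
               suc p * ∑ (choices P) (λ y → f (lookup (heads y) j)) ≡ suc p ^ s * ∑ (toList (lookup P j)) f
∑-choices-at {s = suc s} {p} (v ∷ P) zero f = begin
  suc p * ∑ (choices (v ∷ P)) _                                       ≡⟨ cong (suc p *_) (∑-choices-∷ v P _) ⟩
  suc p * ∑ (picks v) (λ y → ∑ (choices P) (λ _ → f (proj₁ y)))       ≡⟨ cong (suc p *_) (∑-cong (picks v) (λ y → ∑-const (choices P) (f (proj₁ y)))) ⟩
  suc p * ∑ (picks v) (λ y → length (choices P) * f (proj₁ y))        ≡⟨ cong (suc p *_) (trans (∑-*ˡ (picks v) (length (choices P)) (f ∘ proj₁)) (cong₂ _*_ (length-choices P) (∑-picks v f))) ⟩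
  suc p * (suc p ^ s * ∑ (toList v) f)                                ≡⟨ *-assoc (suc p) (suc p ^ s) _ ⟨
  suc p ^ suc s * ∑ (toList v) f                                      ∎
  where open ≡-Reasoning
∑-choices-at {s = suc s} {p} (v ∷ P) (suc j) f = begin
  suc p * ∑ (choices (v ∷ P)) _                                       ≡⟨ cong (suc p *_) (trans (∑-choices-∷ v P _) (trans (∑-const (picks v) S) (cong (_* S) (length-picks v)))) ⟩
  suc p * (suc p * S)                                                 ≡⟨ cong (suc p *_) (∑-choices-at P j f) ⟩
  suc p * (suc p ^ s * ∑ (toList (lookup P j)) f)                     ≡⟨ *-assoc (suc p) (suc p ^ s) _ ⟨
  suc p ^ suc s * ∑ (toList (lookup P j)) f                           ∎
  where
  open ≡-Reasoning
  S : ℕ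
  S = ∑ (choices P) (λ y → f (lookup (heads y) j))

∈-choices⁻ : ∀ {A : Set} {s p} (P : Pools A s (suc p)) {y} → y ∈ choices P → ∀ j → lookup y j ∈ picks (lookup P j)
∈-choices⁻ (v ∷ P) y∈ j with find (∈-concatMap⁻ (λ y → map (y ∷_) (choices P)) {xs = picks v} y∈)
... | y₀ , y₀∈ , y∈′ with ∈-map⁻ (y₀ ∷_) y∈′
∈-choices⁻ (v ∷ P) y∈ zero    | y₀ , y₀∈ , y∈′ | ys , ys∈ , refl = y₀∈
∈-choices⁻ (v ∷ P) y∈ (suc j) | y₀ , y₀∈ , y∈′ | ys , ys∈ , refl = ∈-choices⁻ P ys∈ j

uniqueBy-choices : ∀ {A : Set} {s p} (P : Pools A s (suc p)) → (∀ j → Unique (toList (lookup P j))) → UniqueBy heads (choices P)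
uniqueBy-choices []      uniq = [] ∷ []
uniqueBy-choices {s = suc s} (v ∷ P) uniq = uniqueBy-concatMap (headᵛ {n = s}) _ (picks v) (uniqueBy-picks v (uniq zero))
  (λ y _ → AllPairs.map⁺ (AllPairs-weaken {y = y} (uniqueBy-choices P (uniq ∘ suc))))
  (λ y b b∈ → case ∈-map⁻ (y ∷_) b∈ of λ { (_ , _ , refl) → refl })
  where
  AllPairs-weaken : ∀ {A : Set} {s p} {y : A × Vec A p} {ys : List (Vec (A × Vec A p) s)} → UniqueBy heads ys → AllPairs (λ a b → heads (y ∷ a) ≢ heads (y ∷ b)) ys
  AllPairs-weaken = AllPairs′.map (λ neq eq → neq (cong tailᵛ eq))

-- The sample space is generated as a tree: a first row, then all ways to continue with the
-- remaining pools. Conditioning on the exposed rows is restriction to a subtree.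
outcomes : ∀ {A : Set} {s} p → Pools A s p → List (Pools A s p)
outcomes         zero    P = [ P ]
outcomes         (suc p) P = concatMap (λ y → map (zipWithᵛ _∷_ (heads y)) (outcomes p (rests y))) (choices P)

∑-outcomes : ∀ {A : Set} {s p} (P : Pools A s (suc p)) (f : Pools A s (suc p) → ℕ) →
             ∑ (outcomes (suc p) P) f ≡ ∑ (choices P) (λ y → ∑ (outcomes p (rests y)) (λ ω → f (zipWithᵛ _∷_ (heads y) ω)))
∑-outcomes {p = p} P f = trans (∑-concatMap _ (choices P) f) (∑-cong (choices P) (λ y → ∑-map _ (outcomes p (rests y)) f))

#outcomes : ℕ → ℕ → ℕ
#outcomes s zero    = 1
#outcomes s (suc p) = suc p ^ s * #outcomes s p

length-outcomes : ∀ {A : Set} {s} p (P : Pools A s p) → length (outcomes p P) ≡ #outcomes s p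
length-outcomes zero    P = refl
length-outcomes {s = s} (suc p) P = begin
  length (outcomes (suc p) P)                                   ≡⟨ trans (sym (*-identityʳ _)) (sym (∑-const (outcomes (suc p) P) 1)) ⟩
  ∑ (outcomes (suc p) P) (λ _ → 1)                              ≡⟨ ∑-outcomes P (λ _ → 1) ⟩
  ∑ (choices P) (λ y → ∑ (outcomes p (rests y)) (λ _ → 1))      ≡⟨ ∑-cong (choices P) (λ y → trans (∑-const (outcomes p (rests y)) 1) (trans (*-identityʳ _) (length-outcomes p (rests y)))) ⟩
  ∑ (choices P) (λ _ → #outcomes s p)                           ≡⟨ ∑-const (choices P) _ ⟩
  length (choices P) * #outcomes s p                            ≡⟨ cong (_* #outcomes s p) (length-choices P) ⟩
  suc p ^ s * #outcomes s p                                     ∎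
  where open ≡-Reasoning

map-head-zip : ∀ {A : Set} {s p} (x : Vec A s) (ω : Pools A s p) → mapᵛ headᵛ (zipWithᵛ _∷_ x ω) ≡ x
map-head-zip []      []      = refl
map-head-zip (a ∷ x) (c ∷ ω) = cong (a ∷_) (map-head-zip x ω)

map-tail-zip : ∀ {A : Set} {s p} (x : Vec A s) (ω : Pools A s p) → mapᵛ tailᵛ (zipWithᵛ _∷_ x ω) ≡ ω
map-tail-zip []      []      = refl
map-tail-zip (a ∷ x) (c ∷ ω) = cong (c ∷_) (map-tail-zip x ω)

zip-head-tail : ∀ {A : Set} {s p} (ω : Pools A s (suc p)) → zipWithᵛ _∷_ (mapᵛ headᵛ ω) (mapᵛ tailᵛ ω) ≡ ω
zip-head-tail []            = refl
zip-head-tail ((a ∷ c) ∷ ω) = cong ((a ∷ c) ∷_) (zip-head-tail ω)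

Unique-resp-↭ : ∀ {A : Set} {xs ys : List A} → xs ↭ ys → Unique xs → Unique ys
Unique-resp-↭ {A} p = ↭ₛ.Unique-resp-↭ (setoid A) (↭⇒↭ₛ p)

_≋_ : ∀ {A : Set} {s p} → Pools A s p → Pools A s p → Set
ω ≋ P = ∀ j → toList (lookup ω j) ↭ toList (lookup P j)

rests-unique : ∀ {A : Set} {s p} (P : Pools A s (suc p)) {y} → y ∈ choices P → (∀ j → Unique (toList (lookup P j))) →
               ∀ j → Unique (toList (lookup (rests y) j))
rests-unique P {y} y∈ uniq j rewrite lookup-map j proj₂ y = AllPairs-tail (Unique-resp-↭ (picks-↭ (lookup P j) (∈-choices⁻ P y∈ j)) (uniq j))
  where
  AllPairs-tail : ∀ {A : Set} {x : A} {xs} → Unique (x ∷ xs) → Unique xs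
  AllPairs-tail (_ ∷ uniq) = uniq

unique-outcomes : ∀ {A : Set} {s} p (P : Pools A s p) → (∀ j → Unique (toList (lookup P j))) → Unique (outcomes p P)
unique-outcomes zero    P uniq = [] ∷ []
unique-outcomes (suc p) P uniq = uniqueBy-concatMap (mapᵛ headᵛ) _ (choices P) (uniqueBy-choices P uniq)
  (λ y y∈ → Unique.map⁺ (λ {ω} {ω′} eq → trans (sym (map-tail-zip (heads y) ω)) (trans (cong (mapᵛ tailᵛ) eq) (map-tail-zip (heads y) ω′)))
              (unique-outcomes p (rests y) (rests-unique P y∈ uniq)))
  (λ y b b∈ → case ∈-map⁻ _ b∈ of λ { (ω , _ , refl) → map-head-zip (heads y) ω })

outcomes-sound : ∀ {A : Set} {s} p (P : Pools A s p) {ω} → ω ∈ outcomes p P → ω ≋ P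
outcomes-sound zero    P (here refl) j = ↭-refl
outcomes-sound (suc p) P ω∈ j with find (∈-concatMap⁻ _ {xs = choices P} ω∈)
... | y , y∈ , ω∈′ with ∈-map⁻ _ ω∈′
...   | ω , ω∈″ , refl = subst (λ c → toList c ↭ toList (lookup P j))
  (sym (trans (lookup-zipWith _∷_ j (heads y) ω) (cong (_∷ lookup ω j) (lookup-map j proj₁ y))))
  (↭-trans (↭-prep _ (subst (λ r → toList (lookup ω j) ↭ toList r) (lookup-map j proj₂ y) (outcomes-sound p (rests y) ω∈″ j)))
           (↭-sym (picks-↭ (lookup P j) (∈-choices⁻ P y∈ j))))

find-choice : ∀ {A : Set} {s p} (P ω : Pools A s (suc p)) → ω ≋ P →
              ∃ λ y → y ∈ choices P × heads y ≡ mapᵛ headᵛ ω × mapᵛ tailᵛ ω ≋ rests y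
find-choice []      []            perm = [] , here refl , refl , λ ()
find-choice (v ∷ P) ((a ∷ c) ∷ ω) perm with ∈-picks v (∈-resp-↭ (perm zero) (here refl)) | find-choice P ω (perm ∘ suc)
... | r , r∈ | y , y∈ , heads≡ , tails = (a , r) ∷ y , ∈-concatMap⁺ _ (lose r∈ (∈-map⁺ _ y∈)) , cong (a ∷_) heads≡ ,
      λ { zero → drop-∷ (↭-trans (perm zero) (picks-↭ v r∈)) ; (suc j) → tails j }

outcomes-complete : ∀ {A : Set} {s} p (P ω : Pools A s p) → ω ≋ P → ω ∈ outcomes p P
outcomes-complete zero    P ω perm = here (empty ω P)
  where
  empty : ∀ {A : Set} {s} (ω P : Pools A s 0) → ω ≡ P
  empty []       []       = refl
  empty ([] ∷ ω) ([] ∷ P) = cong ([] ∷_) (empty ω P)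
outcomes-complete (suc p) P ω perm with find-choice P ω perm
... | y , y∈ , heads≡ , tails =
  ∈-concatMap⁺ _ (lose y∈ (subst (_∈ map (zipWithᵛ _∷_ (heads y)) (outcomes p (rests y)))
    (trans (cong (λ h → zipWithᵛ _∷_ h (mapᵛ tailᵛ ω)) heads≡) (zip-head-tail ω))
    (∈-map⁺ _ (outcomes-complete p (rests y) (mapᵛ tailᵛ ω) tails))))

unique-≋ : ∀ {A : Set} {xs ys : List A} → Unique xs → Unique ys → (∀ x → x ∈ ys) → (∀ x → x ∈ xs) → xs ↭ ys
unique-≋ ux uy ∈ys ∈xs = ∼bag⇒↭ (unique∧set⇒bag ux uy (mk⇔ (λ _ → ∈ys _) (λ _ → ∈xs _)))

-- States, strategies and runs

Row : ℕ → ℕ → Set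
Row n s = Vec (Edge n) s

RowGraph : ∀ {n s} → List (Row n s) → Fin s → Graph n
RowGraph R j u v = ∃ λ x → x ∈ R × Joins (lookup x j) u v

-- One `count` serves all colours, because an accepted row merges two blocks in each of them. `used`
-- keeps the rejected rows as well, since they have left the pools too.
record State (n s : ℕ) : Set where
  constructor state
  field
    label    : Fin s → Fin n → Fin n
    count    : ℕ
    accepted : List (Row n s)
    used     : List (Row n s)
open State

-- In every colour, the block sizes required of the two blocks that an accepted edge merges.
Strategy : ℕ → ℕ → Set
Strategy n s = State n s → Fin s → Range × Range

Admissible : ∀ {n} → (Fin n → Fin n) → Range × Range → Edge n → Set
Admissible f (A , B) ((u , v) , _) =
  f u ≢ f v × ((size f u ∈ᴿ A × size f v ∈ᴿ B) ⊎ (size f v ∈ᴿ A × size f u ∈ᴿ B))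

admissible? : ∀ {n} (f : Fin n → Fin n) R e → Dec (Admissible f R e)
admissible? f (A , B) ((u , v) , _) =
  ¬? (f u ≟ f v) ×-dec ((size f u ∈ᴿ? A ×-dec size f v ∈ᴿ? B) ⊎-dec (size f v ∈ᴿ? A ×-dec size f u ∈ᴿ? B))

Accepts : ∀ {n s} → Strategy n s → State n s → Row n s → Set
Accepts π σ x = ∀ j → Admissible (label σ j) (π σ j) (lookup x j)

accepts? : ∀ {n s} (π : Strategy n s) σ x → Dec (Accepts π σ x)
accepts? π σ x = all? (λ j → admissible? (label σ j) (π σ j) (lookup x j))

mergeEdge : ∀ {n} → (Fin n → Fin n) → Edge n → Fin n → Fin n
mergeEdge f ((u , v) , _) = merge f u v

accept reject : ∀ {n s} → Row n s → State n s → State n s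
accept x (state f r acc us) = state (λ j → mergeEdge (f j) (lookup x j)) (r ∸ 1) (x ∷ acc) (x ∷ us)
reject x (state f r acc us) = state f r acc (x ∷ us)

step : ∀ {n s} → Strategy n s → Row n s → State n s → State n s
step π x σ = if does (accepts? π σ x) then accept x σ else reject x σ

if-elim : ∀ {A Q : Set} {a b : A} (P : A → Set) (d : Dec Q) → (Q → P a) → P b → P (if does d then a else b)
if-elim P (yes q) pa pb = pa q
if-elim P (no  _) pa pb = pb

step-elim : ∀ {n s} (π : Strategy n s) x σ (P : State n s → Set) →
            (Accepts π σ x → P (accept x σ)) → P (reject x σ) → P (step π x σ)
step-elim π x σ P = if-elim P (accepts? π σ x)

step-used : ∀ {n s} (π : Strategy n s) x σ → used (step π x σ) ≡ x ∷ used σ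
step-used π x σ = step-elim π x σ (λ σ′ → used σ′ ≡ x ∷ used σ) (λ _ → refl) refl

run : ∀ {n s p} → List (Strategy n s) → Pools (Edge n) s p → State n s → State n s
run             []       ω σ = σ
-- The rows have run out and the remaining strategies are dropped; the schedule used in the end is
-- shorter than `N n`.
run {p = zero}  (π ∷ πs) ω σ = σ
run {p = suc p} (π ∷ πs) ω σ = run πs (mapᵛ tailᵛ ω) (step π (mapᵛ headᵛ ω) σ)

run-elim : ∀ {n s p} (P : State n s → Set) → (∀ π x σ → P σ → P (step π x σ)) →
           ∀ πs (ω : Pools (Edge n) s p) σ → P σ → P (run πs ω σ)
run-elim             P closed []       ω σ Pσ = Pσ
run-elim {p = zero}  P closed (π ∷ πs) ω σ Pσ = Pσ
run-elim {p = suc p} P closed (π ∷ πs) ω σ Pσ = run-elim P closed πs (mapᵛ tailᵛ ω) _ (closed π _ σ Pσ)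

record Sound {n s} (σ : State n s) : Set where
  field
    idem   : ∀ j → Idem (label σ j)
    count≡ : ∀ j → blocks (label σ j) ≡ count σ
    forest : ∀ j → Forest (label σ j) (RowGraph (accepted σ) j)

sound-step : ∀ {n s} (π : Strategy n s) x σ → Sound σ → Sound (step π x σ)
sound-step {n} {s} π x σ snd = step-elim π x σ Sound accepted-case rejected-case
  where
  open Sound snd
  rejected-case : Sound (reject x σ)
  rejected-case = record { idem = idem ; count≡ = count≡ ; forest = forest }
  accepted-case : Accepts π σ x → Sound (accept x σ)
  accepted-case acc = record
    { idem   = λ j → merge-idem j (idem j)
    ; count≡ = λ j → ∸1-cancel (trans (merge-blocks j (idem j)) (count≡ j))
    ; forest = λ j → AddEdge.add-edge (label σ j) (RowGraph (accepted σ) j) (RowGraph (x ∷ accepted σ) j) _ _ (proj₁ (acc j)) (forest j)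
                       (λ (y , y∈ , joins) → y , there y∈ , joins)
                       (x , here refl , inj₁ refl) (x , here refl , inj₂ refl)
                       (λ { (y , here refl , joins) → inj₂ joins ; (y , there y∈ , joins) → inj₁ (y , y∈ , joins) })
    }
    where
    module _ (j : Fin s) where
      open Merge (label σ j) (proj₁ (proj₁ (lookup x j))) (proj₂ (proj₁ (lookup x j))) (proj₁ (acc j)) public using (merge-idem; merge-blocks)
    ∸1-cancel : ∀ {a b} → suc a ≡ b → a ≡ b ∸ 1
    ∸1-cancel refl = refl

initial : ∀ n s → State n s
initial n s = state (λ _ → id) n [] []

sound-initial : ∀ n s → Sound (initial n s)
sound-initial n s = record
  { idem   = λ _ _ → refl
  ; count≡ = λ _ → trans (∑-cong (allFin n) (λ v → 𝟙-yes (v ≟ v) refl)) (trans (∑ᶠ-const {n} 1) (*-identityʳ n))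
  ; forest = λ j → record
    { respects = λ { (_ , () , _) }
    ; connects = λ { refl → ε }
    ; acyclic  = λ { (_ , [] , () , _) ; (_ , _ ∷ _ , _ , _ , (_ , () , _) ∷ _) }
    }
  }

-- Accepted rows are traced back to their positions in the orderings, because a MultiTree is a set
-- of positions.
accepted-rows : ∀ {n s p} πs (ω : Pools (Edge n) s p) σ {x} → x ∈ accepted (run πs ω σ) →
                x ∈ accepted σ ⊎ (∃ λ (i : Fin p) → toℕ i < length πs × (∀ j → lookup (lookup ω j) i ≡ lookup x j))
accepted-rows             []       ω σ x∈ = inj₁ x∈
accepted-rows {p = zero}  (π ∷ πs) ω σ x∈ = inj₁ x∈
accepted-rows {n} {s} {suc p} (π ∷ πs) ω σ {x} x∈ with accepted-rows πs (mapᵛ tailᵛ ω) _ x∈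
... | inj₂ (i , i< , eq) = inj₂ (suc i , s≤s i< , λ j → trans (lookup-tail (lookup ω j)) (trans (cong (λ c → lookup c i) (sym (lookup-map j tailᵛ ω))) (eq j)))
  where
  lookup-tail : ∀ {A : Set} {p} {i : Fin p} (c : Vec A (suc p)) → lookup c (suc i) ≡ lookup (tailᵛ c) i
  lookup-tail (_ ∷ _) = refl
... | inj₁ x∈′ = step-elim π (mapᵛ headᵛ ω) σ (λ σ′ → x ∈ accepted σ′ → x ∈ accepted σ ⊎ _) (λ _ → first) inj₁ x∈′
  where
  lookup-head : ∀ {A : Set} {p} (c : Vec A (suc p)) → lookup c zero ≡ headᵛ c
  lookup-head (_ ∷ _) = refl
  first : x ∈ mapᵛ headᵛ ω ∷ accepted σ →
          x ∈ accepted σ ⊎ (∃ λ (i : Fin (suc p)) → toℕ i < length (π ∷ πs) × (∀ j → lookup (lookup ω j) i ≡ lookup x j))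
  first (here refl) = inj₂ (zero , s≤s z≤n , λ j → trans (lookup-head (lookup ω j)) (sym (lookup-map j headᵛ ω)))
  first (there y)   = inj₁ y

-- From a run with one remaining block to a MultiTree

spanningTree-map : ∀ {n} {G H : Graph n} → (∀ {u v} → G u v → H u v) → (∀ {u v} → H u v → G u v) → SpanningTree G → SpanningTree H
spanningTree-map to from (conn , acyc) =
  (λ u v → mapˢ to (conn u v)) , λ (v , ws , len , uniq , walk) → acyc (v , ws , len , uniq , Linked.map from walk)

-- Two different labels would be two different fixed points.
one-block : ∀ {n} (f : Fin n → Fin n) → Idem f → blocks f ≤ 1 → ∀ u v → f u ≡ f v
one-block {n} f idem le u v with f u ≟ f v
... | yes e = e
... | no ne = contradiction le (<⇒≱ (begin
  2                                                              ≡⟨ cong₂ _+_ (∑ᶠ-𝟙≟ (f u)) (∑ᶠ-𝟙≟ (f v)) ⟨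
  ∑ᶠ (λ w → 𝟙 (w ≟ f u)) + ∑ᶠ (λ w → 𝟙 (w ≟ f v))                ≡⟨ ∑-+ (allFin n) _ _ ⟨
  ∑ᶠ (λ w → 𝟙 (w ≟ f u) + 𝟙 (w ≟ f v))                           ≤⟨ ∑ᶠ-mono pointwise ⟩
  blocks f                                                       ∎))
  where
  open ≤-Reasoning
  fixed : ∀ {w t} → w ≡ f t → f w ≡ w
  fixed refl = idem _
  pointwise : ∀ w → 𝟙 (w ≟ f u) + 𝟙 (w ≟ f v) ≤ 𝟙 (f w ≟ w)
  pointwise w with w ≟ f u
  ... | yes e = ≤-reflexive (trans (cong suc (𝟙-no (w ≟ f v) (λ e′ → ne (trans (sym e) e′)))) (sym (𝟙-yes (f w ≟ w) (fixed e))))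
  ... | no  _ = 𝟙-mono (w ≟ f v) (f w ≟ w) fixed

spanning : ∀ {n s} {σ : State n s} → Sound σ → count σ ≤ 1 → ∀ j → SpanningTree (RowGraph (accepted σ) j)
spanning snd le j = (λ u v → connects (one-block _ (idem j) (subst (_≤ 1) (sym (count≡ j)) le) u v)) , acyclic
  where
  open Sound snd
  open Forest (forest j)

-- A row has a single position, common to all colours, so the positions of the rows in `R` reproduce
-- the graph of every colour at once.
rows⇒multiTree : ∀ {n s} (ω : Outcome n s) m (R : List (Row n s)) →
                 (∀ {x} → x ∈ R → ∃ λ (i : Fin (N n)) → toℕ i < m × (∀ j → lookup (lookup ω j) i ≡ lookup x j)) →
                 (∀ j → SpanningTree (RowGraph R j)) → ContainsMultiTree ω m
rows⇒multiTree {n} {s} ω m R index tree =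
  I , All.tabulate (λ i∈ → proj₁ (proj₂ (proj₂ (from-I i∈)))) , λ j → spanningTree-map (to j) (from j) (tree j)
  where
  pick : ∀ {L} → (∀ {x} → x ∈ L → x ∈ R) → List (Fin (N n))
  pick {[]}    sub = []
  pick {x ∷ L} sub = proj₁ (index (sub (here refl))) ∷ pick {L} (sub ∘ there)
  I : List (Fin (N n))
  I = pick {R} id
  Index : Fin (N n) → Row n s → Set
  Index i x = toℕ i < m × (∀ j → lookup (lookup ω j) i ≡ lookup x j)
  pick⁺ : ∀ {L} (sub : ∀ {x} → x ∈ L → x ∈ R) {x} → x ∈ L → ∃ λ i → i ∈ pick {L} sub × Index i x
  pick⁺ sub (here refl) = _ , here refl , proj₂ (index (sub (here refl)))
  pick⁺ sub (there x∈) with pick⁺ (sub ∘ there) x∈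
  ... | i , i∈ , eq = i , there i∈ , eq
  pick⁻ : ∀ {L} (sub : ∀ {x} → x ∈ L → x ∈ R) {i} → i ∈ pick {L} sub → ∃ λ x → x ∈ L × Index i x
  pick⁻ {x ∷ L} sub (here refl) = x , here refl , proj₂ (index (sub (here refl)))
  pick⁻ {x ∷ L} sub (there i∈) with pick⁻ {L} (sub ∘ there) i∈
  ... | y , y∈ , eq = y , there y∈ , eq
  from-I : ∀ {i} → i ∈ I → ∃ λ x → x ∈ R × Index i x
  from-I = pick⁻ id
  to : ∀ j {u v} → RowGraph R j u v → EdgeGraph ω I j u v
  to j {u} {v} (x , x∈ , joins) with pick⁺ id x∈
  ... | i , i∈ , _ , eq = i , i∈ , subst (λ e → Joins e u v) (sym (eq j)) joins
  from : ∀ j {u v} → EdgeGraph ω I j u v → RowGraph R j u v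
  from j {u} {v} (i , i∈ , joins) with from-I i∈
  ... | x , x∈ , _ , eq = x , x∈ , subst (λ e → Joins e u v) (eq j) joins

run⇒multiTree : ∀ {n s} (πs : List (Strategy n s)) (ω : Outcome n s) →
                count (run πs ω (initial n s)) ≤ 1 → ContainsMultiTree ω (length πs)
run⇒multiTree {n} {s} πs ω le = rows⇒multiTree ω (length πs) _ index
  (spanning (run-elim Sound sound-step πs ω _ (sound-initial n s)) le)
  where
  index : ∀ {x} → x ∈ accepted (run πs ω (initial n s)) → ∃ λ (i : Fin (N n)) → toℕ i < length πs × (∀ j → lookup (lookup ω j) i ≡ lookup x j)
  index x∈ with accepted-rows πs ω (initial n s) x∈
  ... | inj₁ ()
  ... | inj₂ i  = i

-- Expectations over the rows not yet exposed

-- Pools and used rows together make up E(K_n), expressed through sums of test functions.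
Ledger : ∀ {n s p} → Pools (Edge n) s p → List (Row n s) → Set
Ledger {n} P us = ∀ j (g : Edge n → ℕ) → ∑ (toList (lookup P j)) g + ∑ us (λ x → g (lookup x j)) ≡ ∑ (allEdges n) g

∑-↭ : ∀ {A : Set} {xs ys : List A} (g : A → ℕ) → xs ↭ ys → ∑ xs g ≡ ∑ ys g
∑-↭ g _↭_.refl          = refl
∑-↭ g (_↭_.prep x p)    = cong (g x +_) (∑-↭ g p)
∑-↭ g (_↭_.swap x y p)  = trans (cong (λ t → g x + (g y + t)) (∑-↭ g p)) (x+[y+z]≡y+[x+z] (g x) (g y) _)
  where
  x+[y+z]≡y+[x+z] : ∀ a b c → a + (b + c) ≡ b + (a + c)
  x+[y+z]≡y+[x+z] = solve-∀
∑-↭ g (_↭_.trans p q)   = trans (∑-↭ g p) (∑-↭ g q)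

ledger-step : ∀ {n s p} (P : Pools (Edge n) s (suc p)) {y us} → y ∈ choices P → Ledger P us → Ledger (rests y) (heads y ∷ us)
ledger-step P {y} {us} y∈ ledger j g = begin
  ∑ (toList (lookup (rests y) j)) g + (g (lookup (heads y) j) + U)
    ≡⟨ cong₂ (λ r h → ∑ (toList r) g + (g h + U)) (lookup-map j proj₂ y) (lookup-map j proj₁ y) ⟩
  ∑ (toList (proj₂ (lookup y j))) g + (g (proj₁ (lookup y j)) + U)
    ≡⟨ rearrange (∑ (toList (proj₂ (lookup y j))) g) _ U ⟩
  ∑ (proj₁ (lookup y j) ∷ toList (proj₂ (lookup y j))) g + U
    ≡⟨ cong (_+ U) (∑-↭ g (picks-↭ (lookup P j) (∈-choices⁻ P y∈ j))) ⟨
  ∑ (toList (lookup P j)) g + U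
    ≡⟨ ledger j g ⟩
  ∑ (allEdges _) g ∎
  where
  open ≡-Reasoning
  U : ℕ
  U = ∑ us (λ x → g (lookup x j))
  rearrange : ∀ a b c → a + (b + c) ≡ b + a + c
  rearrange = solve-∀

∑-run : ∀ {n s p} π πs (P : Pools (Edge n) s (suc p)) (f : State n s → ℕ) σ →
        ∑ (outcomes (suc p) P) (λ ω → f (run (π ∷ πs) ω σ)) ≡
        ∑ (choices P) (λ y → ∑ (outcomes p (rests y)) (λ ω → f (run πs ω (step π (heads y) σ))))
∑-run {p = p} π πs P f σ = trans (∑-outcomes P _) (∑-cong (choices P) (λ y → ∑-cong (outcomes p (rests y)) (λ ω →
  cong₂ (λ h t → f (run πs t (step π h σ))) (map-head-zip (heads y) ω) (map-tail-zip (heads y) ω))))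

∑-run-≤ : ∀ {n s} πs p (P : Pools (Edge n) s p) (f : State n s → ℕ) σ → (∀ σ → f σ ≤ 1) →
          ∑ (outcomes p P) (λ ω → f (run πs ω σ)) ≤ #outcomes s p
∑-run-≤ {s = s} πs p P f σ f≤1 = begin
  ∑ (outcomes p P) (λ ω → f (run πs ω σ))   ≤⟨ ∑-mono (outcomes p P) (λ ω _ → f≤1 (run πs ω σ)) ⟩
  ∑ (outcomes p P) (λ _ → 1)                ≡⟨ trans (∑-const (outcomes p P) 1) (*-identityʳ _) ⟩
  length (outcomes p P)                     ≡⟨ length-outcomes p P ⟩
  #outcomes s p                             ∎
  where open ≤-Reasoning

-- The rest of the strategy is assumed to fail with probability at most δ / Z + Φ, and b / a is the expected
-- contraction of Φ per row; all denominators are cleared.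
supermartingale : ∀ {n s} (Inv : State n s → Set) (Φ : State n s → ℕ) (Allowed : Strategy n s → Set) (q a b : ℕ) →
  (∀ π x σ → Allowed π → Inv σ → Inv (step π x σ)) →
  (∀ π {p} (P : Pools (Edge n) s (suc p)) σ → Allowed π → q ≤ p → Ledger P (used σ) → Inv σ →
     a * ∑ (choices P) (λ y → Φ (step π (heads y) σ)) ≤ b * (suc p ^ s * Φ σ)) →
  ∀ (f : State n s → ℕ) Z δ rest →
  (∀ p (P : Pools (Edge n) s p) σ → length rest + q ≤ p → Ledger P (used σ) → Inv σ →
     Z * ∑ (outcomes p P) (λ ω → f (run rest ω σ)) ≤ #outcomes s p * (δ + Z * Φ σ)) →
  ∀ πs → All Allowed πs → ∀ p (P : Pools (Edge n) s p) σ → length πs + (length rest + q) ≤ p → Ledger P (used σ) → Inv σ →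
  a ^ length πs * (Z * ∑ (outcomes p P) (λ ω → f (run (πs ++ rest) ω σ))) ≤
  #outcomes s p * (a ^ length πs * δ + b ^ length πs * (Z * Φ σ))
supermartingale {s = s} Inv Φ Allowed q a b closed drift f Z δ rest base [] [] p P σ len ledger inv = begin
  1 * (Z * _)                                    ≡⟨ *-identityˡ _ ⟩
  Z * _                                          ≤⟨ base p P σ len ledger inv ⟩
  #outcomes s p * (δ + Z * Φ σ)                  ≡⟨ cong (#outcomes s p *_) (sym (cong₂ _+_ (*-identityˡ δ) (*-identityˡ _))) ⟩
  #outcomes s p * (1 * δ + 1 * (Z * Φ σ))        ∎
  where open ≤-Reasoning
supermartingale {s = s} Inv Φ Allowed q a b closed drift f Z δ rest base (π ∷ πs) (allowed ∷ alls) (suc p) P σ (s≤s len) ledger inv = begin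
  a * A * (Z * ∑ (outcomes (suc p) P) (λ ω → f (run (π ∷ πs ++ rest) ω σ)))
    ≡⟨ cong (λ t → a * A * (Z * t)) (∑-run π (πs ++ rest) P f σ) ⟩
  a * A * (Z * ∑ (choices P) S)
    ≡⟨ trans (*-assoc a A _) (cong (a *_) (trans (cong (A *_) (sym (∑-*ˡ (choices P) Z S))) (sym (∑-*ˡ (choices P) A _)))) ⟩
  a * ∑ (choices P) (λ y → A * (Z * S y))
    ≤⟨ *-monoʳ-≤ a (∑-mono (choices P) (λ y y∈ →
         supermartingale Inv Φ Allowed q a b closed drift f Z δ rest base πs alls p (rests y) (step π (heads y) σ) len
           (subst (Ledger (rests y)) (sym (step-used π (heads y) σ)) (ledger-step P {us = used σ} y∈ ledger)) (closed π (heads y) σ allowed inv))) ⟩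
  a * ∑ (choices P) (λ y → T * (A * δ + B * (Z * Φ′ y)))
    ≡⟨ cong (a *_) (trans (∑-*ˡ (choices P) T _) (cong (T *_) (trans (∑-+ (choices P) _ _)
         (cong₂ _+_ (trans (∑-const (choices P) (A * δ)) (cong (_* (A * δ)) (length-choices P)))
                    (trans (∑-*ˡ (choices P) B _) (cong (B *_) (∑-*ˡ (choices P) Z Φ′))))))) ⟩
  a * (T * (D * (A * δ) + B * (Z * ∑ (choices P) Φ′)))
    ≡⟨ distribute a T D A δ B Z (∑ (choices P) Φ′) ⟩
  T * (D * (a * A * δ)) + T * (B * Z) * (a * ∑ (choices P) Φ′)
    ≤⟨ +-monoʳ-≤ (T * (D * (a * A * δ))) (*-monoʳ-≤ (T * (B * Z)) (drift π P σ allowed (≤-trans (m≤n+m q (length rest)) (≤-trans (m≤n+m _ (length πs)) len)) ledger inv)) ⟩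
  T * (D * (a * A * δ)) + T * (B * Z) * (b * (D * Φ σ))
    ≡⟨ collect a b T D A δ B Z (Φ σ) ⟩
  D * T * (a * A * δ + b * B * (Z * Φ σ)) ∎
  where
  open ≤-Reasoning
  A B T D : ℕ
  A = a ^ length πs
  B = b ^ length πs
  T = #outcomes s p
  D = suc p ^ s
  S Φ′ : Vec _ _ → ℕ
  S y = ∑ (outcomes p (rests y)) (λ ω → f (run (πs ++ rest) ω (step π (heads y) σ)))
  Φ′ y = Φ (step π (heads y) σ)
  distribute : ∀ a T D A δ B Z E → a * (T * (D * (A * δ) + B * (Z * E))) ≡ T * (D * (a * A * δ)) + T * (B * Z) * (a * E)
  distribute = solve-∀
  collect : ∀ a b T D A δ B Z F → T * (D * (a * A * δ)) + T * (B * Z) * (b * (D * F)) ≡ D * T * (a * A * δ + b * B * (Z * F))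
  collect = solve-∀

-- Counting the admissible edges left in a pool

incident : ∀ {n} → Fin n → Edge n → ℕ
incident v ((x , y) , _) = 𝟙 (v ≟ x) + 𝟙 (v ≟ y)

∑-incident : ∀ {n} (g : Fin n → ℕ) (e : Edge n) → g (proj₁ (proj₁ e)) + g (proj₂ (proj₁ e)) ≡ ∑ᶠ (λ v → g v * incident v e)
∑-incident {n} g ((x , y) , _) = begin
  g x + g y                                                  ≡⟨ cong₂ _+_ (∑ᶠ-δ x g) (∑ᶠ-δ y g) ⟨
  ∑ᶠ (λ v → 𝟙 (v ≟ x) * g v) + ∑ᶠ (λ v → 𝟙 (v ≟ y) * g v)    ≡⟨ ∑-+ (allFin n) _ _ ⟨
  ∑ᶠ (λ v → 𝟙 (v ≟ x) * g v + 𝟙 (v ≟ y) * g v)               ≡⟨ ∑-cong (allFin n) (λ v → factor (g v) (𝟙 (v ≟ x)) (𝟙 (v ≟ y))) ⟩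
  ∑ᶠ (λ v → g v * (𝟙 (v ≟ x) + 𝟙 (v ≟ y)))                   ∎
  where
  open ≡-Reasoning
  factor : ∀ a b c → b * a + c * a ≡ a * (b + c)
  factor = solve-∀

degree : ∀ {n s} → List (Row n s) → Fin s → Fin n → ℕ
degree us j v = ∑ us (λ x → incident v (lookup x j))

outside : ∀ {n} → (Fin n → Fin n) → Range → Fin n → ℕ
outside f B u = ∑ᶠ (λ v → 𝟙 (size f v ∈ᴿ? B ×-dec ¬? (f u ≟ f v)))

mass≤outside+size : ∀ {n} (f : Fin n → Fin n) B u → mass f B ≤ outside f B u + size f u
mass≤outside+size {n} f B u = ≤-trans (∑ᶠ-mono pointwise) (≤-reflexive (∑-+ (allFin n) _ _))
  where
  pointwise : ∀ v → 𝟙 (size f v ∈ᴿ? B) ≤ 𝟙 (size f v ∈ᴿ? B ×-dec ¬? (f u ≟ f v)) + 𝟙 (f v ≟ f u)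
  pointwise v = 𝟙-≤ (size f v ∈ᴿ? B) (λ inB → cases inB (f u ≟ f v))
    where
    cases : size f v ∈ᴿ B → Dec (f u ≡ f v) → 1 ≤ 𝟙 (size f v ∈ᴿ? B ×-dec ¬? (f u ≟ f v)) + 𝟙 (f v ≟ f u)
    cases inB (yes e) = ≤-trans (≤-reflexive (sym (𝟙-yes (f v ≟ f u) (sym e)))) (m≤n+m _ _)
    cases inB (no ne) = ≤-trans (≤-reflexive (sym (𝟙-yes (size f v ∈ᴿ? B ×-dec ¬? (f u ≟ f v)) (inB , ne)))) (m≤m+n _ _)

-- At least `mass f A * X` ordered pairs have their first vertex in the range `A` and the second in
-- the range `B` and in another block, and an edge of the complete graph accounts for at most two of
-- them. Every admissible edge has an end counted by `mass f A`, so at most `mass f A * d`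
-- admissible edges have been used.
many-admissible : ∀ {n s p} (P : Pools (Edge n) s p) (us : List (Row n s)) → Ledger P us →
                  ∀ j (f : Fin n → Fin n) A B X d → (∀ v → degree us j v ≤ d) → (∀ u → size f u ∈ᴿ A → X ≤ outside f B u) →
                  mass f A * X ≤ 2 * ∑ (toList (lookup P j)) (λ e → 𝟙 (admissible? f (A , B) e)) + mass f A * (2 * d)
many-admissible {n} P us ledger j f A B X d deg≤ X≤ = begin
  mass f A * X                                         ≡⟨ ∑-*ʳ (allFin n) X _ ⟨
  ∑ᶠ (λ u → 𝟙A u * X)                                  ≤⟨ ∑ᶠ-mono (λ u → scale (size f u ∈ᴿ? A) (X≤ u)) ⟩
  ∑ᶠ (λ u → 𝟙A u * outside f B u)                      ≡⟨ ∑-cong (allFin n) (λ u → ∑-*ˡ (allFin n) (𝟙A u) _) ⟨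
  ∑ᶠ (λ u → ∑ᶠ (F u))                                  ≡⟨ ∑-allEdges n F ⟨
  ∑ (allEdges n) (λ ((u , v) , _) → F u v + F v u) + ∑ᶠ (λ u → F u u)
    ≤⟨ +-mono-≤ (∑-mono (allEdges n) (λ e _ → both e)) (≤-trans (≤-reflexive (trans (∑-cong (allFin n) diagonal) (∑-zero (allFin n)))) z≤n) ⟩
  ∑ (allEdges n) (λ e → 2 * adm e) + 0                 ≡⟨ trans (+-identityʳ _) (∑-*ˡ (allEdges n) 2 adm) ⟩
  2 * ∑ (allEdges n) adm                               ≡⟨ cong (2 *_) (ledger j adm) ⟨
  2 * (∑ (toList (lookup P j)) adm + ∑ us (λ x → adm (lookup x j)))
    ≤⟨ *-monoʳ-≤ 2 (+-monoʳ-≤ (∑ (toList (lookup P j)) adm) wasted) ⟩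
  2 * (∑ (toList (lookup P j)) adm + mass f A * d)     ≡⟨ rearrange (∑ (toList (lookup P j)) adm) (mass f A) d ⟩
  2 * ∑ (toList (lookup P j)) adm + mass f A * (2 * d) ∎
  where
  open ≤-Reasoning
  𝟙A : Fin n → ℕ
  𝟙A u = 𝟙 (size f u ∈ᴿ? A)
  adm : Edge n → ℕ
  adm e = 𝟙 (admissible? f (A , B) e)
  F : Fin n → Fin n → ℕ
  F u v = 𝟙A u * 𝟙 (size f v ∈ᴿ? B ×-dec ¬? (f u ≟ f v))
  rearrange : ∀ a b c → 2 * (a + b * c) ≡ 2 * a + b * (2 * c)
  rearrange = solve-∀
  scale : ∀ {Q : Set} (D : Dec Q) {y z} → (Q → y ≤ z) → 𝟙 D * y ≤ 𝟙 D * z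
  scale (yes q) h = *-monoʳ-≤ 1 (h q)
  scale (no  _) h = z≤n
  diagonal : ∀ u → F u u ≡ 0
  diagonal u = trans (cong (𝟙A u *_) (𝟙-no (size f u ∈ᴿ? B ×-dec ¬? (f u ≟ f u)) (λ (_ , ne) → ne refl))) (*-zeroʳ (𝟙A u))
  𝟙*𝟙≤ : ∀ {Q R S : Set} (q : Dec Q) (r : Dec R) (t : Dec S) → (Q → R → S) → 𝟙 q * 𝟙 r ≤ 𝟙 t
  𝟙*𝟙≤ (yes q) r t h = ≤-trans (≤-reflexive (*-identityˡ (𝟙 r))) (𝟙-mono r t (h q))
  𝟙*𝟙≤ (no  _) r t h = z≤n
  both : ∀ (e : Edge n) → F (proj₁ (proj₁ e)) (proj₂ (proj₁ e)) + F (proj₂ (proj₁ e)) (proj₁ (proj₁ e)) ≤ 2 * adm e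
  both e@((u , v) , _) = ≤-trans
    (+-mono-≤ (𝟙*𝟙≤ (size f u ∈ᴿ? A) (size f v ∈ᴿ? B ×-dec ¬? (f u ≟ f v)) (admissible? f (A , B) e) (λ inA (inB , ne) → ne , inj₁ (inA , inB)))
              (𝟙*𝟙≤ (size f v ∈ᴿ? A) (size f u ∈ᴿ? B ×-dec ¬? (f v ≟ f u)) (admissible? f (A , B) e) (λ inA (inB , ne) → ne ∘ sym , inj₂ (inA , inB))))
    (≤-reflexive (cong (adm e +_) (sym (+-identityʳ (adm e)))))
  ends : ∀ (e : Edge n) → adm e ≤ 𝟙A (proj₁ (proj₁ e)) + 𝟙A (proj₂ (proj₁ e))
  ends e@((u , v) , _) = 𝟙-≤ (admissible? f (A , B) e) λ where
    (_ , inj₁ (inA , _)) → ≤-trans (≤-reflexive (sym (𝟙-yes (size f u ∈ᴿ? A) inA))) (m≤m+n _ _)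
    (_ , inj₂ (inA , _)) → ≤-trans (≤-reflexive (sym (𝟙-yes (size f v ∈ᴿ? A) inA))) (m≤n+m _ _)
  wasted : ∑ us (λ x → adm (lookup x j)) ≤ mass f A * d
  wasted = begin
    ∑ us (λ x → adm (lookup x j))                              ≤⟨ ∑-mono us (λ x _ → ≤-trans (ends (lookup x j)) (≤-reflexive (∑-incident 𝟙A (lookup x j)))) ⟩
    ∑ us (λ x → ∑ᶠ (λ v → 𝟙A v * incident v (lookup x j)))     ≡⟨ ∑-comm us (allFin n) _ ⟩
    ∑ᶠ (λ v → ∑ us (λ x → 𝟙A v * incident v (lookup x j)))     ≡⟨ ∑-cong (allFin n) (λ v → ∑-*ˡ us (𝟙A v) _) ⟩
    ∑ᶠ (λ v → 𝟙A v * degree us j v)                            ≤⟨ ∑ᶠ-mono (λ v → *-monoʳ-≤ (𝟙A v) (deg≤ v)) ⟩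
    ∑ᶠ (λ v → 𝟙A v * d)                                        ≡⟨ ∑-*ʳ (allFin n) d _ ⟩
    mass f A * d                                               ∎

-- Acceptance probability of a row and the drift of a potential

∏-const-* : ∀ {s} b (g : Fin s → ℕ) → ∏ᶠ (λ j → b * g j) ≡ b ^ s * ∏ᶠ g
∏-const-* {zero}  b g = refl
∏-const-* {suc s} b g = trans (cong (b * g zero *_) (∏-const-* b (g ∘ suc))) (rearrange b (g zero) (b ^ s) _)
  where
  rearrange : ∀ a b c d → a * b * (c * d) ≡ a * c * (b * d)
  rearrange = solve-∀

∏-lower : ∀ {s} (h : Fin s → ℕ) X → (∀ j → X ≤ h j) → X ^ s ≤ ∏ᶠ h
∏-lower {zero}  h X le = ≤-refl
∏-lower {suc s} h X le = *-mono-≤ (le zero) (∏-lower (h ∘ suc) X (le ∘ suc))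

-- One factor may fall short by the ratio m / w, and the product loses this ratio only once. The
-- exceptional colour will be the one that advances a small block.
∏-lower-except : ∀ {s} (h : Fin s → ℕ) X m w j₀ → (∀ j → j ≢ j₀ → X ≤ h j) → X * m ≤ h j₀ * w → X ^ s * m ≤ ∏ᶠ h * w
∏-lower-except {suc s} h X m w zero others special = begin
  X * X ^ s * m                 ≡⟨ swap₃ X (X ^ s) m ⟩
  X * m * X ^ s                 ≤⟨ *-mono-≤ special (∏-lower (h ∘ suc) X (λ j → others (suc j) λ ())) ⟩
  h zero * w * ∏ᶠ (h ∘ suc)     ≡⟨ swap₃ (h zero) w _ ⟩
  h zero * ∏ᶠ (h ∘ suc) * w     ∎
  where
  open ≤-Reasoning
  swap₃ : ∀ a b c → a * b * c ≡ a * c * b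
  swap₃ = solve-∀
∏-lower-except {suc s} h X m w (suc j₀) others special = begin
  X * X ^ s * m                   ≡⟨ *-assoc X (X ^ s) m ⟩
  X * (X ^ s * m)                 ≤⟨ *-mono-≤ (others zero λ ()) (∏-lower-except (h ∘ suc) X m w j₀ (λ j ne → others (suc j) (ne ∘ suc-injective)) special) ⟩
  h zero * (∏ᶠ (h ∘ suc) * w)     ≡⟨ *-assoc (h zero) _ w ⟨
  h zero * ∏ᶠ (h ∘ suc) * w       ∎
  where open ≤-Reasoning

∏𝟙≤𝟙 : ∀ {s} {Q : Fin s → Set} (d : ∀ j → Dec (Q j)) (e : Dec (∀ j → Q j)) → ∏ᶠ (λ j → 𝟙 (d j)) ≤ 𝟙 e
∏𝟙≤𝟙 {zero}  d e = ≤-reflexive (sym (𝟙-yes e λ ()))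
∏𝟙≤𝟙 {suc s} d e with d zero
... | no ¬q = z≤n
... | yes q = ≤-trans (≤-reflexive (*-identityˡ _)) (≤-trans (∏𝟙≤𝟙 (d ∘ suc) (all? (d ∘ suc)))
                (𝟙-mono (all? (d ∘ suc)) e (λ h → λ { zero → q ; (suc j) → h j })))

#accepting : ∀ {n s p} → Strategy n s → Pools (Edge n) s (suc p) → State n s → ℕ
#accepting π P σ = ∑ (choices P) (λ y → 𝟙 (accepts? π σ (heads y)))

∏-admissible≤accepting : ∀ {n s p} (π : Strategy n s) (P : Pools (Edge n) s (suc p)) σ →
  ∏ᶠ (λ j → ∑ (toList (lookup P j)) (λ e → 𝟙 (admissible? (label σ j) (π σ j) e))) ≤ #accepting π P σ
∏-admissible≤accepting π P σ = ≤-trans (≤-reflexive (sym (∑-choices-∏ P _)))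
  (∑-mono (choices P) (λ y _ → ∏𝟙≤𝟙 (λ j → admissible? (label σ j) (π σ j) (lookup (heads y) j)) (accepts? π σ (heads y))))

-- Accepted rows lower `Φ` by `Δ` and rejected ones do not raise it; the last hypothesis says that
-- the expected loss is at least the fraction k / a of `Φ`.
drift-step : ∀ {n s p} (π : Strategy n s) (P : Pools (Edge n) s (suc p)) σ (Φ : State n s → ℕ) Δ a k →
  (∀ x → Accepts π σ x → Δ + Φ (accept x σ) ≤ Φ σ) → (∀ x → Φ (reject x σ) ≤ Φ σ) →
  k * (suc p ^ s * Φ σ) ≤ a * (Δ * #accepting π P σ) →
  a * ∑ (choices P) (λ y → Φ (step π (heads y) σ)) ≤ (a ∸ k) * (suc p ^ s * Φ σ)
drift-step {s = s} {p} π P σ Φ Δ a k acc rej rate = begin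
  a * ∑Φ                                                     ≤⟨ m+n≤o⇒m≤o∸n (a * ∑Φ) bound ⟩
  a * (suc p ^ s * Φ σ) ∸ k * (suc p ^ s * Φ σ)              ≡⟨ *-distribʳ-∸ (suc p ^ s * Φ σ) a k ⟨
  (a ∸ k) * (suc p ^ s * Φ σ)                                ∎
  where
  open ≤-Reasoning
  ∑Φ : ℕ
  ∑Φ = ∑ (choices P) (λ y → Φ (step π (heads y) σ))
  pointwise : ∀ x → Δ * 𝟙 (accepts? π σ x) + Φ (step π x σ) ≤ Φ σ
  pointwise x = cases (accepts? π σ x)
    where
    cases : (d : Dec (Accepts π σ x)) → Δ * 𝟙 d + Φ (if does d then accept x σ else reject x σ) ≤ Φ σ
    cases (yes a) = ≤-trans (≤-reflexive (cong (_+ Φ (accept x σ)) (*-identityʳ Δ))) (acc x a)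
    cases (no  _) = ≤-trans (≤-reflexive (cong (_+ Φ (reject x σ)) (*-zeroʳ Δ))) (rej x)
  total : Δ * #accepting π P σ + ∑Φ ≤ suc p ^ s * Φ σ
  total = begin
    Δ * #accepting π P σ + ∑Φ      ≡⟨ cong (_+ ∑Φ) (∑-*ˡ (choices P) Δ _) ⟨
    ∑ (choices P) (λ y → Δ * 𝟙 (accepts? π σ (heads y))) + ∑Φ     ≡⟨ ∑-+ (choices P) _ _ ⟨
    ∑ (choices P) (λ y → Δ * 𝟙 (accepts? π σ (heads y)) + Φ (step π (heads y) σ))     ≤⟨ ∑-mono (choices P) (λ y _ → pointwise (heads y)) ⟩
    ∑ (choices P) (λ _ → Φ σ)      ≡⟨ trans (∑-const (choices P) (Φ σ)) (cong (_* Φ σ) (length-choices P)) ⟩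
    suc p ^ s * Φ σ                ∎
  bound : a * ∑Φ + k * (suc p ^ s * Φ σ) ≤ a * (suc p ^ s * Φ σ)
  bound = begin
    a * ∑Φ + k * (suc p ^ s * Φ σ)             ≤⟨ +-monoʳ-≤ (a * ∑Φ) rate ⟩
    a * ∑Φ + a * (Δ * #accepting π P σ)        ≡⟨ trans (+-comm (a * ∑Φ) _) (sym (*-distribˡ-+ a _ ∑Φ)) ⟩
    a * (Δ * #accepting π P σ + ∑Φ)            ≤⟨ *-monoʳ-≤ a total ⟩
    a * (suc p ^ s * Φ σ)                      ∎

-- Restriction to states with low used degrees

-- Admissibility counts need a used degree of o(n) at every vertex: otherwise almost all edges leaving a
-- small block might already have been rejected.
Alive : ∀ {n s} → ℕ → State n s → Set
Alive d σ = ∀ j v → degree (used σ) j v ≤ d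

alive? : ∀ {n s} d (σ : State n s) → Dec (Alive d σ)
alive? d σ = all? (λ j → all? (λ v → degree (used σ) j v ≤? d))

alive-step⁻ : ∀ {n s} d (π : Strategy n s) x σ → Alive d (step π x σ) → Alive d σ
alive-step⁻ d π x σ alive j v = ≤-trans (m≤n+m _ _) (subst (λ us → degree us j v ≤ d) (step-used π x σ) (alive j v))

-- Degrees only grow, so a dead state stays dead. Multiplying by the indicator therefore keeps a
-- contraction intact without changing the distribution of the rows; the discarded event is
-- estimated separately.
while-alive : ∀ {n s} → ℕ → (State n s → ℕ) → State n s → ℕ
while-alive d Φ σ = 𝟙 (alive? d σ) * Φ σ

while-alive-dead : ∀ {n s} d (Φ : State n s → ℕ) σ → ¬ Alive d σ → while-alive d Φ σ ≡ 0
while-alive-dead d Φ σ dead = cong (_* Φ σ) (𝟙-no (alive? d σ) dead)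

while-alive-alive : ∀ {n s} d (Φ : State n s → ℕ) σ → Alive d σ → while-alive d Φ σ ≡ Φ σ
while-alive-alive d Φ σ alive = trans (cong (_* Φ σ) (𝟙-yes (alive? d σ) alive)) (*-identityˡ (Φ σ))

while-alive-≤ : ∀ {n s} d (Φ : State n s → ℕ) σ → while-alive d Φ σ ≤ Φ σ
while-alive-≤ d Φ σ = ≤-trans (*-monoˡ-≤ (Φ σ) (𝟙≤1 (alive? d σ))) (≤-reflexive (*-identityˡ (Φ σ)))

while-alive-run : ∀ {n s p} d (Φ : State n s → ℕ) πs (ω : Pools (Edge n) s p) σ → ¬ Alive d σ → while-alive d Φ (run πs ω σ) ≡ 0
while-alive-run d Φ πs ω σ dead = while-alive-dead d Φ (run πs ω σ)
  (run-elim (λ σ → ¬ Alive d σ) (λ π x σ dead → dead ∘ alive-step⁻ d π x σ) πs ω σ dead)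

-- From a dead state all successors are dead and the left side vanishes; only an alive state needs
-- the hypothesis.
drift-alive : ∀ {n s p} (π : Strategy n s) (P : Pools (Edge n) s (suc p)) σ (Φ : State n s → ℕ) d a b →
  (Alive d σ → a * ∑ (choices P) (λ y → Φ (step π (heads y) σ)) ≤ b * (suc p ^ s * Φ σ)) →
  a * ∑ (choices P) (λ y → while-alive d Φ (step π (heads y) σ)) ≤ b * (suc p ^ s * while-alive d Φ σ)
drift-alive {s = s} {p} π P σ Φ d a b drift = cases (alive? d σ)
  where
  cases : Dec (Alive d σ) → a * ∑ (choices P) (λ y → while-alive d Φ (step π (heads y) σ)) ≤ b * (suc p ^ s * while-alive d Φ σ)
  cases (yes alive) = ≤-trans (*-monoʳ-≤ a (∑-mono (choices P) (λ y _ → while-alive-≤ d Φ (step π (heads y) σ))))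
                        (≤-trans (drift alive) (≤-reflexive (cong (λ t → b * (suc p ^ s * t)) (sym (while-alive-alive d Φ σ alive)))))
  cases (no dead)   = ≤-trans (≤-reflexive (trans (cong (a *_) (trans (∑-cong (choices P) (λ y →
                        while-alive-dead d Φ (step π (heads y) σ) (dead ∘ alive-step⁻ d π (heads y) σ))) (∑-zero (choices P)))) (*-zeroʳ a))) z≤n

argmax : ∀ {t} (g : Fin (suc t) → ℕ) → ∃ λ j₀ → ∀ j → g j ≤ g j₀
argmax {zero}  g = zero , λ { zero → ≤-refl }
argmax {suc t} g with argmax (g ∘ suc)
... | j₀ , max with ≤-total (g zero) (g (suc j₀))
...   | inj₁ le = suc j₀ , λ { zero → le ; (suc j) → max j }
...   | inj₂ ge = zero , λ { zero → ≤-refl ; (suc j) → ≤-trans (max j) ge }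

∑ᶠ-drop : ∀ {s} (g h : Fin s → ℕ) k j₀ → (∀ j → g j ≤ h j) → k + g j₀ ≤ h j₀ → k + ∑ᶠ g ≤ ∑ᶠ h
∑ᶠ-drop {s} g h k j₀ le drop = begin
  k + ∑ᶠ g                                 ≡⟨ cong (_+ ∑ᶠ g) (∑ᶠ-δ j₀ (λ _ → k)) ⟨
  ∑ᶠ (λ j → 𝟙 (j ≟ j₀) * k) + ∑ᶠ g         ≡⟨ ∑-+ (allFin s) _ _ ⟨
  ∑ᶠ (λ j → 𝟙 (j ≟ j₀) * k + g j)          ≤⟨ ∑ᶠ-mono pointwise ⟩
  ∑ᶠ h                                     ∎
  where
  open ≤-Reasoning
  pointwise : ∀ j → 𝟙 (j ≟ j₀) * k + g j ≤ h j
  pointwise j with j ≟ j₀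
  ... | yes refl = ≤-trans (≤-reflexive (cong (_+ g j) (+-identityʳ k))) drop
  ... | no  _    = le j

-- One stage: size classes, potential and invariants

-- massRatio is 1/ε; per row the potential of stage k contracts by the factor 1 - k / (n * timeFactor).
abstract
  massRatio timeFactor : ℕ → ℕ
  massRatio t = 128 * suc t
  timeFactor t = 2 * (suc t * (1024 * (massRatio t * massRatio t)) ^ suc t)

  massRatio≡ : ∀ t → massRatio t ≡ 128 * suc t
  massRatio≡ t = refl

  timeFactor≡ : ∀ t → timeFactor t ≡ 2 * (suc t * (1024 * (massRatio t * massRatio t)) ^ suc t)
  timeFactor≡ t = refl

module Stage (t n : ℕ) where

  -- A colour that is not short of small blocks has at least n^2 / b admissible edges, so 1 / b^s
  -- bounds the acceptance probability in the first phase. There the potential is at most 2sn, hence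
  -- `c` is 2s b^s.
  s E b c : ℕ
  s = suc t
  E = massRatio t
  b = 1024 * (E * E)
  c = timeFactor t

  128≤E : 128 ≤ E
  128≤E = ≤-trans (m≤m*n 128 s) (≤-reflexive (sym (massRatio≡ t)))

  1≤E : 1 ≤ E
  1≤E = ≤-trans (m≤m+n 1 127) 128≤E

  -- Two small blocks merge to less than 16k. Two medium ones merge to less than 128k = 16 * 8k,
  -- which is the size bound required on entering the next stage. A medium block already has the
  -- target size 8k.
  small medium : ℕ → Range
  small  k = 0 , 8 * k
  medium k = 8 * k , 64 * k

  smallMass : ℕ → State n s → Fin s → ℕ
  smallMass k σ j = mass (label σ j) (small k)

  Undone : ℕ → State n s → Fin s → Set
  Undone k σ j = n ≤ E * smallMass k σ j

  undone? : ∀ k σ j → Dec (Undone k σ j)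
  undone? k σ j = n ≤? E * smallMass k σ j

  worst : ℕ → State n s → Fin s
  worst k σ = proj₁ (argmax (smallMass k σ))

  worst-max : ∀ k σ j → smallMass k σ j ≤ smallMass k σ (worst k σ)
  worst-max k σ = proj₂ (argmax (smallMass k σ))

  -- The worst colour is undone whenever some colour is, so the second case occurs only once no colour is undone.
  stage : ℕ → Strategy n s
  stage k σ j =
    if does (undone? k σ j) then small k , small k
    else if does (j ≟ worst k σ) then small k , medium k
    else medium k , medium k

  -- In the first phase `k * count σ` falls by `k` per accepted row. The extra `n` per colour keeps
  -- the potential positive until the switch and pays for the small mass, at most `n` per colour,
  -- that replaces it.
  potential : ℕ → State n s → ℕ
  potential k σ = if does (undone? k σ (worst k σ)) then s * (k * count σ + n) else ∑ᶠ (smallMass k σ)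

  stage-undone : ∀ k σ j → Undone k σ j → stage k σ j ≡ (small k , small k)
  stage-undone k σ j u rewrite dec-true (undone? k σ j) u = refl

  stage-worst : ∀ k σ → ¬ Undone k σ (worst k σ) → stage k σ (worst k σ) ≡ (small k , medium k)
  stage-worst k σ d rewrite dec-false (undone? k σ (worst k σ)) d | dec-true (worst k σ ≟ worst k σ) refl = refl

  stage-other : ∀ k σ j → ¬ Undone k σ j → j ≢ worst k σ → stage k σ j ≡ (medium k , medium k)
  stage-other k σ j d ne rewrite dec-false (undone? k σ j) d | dec-false (j ≟ worst k σ) ne = refl

  potential-undone : ∀ k σ → Undone k σ (worst k σ) → potential k σ ≡ s * (k * count σ + n)
  potential-undone k σ u rewrite dec-true (undone? k σ (worst k σ)) u = refl

  potential-done : ∀ k σ → ¬ Undone k σ (worst k σ) → potential k σ ≡ ∑ᶠ (smallMass k σ)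
  potential-done k σ d rewrite dec-false (undone? k σ (worst k σ)) d = refl

  done-all : ∀ k σ → ¬ Undone k σ (worst k σ) → ∀ j → ¬ Undone k σ j
  done-all k σ d j u = d (≤-trans u (*-monoʳ-≤ E (worst-max k σ j)))

  -- `E` carries the factor `s` for this purpose: each of the `s` colours has small mass below n /
  -- E.
  128∑smallMass≤n : ∀ k σ → ¬ Undone k σ (worst k σ) → 128 * ∑ᶠ (smallMass k σ) ≤ n
  128∑smallMass≤n k σ d = *-cancelˡ-≤ s (begin
    s * (128 * ∑ᶠ (smallMass k σ))         ≡⟨ regroup s (∑ᶠ (smallMass k σ)) ⟩
    128 * s * ∑ᶠ (smallMass k σ)           ≡⟨ cong (_* ∑ᶠ (smallMass k σ)) (massRatio≡ t) ⟨
    E * ∑ᶠ (smallMass k σ)                 ≡⟨ ∑-*ˡ (allFin s) E _ ⟨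
    ∑ᶠ (λ j → E * smallMass k σ j)         ≤⟨ ∑ᶠ-mono (λ j → <⇒≤ (≰⇒> (done-all k σ d j))) ⟩
    ∑ᶠ {s} (λ _ → n)                       ≡⟨ ∑ᶠ-const {s} n ⟩
    s * n                                  ∎)
    where
    open ≤-Reasoning
    regroup : ∀ a b → a * (128 * b) ≡ 128 * a * b
    regroup = solve-∀

  -- `done-count` bounds a difference: in the second phase an accepted row lowers `k * count σ` by
  -- `k` and the total small mass by at least `k`, so the inequality survives and keeps
  -- `k * count σ` at n / 32 or more. `undone-upper` provides the starting value, since an undone
  -- colour merges only small blocks.
  record StageInv (k : ℕ) (σ : State n s) : Set where
    field
      sound        : Sound σ
      lower        : ∀ j v → k ≤ size (label σ j) v
      upper        : ∀ j v → size (label σ j) v < 128 * k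
      undone-upper : ∀ j → Undone k σ j → ∀ v → size (label σ j) v < 16 * k
      done-count   : ¬ Undone k σ (worst k σ) → n + 32 * ∑ᶠ (smallMass k σ) ≤ 32 * (k * count σ)

  few-blocks : ∀ {σ : State n s} → Sound σ → ∀ j X → (∀ v → size (label σ j) v < X) → n ≤ X * count σ
  few-blocks {σ} snd j X upper = ≤-trans (n≤blocks*max (label σ j) (idem j) X (λ v → <⇒≤ (upper v))) (≤-reflexive (cong (X *_) (count≡ j)))
    where open Sound snd

  enter-stage : ∀ k σ → Sound σ → (∀ j v → k ≤ size (label σ j) v) → (∀ j v → size (label σ j) v < 16 * k) → StageInv k σ
  enter-stage k σ snd lo hi = record
    { sound = snd ; lower = lo
    ; upper = λ j v → ≤-trans (hi j v) (*-monoˡ-≤ k (m≤m+n 16 112))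
    ; undone-upper = λ j _ → hi j
    ; done-count = λ d → *-cancelˡ-≤ 4 (arith {∑ᶠ (smallMass k σ)} {count σ} (128∑smallMass≤n k σ d) (few-blocks snd zero (16 * k) (hi zero)))
    }
    where
    arith : ∀ {m r} → 128 * m ≤ n → n ≤ 16 * k * r → 4 * (n + 32 * m) ≤ 4 * (32 * (k * r))
    arith {m} {r} h₁ h₂ = begin
      4 * (n + 32 * m)      ≡⟨ e₁ n m ⟩
      4 * n + 128 * m       ≤⟨ +-monoʳ-≤ (4 * n) h₁ ⟩
      4 * n + n             ≤⟨ m≤m+n _ (3 * n) ⟩
      4 * n + n + 3 * n     ≡⟨ e₂ n ⟩
      8 * n                 ≤⟨ *-monoʳ-≤ 8 h₂ ⟩
      8 * (16 * k * r)      ≡⟨ e₃ k r ⟩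
      4 * (32 * (k * r))    ∎
      where
      open ≤-Reasoning
      e₁ : ∀ n m → 4 * (n + 32 * m) ≡ 4 * n + 128 * m
      e₁ = solve-∀
      e₂ : ∀ n → 4 * n + n + 3 * n ≡ 8 * n
      e₂ = solve-∀
      e₃ : ∀ k r → 8 * (16 * k * r) ≡ 4 * (32 * (k * r))
      e₃ = solve-∀

  -- All colours have the same number of blocks, so one colour with only small blocks bounds it for every colour.
  many-blocks : ∀ k σ → StageInv k σ → n ≤ 32 * (k * count σ)
  many-blocks k σ inv = cases (undone? k σ (worst k σ))
    where
    open StageInv inv
    double : ∀ k r → 16 * k * r + 16 * k * r ≡ 32 * (k * r)
    double = solve-∀
    cases : Dec (Undone k σ (worst k σ)) → n ≤ 32 * (k * count σ)
    cases (yes u) = ≤-trans (few-blocks sound (worst k σ) (16 * k) (undone-upper (worst k σ) u)) (≤-trans (m≤m+n _ _) (≤-reflexive (double k (count σ))))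
    cases (no d)  = ≤-trans (m≤m+n n _) (done-count d)

  -- Each block is charged 64k: every vertex pays 1, a vertex of a small block 64 more, one of a
  -- medium block 8 more. As there are at least n / (32k) blocks, the charges total at least 2n; all
  -- vertices together pay n by the first rule and the small ones at most n / 2 by the second, so
  -- the medium ones pay at least n / 2.
  medium-mass : ∀ k σ → StageInv k σ → ∀ j → ¬ Undone k σ j → n ≤ E * mass (label σ j) (medium k)
  medium-mass k σ inv j d = ≤-trans (arith {count σ} {m} {med} (many-blocks k σ inv) weights 128m≤n) (*-monoˡ-≤ med (≤-trans (m≤m+n 16 112) 128≤E))
    where
    open StageInv inv
    open Sound sound
    f : Fin n → Fin n
    f = label σ j
    m med : ℕ
    m = mass f (small k)
    med = mass f (medium k)
    weight : ℕ → ℕ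
    weight x = 64 * 𝟙 (x ∈ᴿ? small k) + 8 * 𝟙 (x ∈ᴿ? medium k) + 1
    128m≤n : 128 * m ≤ n
    128m≤n = ≤-trans (*-monoˡ-≤ m 128≤E) (<⇒≤ (≰⇒> d))
    block-weight : ∀ v → 64 * k ≤ weight (size f v) * size f v
    block-weight v = cases (size f v <? 8 * k) (size f v <? 64 * k)
      where
      x : ℕ
      x = size f v
      cases : Dec (x < 8 * k) → Dec (x < 64 * k) → 64 * k ≤ weight x * x
      cases (yes sm) _ = *-mono-≤ {64} {weight x} (≤-trans (≤-reflexive (cong (64 *_) (sym (𝟙-yes (x ∈ᴿ? small k) (z≤n , sm))))) (≤-trans (m≤m+n _ _) (m≤m+n _ 1))) (lower j v)
      cases (no ¬sm) (yes md) = ≤-trans (≤-reflexive (*-assoc 8 8 k)) (*-mono-≤ {8} {weight x}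
        (≤-trans (≤-reflexive (cong (8 *_) (sym (𝟙-yes (x ∈ᴿ? medium k) (≮⇒≥ ¬sm , md))))) (≤-trans (m≤n+m _ (64 * 𝟙 (x ∈ᴿ? small k))) (m≤m+n _ 1))) (≮⇒≥ ¬sm))
      cases (no _) (no ¬md) = ≤-trans (≮⇒≥ ¬md) (≤-trans (≤-reflexive (sym (*-identityˡ x))) (*-monoˡ-≤ x (m≤n+m 1 (64 * 𝟙 (x ∈ᴿ? small k) + 8 * 𝟙 (x ∈ᴿ? medium k)))))
    weights : 64 * k * count σ ≤ 64 * m + 8 * med + n
    weights = begin
      64 * k * count σ                ≡⟨ cong (64 * k *_) (count≡ j) ⟨
      64 * k * blocks f               ≤⟨ blocks-weight f (idem j) (64 * k) weight block-weight ⟩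
      ∑ᶠ (λ v → weight (size f v))    ≡⟨ trans (∑-+ (allFin n) _ _) (cong₂ _+_ (trans (∑-+ (allFin n) _ _) (cong₂ _+_ (∑-*ˡ (allFin n) 64 _) (∑-*ˡ (allFin n) 8 _))) (trans (∑ᶠ-const {n} 1) (*-identityʳ n))) ⟩
      64 * m + 8 * med + n            ∎
      where open ≤-Reasoning
    arith : ∀ {r m q} → n ≤ 32 * (k * r) → 64 * k * r ≤ 64 * m + 8 * q + n → 128 * m ≤ n → n ≤ 16 * q
    arith {r} {m} {q} h₁ h₂ h₃ = +-cancelˡ-≤ (3 * n) n (16 * q) (begin
      3 * n + n                         ≡⟨ e₁ n ⟩
      4 * n                             ≤⟨ *-monoʳ-≤ 4 h₁ ⟩
      4 * (32 * (k * r))                ≡⟨ e₂ k r ⟩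
      2 * (64 * k * r)                  ≤⟨ *-monoʳ-≤ 2 h₂ ⟩
      2 * (64 * m + 8 * q + n)          ≡⟨ e₃ m q n ⟩
      128 * m + (16 * q + 2 * n)        ≤⟨ +-monoˡ-≤ (16 * q + 2 * n) h₃ ⟩
      n + (16 * q + 2 * n)              ≡⟨ e₄ n q ⟩
      3 * n + 16 * q                    ∎)
      where
      open ≤-Reasoning
      e₁ : ∀ n → 3 * n + n ≡ 4 * n
      e₁ = solve-∀
      e₂ : ∀ k r → 4 * (32 * (k * r)) ≡ 2 * (64 * k * r)
      e₂ = solve-∀
      e₃ : ∀ m q n → 2 * (64 * m + 8 * q + n) ≡ 128 * m + (16 * q + 2 * n)
      e₃ = solve-∀
      e₄ : ∀ n q → n + (16 * q + 2 * n) ≡ 3 * n + 16 * q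
      e₄ = solve-∀

  stage-cases : ∀ k σ j (Q : Range × Range → Set) →
                (Undone k σ j → Q (small k , small k)) →
                (¬ Undone k σ j → j ≡ worst k σ → Q (small k , medium k)) →
                (¬ Undone k σ j → j ≢ worst k σ → Q (medium k , medium k)) → Q (stage k σ j)
  stage-cases k σ j Q q₁ q₂ q₃ = cases (undone? k σ j) (j ≟ worst k σ)
    where
    cases : Dec (Undone k σ j) → Dec (j ≡ worst k σ) → Q (stage k σ j)
    cases (yes u) _          = subst Q (sym (stage-undone k σ j u)) (q₁ u)
    cases (no d)  (yes refl) = subst Q (sym (stage-worst k σ d)) (q₂ d refl)
    cases (no d)  (no ne)    = subst Q (sym (stage-other k σ j d ne)) (q₃ d ne)

  8k≤64k : ∀ k → 8 * k ≤ 64 * k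
  8k≤64k k = *-monoˡ-≤ k (m≤m+n 8 56)

  module Accepted (k : ℕ) (σ : State n s) (inv : StageInv k σ) (x : Row n s) (acc : Accepts (stage k) σ x) where
    open StageInv inv
    open Sound sound

    σ′ : State n s
    σ′ = accept x σ

    module _ (j : Fin s) where
      f : Fin n → Fin n
      f = label σ j
      u v : Fin n
      u = proj₁ (proj₁ (lookup x j))
      v = proj₂ (proj₁ (lookup x j))
      module M = Merge f u v (proj₁ (acc j))

      ends-below : ∀ R h → stage k σ j ≡ R → proj₂ (proj₁ R) ≤ h → proj₂ (proj₂ R) ≤ h → size f u < h × size f v < h
      ends-below R h refl a≤ b≤ with proj₂ (acc j)
      ... | inj₁ ((_ , ua) , (_ , vb)) = ≤-trans ua a≤ , ≤-trans vb b≤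
      ... | inj₂ ((_ , va) , (_ , ub)) = ≤-trans ub b≤ , ≤-trans va a≤

      all-ends-below : size f u < 64 * k × size f v < 64 * k
      all-ends-below = stage-cases k σ j (λ R → stage k σ j ≡ R → size f u < 64 * k × size f v < 64 * k)
        (λ _ eq → ends-below _ (64 * k) eq (8k≤64k k) (8k≤64k k))
        (λ _ _ eq → ends-below _ (64 * k) eq (8k≤64k k) ≤-refl)
        (λ _ _ eq → ends-below _ (64 * k) eq ≤-refl ≤-refl) refl

      smallMass-≤ : smallMass k σ′ j ≤ smallMass k σ j
      smallMass-≤ = M.mass-small-≤ (8 * k)

      upper′ : ∀ w → size (label σ′ j) w < 128 * k
      upper′ = M.merge-size-bound (proj₁ all-ends-below) (proj₂ all-ends-below) (≤-reflexive (sym (*-distribʳ-+ k 64 64))) (upper j)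

      undone-before : Undone k σ′ j → Undone k σ j
      undone-before un = ≤-trans un (*-monoʳ-≤ E smallMass-≤)

      undone-upper′ : Undone k σ′ j → ∀ w → size (label σ′ j) w < 16 * k
      undone-upper′ un = M.merge-size-bound (proj₁ ends) (proj₂ ends) (≤-reflexive (sym (*-distribʳ-+ k 8 8))) (undone-upper j (undone-before un))
        where
        ends : size f u < 8 * k × size f v < 8 * k
        ends = ends-below _ (8 * k) (stage-undone k σ j (undone-before un)) ≤-refl ≤-refl

      suc-count : suc (count σ′) ≡ count σ
      suc-count = lemma (trans (M.merge-blocks (idem j)) (count≡ j))
        where
        lemma : ∀ {a r : ℕ} → suc a ≡ r → suc (r ∸ 1) ≡ r
        lemma refl = refl

    drop-worst : ¬ Undone k σ (worst k σ) → k + smallMass k σ′ (worst k σ) ≤ smallMass k σ (worst k σ)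
    drop-worst d = cases (subst (λ R → Admissible (f w) R (lookup x w)) (stage-worst k σ d) (acc w))
      where
      w : Fin s
      w = worst k σ
      cases : Admissible (f w) (small k , medium k) (lookup x w) → k + smallMass k σ′ w ≤ smallMass k σ w
      cases (_ , inj₁ ((_ , us) , (vm , _))) = ≤-trans (+-monoˡ-≤ _ (lower w (u w))) (M.mass-small-drop w (8 * k) (u w) (inj₁ refl) us (≤-trans vm (m≤n+m _ _)))
      cases (_ , inj₂ ((_ , vs) , (um , _))) = ≤-trans (+-monoˡ-≤ _ (lower w (v w))) (M.mass-small-drop w (8 * k) (v w) (inj₂ refl) vs (≤-trans um (m≤m+n _ _)))

    drop-∑ : ¬ Undone k σ (worst k σ) → k + ∑ᶠ (smallMass k σ′) ≤ ∑ᶠ (smallMass k σ)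
    drop-∑ d = ∑ᶠ-drop (smallMass k σ′) (smallMass k σ) k (worst k σ) smallMass-≤ (drop-worst d)

    done-count′ : 128 * k ≤ n → ¬ Undone k σ′ (worst k σ′) → n + 32 * ∑ᶠ (smallMass k σ′) ≤ 32 * (k * count σ′)
    done-count′ 128k≤n d′ = cases (undone? k σ (worst k σ))
      where
      cases : Dec (Undone k σ (worst k σ)) → n + 32 * ∑ᶠ (smallMass k σ′) ≤ 32 * (k * count σ′)
      -- The row that ends the first phase: just before it some colour had all sizes below 16k, and
      -- `128 * k ≤ n` absorbs the one block lost by this row.
      cases (yes un) = *-cancelˡ-≤ 4 (+-cancelʳ-≤ n _ _ (begin
        4 * (n + 32 * m′) + n            ≡⟨ e₁ n m′ ⟩
        5 * n + 128 * m′                 ≤⟨ +-monoʳ-≤ (5 * n) (128∑smallMass≤n k σ′ d′) ⟩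
        5 * n + n                        ≤⟨ m≤m+n _ (2 * n) ⟩
        5 * n + n + 2 * n                ≡⟨ e₂ n ⟩
        8 * n                            ≤⟨ *-monoʳ-≤ 8 (few-blocks sound (worst k σ) (16 * k) (undone-upper (worst k σ) un)) ⟩
        8 * (16 * k * count σ)           ≡⟨ cong (λ r → 8 * (16 * k * r)) (suc-count zero) ⟨
        8 * (16 * k * suc r′)            ≡⟨ e₃ k r′ ⟩
        4 * (32 * (k * r′)) + 128 * k    ≤⟨ +-monoʳ-≤ (4 * (32 * (k * r′))) 128k≤n ⟩
        4 * (32 * (k * r′)) + n          ∎))
        where
        open ≤-Reasoning
        m′ r′ : ℕ
        m′ = ∑ᶠ (smallMass k σ′)
        r′ = count σ′
        e₁ : ∀ n m → 4 * (n + 32 * m) + n ≡ 5 * n + 128 * m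
        e₁ = solve-∀
        e₂ : ∀ n → 5 * n + n + 2 * n ≡ 8 * n
        e₂ = solve-∀
        e₃ : ∀ k r → 8 * (16 * k * suc r) ≡ 4 * (32 * (k * r)) + 128 * k
        e₃ = solve-∀
      cases (no d) = +-cancelʳ-≤ (32 * k) _ _ (begin
        n + 32 * m′ + 32 * k             ≡⟨ e₁ n m′ k ⟩
        n + 32 * (k + m′)                ≤⟨ +-monoʳ-≤ n (*-monoʳ-≤ 32 (drop-∑ d)) ⟩
        n + 32 * ∑ᶠ (smallMass k σ)      ≤⟨ done-count d ⟩
        32 * (k * count σ)               ≡⟨ cong (λ r → 32 * (k * r)) (suc-count zero) ⟨
        32 * (k * suc r′)                ≡⟨ e₂ k r′ ⟩
        32 * (k * r′) + 32 * k           ∎)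
        where
        open ≤-Reasoning
        m′ r′ : ℕ
        m′ = ∑ᶠ (smallMass k σ′)
        r′ = count σ′
        e₁ : ∀ n m k → n + 32 * m + 32 * k ≡ n + 32 * (k + m)
        e₁ = solve-∀
        e₂ : ∀ k r → 32 * (k * suc r) ≡ 32 * (k * r) + 32 * k
        e₂ = solve-∀

    potential-drop : k + potential k σ′ ≤ potential k σ
    potential-drop = cases (undone? k σ (worst k σ)) (undone? k σ′ (worst k σ′))
      where
      open ≤-Reasoning
      r′ : ℕ
      r′ = count σ′
      cases : Dec (Undone k σ (worst k σ)) → Dec (Undone k σ′ (worst k σ′)) → k + potential k σ′ ≤ potential k σ
      -- Small masses never grow, so a finished first phase is not reopened.
      cases (no d) un′ = begin
        k + potential k σ′              ≡⟨ cong (k +_) (potential-done k σ′ (d ∘ λ un → ≤-trans (undone-before (worst k σ′) un) (*-monoʳ-≤ E (worst-max k σ _)))) ⟩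
        k + ∑ᶠ (smallMass k σ′)         ≤⟨ drop-∑ d ⟩
        ∑ᶠ (smallMass k σ)              ≡⟨ potential-done k σ d ⟨
        potential k σ                   ∎
      cases (yes un) (yes un′) = begin
        k + potential k σ′              ≡⟨ cong (k +_) (potential-undone k σ′ un′) ⟩
        k + s * (k * r′ + n)            ≤⟨ +-monoˡ-≤ _ (m≤n*m k s) ⟩
        s * k + s * (k * r′ + n)        ≡⟨ e s k r′ n ⟩
        s * (k * suc r′ + n)            ≡⟨ cong (λ r → s * (k * r + n)) (suc-count zero) ⟩
        s * (k * count σ + n)           ≡⟨ potential-undone k σ un ⟨
        potential k σ                   ∎
        where
        e : ∀ s k r n → s * k + s * (k * r + n) ≡ s * (k * suc r + n)
        e = solve-∀
      cases (yes un) (no d′) = begin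
        k + potential k σ′              ≡⟨ cong (k +_) (potential-done k σ′ d′) ⟩
        k + ∑ᶠ (smallMass k σ′)         ≤⟨ +-mono-≤ (m≤n*m k s) (∑ᶠ-mono (λ j → mass≤n (label σ′ j) (small k))) ⟩
        s * k + ∑ᶠ {s} (λ _ → n)        ≡⟨ cong (s * k +_) (∑ᶠ-const {s} n) ⟩
        s * k + s * n                   ≤⟨ m≤m+n _ (s * (k * r′)) ⟩
        s * k + s * n + s * (k * r′)    ≡⟨ e s k r′ n ⟩
        s * (k * suc r′ + n)            ≡⟨ cong (λ r → s * (k * r + n)) (suc-count zero) ⟩
        s * (k * count σ + n)           ≡⟨ potential-undone k σ un ⟨
        potential k σ                   ∎
        where
        e : ∀ s k r n → s * k + s * n + s * (k * r) ≡ s * (k * suc r + n)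
        e = solve-∀

  stage-closed : ∀ k → 128 * k ≤ n → ∀ x σ → StageInv k σ → StageInv k (step (stage k) x σ)
  stage-closed k 128k≤n x σ inv = with-sound (sound-step (stage k) x σ sound)
    where
    open StageInv inv
    Rest : State n s → Set
    Rest σ′ = Sound σ′ → StageInv k σ′
    with-sound : Rest (step (stage k) x σ)
    with-sound = step-elim (stage k) x σ Rest
      (λ acc snd → let open Accepted k σ inv x acc in record
        { sound = snd
        ; lower = λ j v → ≤-trans (lower j v) (M.merge-size-≤ j v)
        ; upper = upper′
        ; undone-upper = undone-upper′
        ; done-count = done-count′ 128k≤n
        })
      (λ snd → record { sound = snd ; lower = lower ; upper = upper ; undone-upper = undone-upper ; done-count = done-count })

  stage-complete : ∀ k σ → 1 ≤ n → StageInv k σ → potential k σ ≡ 0 → ∀ j v → 8 * k ≤ size (label σ j) v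
  stage-complete k σ 1≤n inv zero-pot = cases (undone? k σ (worst k σ))
    where
    cases : Dec (Undone k σ (worst k σ)) → ∀ j v → 8 * k ≤ size (label σ j) v
    cases (yes un) = ⊥-elim (n≮0 (≤-trans 1≤n (≤-trans (≤-trans (m≤n+m n (k * count σ)) (m≤n*m _ s)) (≤-reflexive (trans (sym (potential-undone k σ un)) zero-pot)))))
    cases (no d) j v = ≮⇒≥ λ lt → n≮0 (begin
      1                                       ≡⟨ 𝟙-yes (size (label σ j) v ∈ᴿ? small k) (z≤n , lt) ⟨
      𝟙 (size (label σ j) v ∈ᴿ? small k)      ≤⟨ ≤∑ᶠ (λ v → 𝟙 (size (label σ j) v ∈ᴿ? small k)) v ⟩
      smallMass k σ j                         ≤⟨ ≤∑ᶠ (smallMass k σ) j ⟩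
      ∑ᶠ (smallMass k σ)                      ≡⟨ trans (sym (potential-done k σ d)) zero-pot ⟩
      0                                       ∎)
      where open ≤-Reasoning

-- Contraction rates of the stages and of the final phase

edge-count : ∀ n → 2 * N n + n ≡ n * n
edge-count n = begin
  2 * N n + n                                              ≡⟨ cong (λ l → 2 * l + n) (length-allEdges n) ⟨
  2 * length (allEdges n) + n                              ≡⟨ cong₂ _+_ (trans (*-comm 2 (length (allEdges n))) (sym (∑-const (allEdges n) 2))) (trans (sym (*-identityʳ n)) (sym (∑ᶠ-const {n} 1))) ⟩
  ∑ (allEdges n) (λ _ → 1 + 1) + ∑ᶠ {n} (λ _ → 1)          ≡⟨ ∑-allEdges n (λ _ _ → 1) ⟩
  ∑ᶠ {n} (λ _ → ∑ᶠ {n} (λ _ → 1))                          ≡⟨ trans (∑ᶠ-const {n} _) (cong (n *_) (trans (∑ᶠ-const {n} 1) (*-identityʳ n))) ⟩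
  n * n                                                    ∎
  where open ≡-Reasoning

pool≤n² : ∀ {n t p} (P : Pools (Edge n) (suc t) p) us → Ledger P us → p ≤ n * n
pool≤n² {n} {p = p} P us ledger = begin
  p                                                   ≡⟨ trans (sym (length-toList (lookup P zero))) (trans (sym (*-identityʳ _)) (sym (∑-const (toList (lookup P zero)) 1))) ⟩
  ∑ (toList (lookup P zero)) (λ _ → 1)                ≤⟨ m≤m+n _ (∑ us (λ _ → 1)) ⟩
  ∑ (toList (lookup P zero)) (λ _ → 1) + ∑ us (λ _ → 1)  ≡⟨ ledger zero (λ _ → 1) ⟩
  ∑ (allEdges n) (λ _ → 1)                            ≡⟨ trans (∑-const (allEdges n) 1) (trans (*-identityʳ _) (length-allEdges n)) ⟩
  N n                                                 ≤⟨ ≤-trans (m≤m+n (N n) (N n + 0)) (m≤m+n _ n) ⟩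
  2 * N n + n                                         ≡⟨ edge-count n ⟩
  n * n                                               ∎
  where open ≤-Reasoning

size≤n : ∀ {n} (f : Fin n → Fin n) v → size f v ≤ n
size≤n {n} f v = ≤-trans (∑ᶠ-mono (λ u → 𝟙≤1 (f u ≟ f v))) (≤-reflexive (trans (∑ᶠ-const {n} 1) (*-identityʳ n)))

blocks≤n : ∀ {n} (f : Fin n → Fin n) → blocks f ≤ n
blocks≤n {n} f = ≤-trans (∑ᶠ-mono (λ v → 𝟙≤1 (f v ≟ v))) (≤-reflexive (trans (∑ᶠ-const {n} 1) (*-identityʳ n)))

module Rates (t n : ℕ) where
  open Stage t n

  #admissible : ∀ {p} → Strategy n s → Pools (Edge n) s p → State n s → Fin s → ℕ
  #admissible π P σ j = ∑ (toList (lookup P j)) (λ e → 𝟙 (admissible? (label σ j) (π σ j) e))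

  pools-^ : ∀ {p} (P : Pools (Edge n) s (suc p)) us → Ledger P us → suc p ^ s ≤ (n * n) ^ s
  pools-^ P us ledger = ^-monoˡ-≤ s (pool≤n² P us ledger)

  E≤b : ∀ g → 1024 * E * g ≤ b * g
  E≤b g = *-monoˡ-≤ g (≤-trans (m≤m*n (1024 * E) E {{>-nonZero 1≤E}}) (≤-reflexive (*-assoc 1024 E E)))

  b^s≤c : ∀ x → b ^ s * x ≤ c * x
  b^s≤c x = *-monoˡ-≤ x (≤-trans (≤-trans (m≤n*m (b ^ s) s) (m≤m+n _ _)) (≤-reflexive (sym (timeFactor≡ t))))

  accepting-lower : ∀ {p} (π : Strategy n s) (P : Pools (Edge n) s (suc p)) σ → Ledger P (used σ) →
                    (∀ j → n * n ≤ b * #admissible π P σ j) → suc p ^ s ≤ b ^ s * #accepting π P σ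
  accepting-lower {p} π P σ ledger many = begin
    suc p ^ s                                         ≤⟨ pools-^ P (used σ) ledger ⟩
    (n * n) ^ s                                       ≤⟨ ∏-lower _ (n * n) many ⟩
    ∏ᶠ (λ j → b * #admissible π P σ j)                ≡⟨ ∏-const-* b (#admissible π P σ) ⟩
    b ^ s * ∏ᶠ (#admissible π P σ)                    ≤⟨ *-monoʳ-≤ (b ^ s) (∏-admissible≤accepting π P σ) ⟩
    b ^ s * #accepting π P σ                          ∎
    where open ≤-Reasoning

  accepting-lower-except : ∀ {p} (π : Strategy n s) (P : Pools (Edge n) s (suc p)) σ → Ledger P (used σ) → ∀ m j₀ →
                           (∀ j → j ≢ j₀ → n * n ≤ b * #admissible π P σ j) → n * m ≤ b * #admissible π P σ j₀ →
                           suc p ^ s * m ≤ b ^ s * #accepting π P σ * n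
  accepting-lower-except {p} π P σ ledger m j₀ many special = begin
    suc p ^ s * m                                     ≤⟨ *-monoˡ-≤ m (pools-^ P (used σ) ledger) ⟩
    (n * n) ^ s * m                                   ≤⟨ ∏-lower-except _ (n * n) m n j₀ many special′ ⟩
    ∏ᶠ (λ j → b * #admissible π P σ j) * n            ≡⟨ cong (_* n) (∏-const-* b (#admissible π P σ)) ⟩
    b ^ s * ∏ᶠ (#admissible π P σ) * n                ≤⟨ *-monoˡ-≤ n (*-monoʳ-≤ (b ^ s) (∏-admissible≤accepting π P σ)) ⟩
    b ^ s * #accepting π P σ * n                      ∎
    where
    open ≤-Reasoning
    special′ : n * n * m ≤ b * #admissible π P σ j₀ * n
    special′ = ≤-trans (≤-reflexive (trans (*-assoc n n m) (*-comm n (n * m)))) (*-monoˡ-≤ n special)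

  -- The second end has at least n / E candidates. The block of the first end removes at most 64k ≤
  -- n / (4E) of them, and used edges remove few since d ≤ n / (1024E), so a constant fraction is
  -- left.
  stage-edges : ∀ {p} k d (P : Pools (Edge n) s p) σ → 256 * E * k ≤ n → 1024 * E * d ≤ n → Ledger P (used σ) →
                StageInv k σ → Alive d σ → ∀ j → n * mass (label σ j) (proj₁ (stage k σ j)) ≤ 4 * E * #admissible (stage k) P σ j
  stage-edges k d P σ k-small d-small ledger inv alive j =
    arith (many-admissible P (used σ) ledger j f A B (mass f B ∸ 64 * k) d (alive j) avoid) (m≤n+m∸n (mass f B) (64 * k)) B-large
    where
    f : Fin n → Fin n
    f = label σ j
    A B : Range
    A = proj₁ (stage k σ j)
    B = proj₂ (stage k σ j)
    B-large : n ≤ E * mass f B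
    B-large = stage-cases k σ j (λ R → n ≤ E * mass f (proj₂ R)) id (λ d _ → medium-mass k σ inv j d) (λ d _ → medium-mass k σ inv j d)
    A-below : ∀ {x} → x ∈ᴿ A → x ≤ 64 * k
    A-below {x} = stage-cases k σ j (λ R → x ∈ᴿ proj₁ R → x ≤ 64 * k)
      (λ _ (_ , lt) → ≤-trans (<⇒≤ lt) (8k≤64k k)) (λ _ _ (_ , lt) → ≤-trans (<⇒≤ lt) (8k≤64k k)) (λ _ _ (_ , lt) → <⇒≤ lt)
    avoid : ∀ u → size f u ∈ᴿ A → mass f B ∸ 64 * k ≤ outside f B u
    avoid u inA = m≤n+o⇒m∸n≤o (mass f B) (64 * k) (≤-trans (mass≤outside+size f B u) (≤-trans (+-monoʳ-≤ (outside f B u) (A-below inA)) (≤-reflexive (+-comm (outside f B u) (64 * k)))))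
    arith : ∀ {a x g β} → a * x ≤ 2 * g + a * (2 * d) → β ≤ 64 * k + x → n ≤ E * β → n * a ≤ 4 * E * g
    arith {a} {x} {g} {β} h₁ h₂ h₃ = *-cancelˡ-≤ 2 (+-cancelˡ-≤ (2 * (n * a)) _ _ (begin
      2 * (n * a) + 2 * (n * a)                          ≡⟨ e₁ n a ⟩
      4 * (a * n)                                        ≤⟨ *-monoʳ-≤ 4 (*-monoʳ-≤ a (≤-trans h₃ (*-monoʳ-≤ E h₂))) ⟩
      4 * (a * (E * (64 * k + x)))                       ≡⟨ e₂ a E k x ⟩
      a * (256 * E * k) + 4 * E * (a * x)                ≤⟨ +-mono-≤ (*-monoʳ-≤ a k-small) (*-monoʳ-≤ (4 * E) h₁) ⟩
      a * n + 4 * E * (2 * g + a * (2 * d))              ≡⟨ e₃ a n E g d ⟩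
      a * n + (8 * E * d) * a + 8 * E * g                ≤⟨ +-monoˡ-≤ (8 * E * g) (+-monoʳ-≤ (a * n) (*-monoˡ-≤ a (≤-trans (*-monoˡ-≤ d (*-monoˡ-≤ E (m≤m+n 8 1016))) d-small))) ⟩
      a * n + n * a + 8 * E * g                          ≡⟨ e₄ a n E g ⟩
      2 * (n * a) + 2 * (4 * E * g)                      ∎))
      where
      open ≤-Reasoning
      e₁ : ∀ n a → 2 * (n * a) + 2 * (n * a) ≡ 4 * (a * n)
      e₁ = solve-∀
      e₂ : ∀ a E k x → 4 * (a * (E * (64 * k + x))) ≡ a * (256 * E * k) + 4 * E * (a * x)
      e₂ = solve-∀
      e₃ : ∀ a n E g d → a * n + 4 * E * (2 * g + a * (2 * d)) ≡ a * n + (8 * E * d) * a + 8 * E * g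
      e₃ = solve-∀
      e₄ : ∀ a n E g → a * n + n * a + 8 * E * g ≡ 2 * (n * a) + 2 * (4 * E * g)
      e₄ = solve-∀

  private
    n²≤bg : ∀ a g → n ≤ E * a → n * a ≤ 4 * E * g → n * n ≤ b * g
    n²≤bg a g h₁ h₂ = begin
      n * n                 ≤⟨ *-monoʳ-≤ n h₁ ⟩
      n * (E * a)           ≡⟨ x[yz]≡y[xz] n E a ⟩
      E * (n * a)           ≤⟨ *-monoʳ-≤ E h₂ ⟩
      E * (4 * E * g)       ≡⟨ regroup E g ⟩
      4 * (E * E) * g       ≤⟨ *-monoˡ-≤ g (*-monoˡ-≤ (E * E) (m≤m+n 4 1020)) ⟩
      b * g                 ∎
      where
      open ≤-Reasoning
      regroup : ∀ E g → E * (4 * E * g) ≡ 4 * (E * E) * g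
      regroup = solve-∀

  -- In the first phase the potential is at most 2sn and a row is accepted with probability at least
  -- 1 / b^s. In the second the potential is at most s times the worst small mass m, and the
  -- acceptance probability carries the matching factor m / n.
  stage-rate : ∀ {p} k d (P : Pools (Edge n) s (suc p)) σ → 256 * E * k ≤ n → 1024 * E * d ≤ n → Ledger P (used σ) →
               StageInv k σ → Alive d σ → suc p ^ s * potential k σ ≤ n * c * #accepting (stage k) P σ
  stage-rate {p} k d P σ k-small d-small ledger inv alive = cases (undone? k σ w)
    where
    open StageInv inv
    open Sound sound
    open ≤-Reasoning
    w : Fin s
    w = worst k σ
    g : Fin s → ℕ
    g = #admissible (stage k) P σ
    acc D : ℕ
    acc = #accepting (stage k) P σ
    D = suc p ^ s
    edges : ∀ j → n * mass (label σ j) (proj₁ (stage k σ j)) ≤ 4 * E * g j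
    edges = stage-edges k d P σ k-small d-small ledger inv alive
    edges-in : ∀ j R → stage k σ j ≡ R → n * mass (label σ j) (proj₁ R) ≤ 4 * E * g j
    edges-in j R refl = edges j
    ordinary : ∀ j → (¬ Undone k σ j → j ≢ w) → n * n ≤ b * g j
    ordinary j ne = n²≤bg _ (g j) (stage-cases k σ j (λ R → n ≤ E * mass (label σ j) (proj₁ R))
      id (λ d e → contradiction e (ne d)) (λ d _ → medium-mass k σ inv j d)) (edges j)
    kr≤n : k * count σ ≤ n
    kr≤n = ≤-trans (≤-reflexive (cong (k *_) (sym (count≡ zero)))) (blocks-min (label σ zero) (idem zero) k (lower zero))
    cases : Dec (Undone k σ w) → D * potential k σ ≤ n * c * acc
    cases (yes un) = begin
      D * potential k σ                      ≡⟨ cong (D *_) (potential-undone k σ un) ⟩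
      D * (s * (k * count σ + n))            ≤⟨ *-mono-≤ (accepting-lower (stage k) P σ ledger (λ j → ordinary j (λ { d refl → d un })))
                                                        (*-monoʳ-≤ s (+-monoˡ-≤ n kr≤n)) ⟩
      b ^ s * acc * (s * (n + n))            ≡⟨ trans (regroup (b ^ s) acc s n) (cong (λ c → n * c * acc) (sym (timeFactor≡ t))) ⟩
      n * c * acc                            ∎
      where
      regroup : ∀ B a s n → B * a * (s * (n + n)) ≡ n * (2 * (s * B)) * a
      regroup = solve-∀
    cases (no d) = begin
      D * potential k σ                      ≡⟨ cong (D *_) (potential-done k σ d) ⟩
      D * ∑ᶠ (smallMass k σ)                 ≤⟨ *-monoʳ-≤ D (≤-trans (∑ᶠ-mono (worst-max k σ)) (≤-reflexive (∑ᶠ-const {s} _))) ⟩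
      D * (s * smallMass k σ w)              ≡⟨ x[yz]≡[xz]y D s _ ⟩
      D * smallMass k σ w * s                ≤⟨ *-monoˡ-≤ s (accepting-lower-except (stage k) P σ ledger _ w (λ j ne → ordinary j (λ _ → ne))
                                                  (≤-trans (edges-in w (small k , medium k) (stage-worst k σ d)) 4E≤b)) ⟩
      b ^ s * acc * n * s                    ≤⟨ m≤m+n _ _ ⟩
      b ^ s * acc * n * s + b ^ s * acc * n * s   ≡⟨ trans (regroup (b ^ s) acc n s) (cong (λ c → n * c * acc) (sym (timeFactor≡ t))) ⟩
      n * c * acc                            ∎
      where
      4E≤b : 4 * E * g w ≤ b * g w
      4E≤b = ≤-trans (*-monoˡ-≤ (g w) (*-monoˡ-≤ E (m≤m+n 4 1020))) (E≤b (g w))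
      x[yz]≡[xz]y : ∀ x y z → x * (y * z) ≡ x * z * y
      x[yz]≡[xz]y = solve-∀
      regroup : ∀ B a n s → B * a * n * s + B * a * n * s ≡ n * (2 * (s * B)) * a
      regroup = solve-∀

  stage-drift : ∀ {p} k d (P : Pools (Edge n) s (suc p)) σ → 256 * E * k ≤ n → 1024 * E * d ≤ n → Ledger P (used σ) → StageInv k σ →
                n * c * ∑ (choices P) (λ y → while-alive d (potential k) (step (stage k) (heads y) σ)) ≤
                (n * c ∸ k) * (suc p ^ s * while-alive d (potential k) σ)
  stage-drift {p} k d P σ k-small d-small ledger inv = drift-alive (stage k) P σ (potential k) d (n * c) (n * c ∸ k) λ alive →
    drift-step (stage k) P σ (potential k) k (n * c) k (λ x acc → Accepted.potential-drop k σ inv x acc) (λ x → ≤-refl)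
      (begin
        k * (suc p ^ s * potential k σ)           ≤⟨ *-monoʳ-≤ k (stage-rate k d P σ k-small d-small ledger inv alive) ⟩
        k * (n * c * #accepting (stage k) P σ)    ≡⟨ x[yz]≡y[xz] k (n * c) _ ⟩
        n * c * (k * #accepting (stage k) P σ)    ∎)
    where
    open ≤-Reasoning

  everything : Range
  -- The upper end of a range is excluded, and a block may have size `n`.
  everything = 0 , suc n

  final : Strategy n s
  final σ j = everything , everything

  record FinalInv (k : ℕ) (σ : State n s) : Set where
    field
      sound : Sound σ
      lower : ∀ j v → k ≤ size (label σ j) v

  final-closed : ∀ k x σ → FinalInv k σ → FinalInv k (step final x σ)
  final-closed k x σ inv = with-sound (sound-step final x σ sound)
    where
    open FinalInv inv
    Rest : State n s → Set
    Rest σ′ = Sound σ′ → FinalInv k σ′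
    with-sound : Rest (step final x σ)
    with-sound = step-elim final x σ Rest
      (λ acc snd → record { sound = snd ; lower = λ j v → ≤-trans (lower j v) (Merge.merge-size-≤ (label σ j) _ _ (proj₁ (acc j)) v) })
      (λ snd → record { sound = snd ; lower = lower })

  excess : State n s → ℕ
  excess σ = count σ ∸ 1

  -- As long as there are two blocks, every vertex sees at least `k` vertices outside its own block,
  -- and now `k` exceeds n / (256E).
  final-edges : ∀ {p} k d (P : Pools (Edge n) s p) σ → n < 256 * E * k → 1024 * E * d ≤ n → Ledger P (used σ) →
                FinalInv k σ → Alive d σ → 2 ≤ count σ → ∀ j → n * n ≤ b * #admissible final P σ j
  final-edges k d P σ k-large d-small ledger inv alive two j =
    ≤-trans (arith (many-admissible P (used σ) ledger j f everything everything k d (alive j) avoid) all-mass) (E≤b _)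
    where
    open FinalInv inv
    open Sound sound
    f : Fin n → Fin n
    f = label σ j
    in-all : ∀ v → size f v ∈ᴿ everything
    in-all v = z≤n , s≤s (size≤n f v)
    all-mass : n ≤ mass f everything
    all-mass = ≤-reflexive (sym (trans (∑-cong (allFin n) (λ v → 𝟙-yes (size f v ∈ᴿ? everything) (in-all v))) (trans (∑ᶠ-const {n} 1) (*-identityʳ n))))
    avoid : ∀ u → size f u ∈ᴿ everything → k ≤ outside f everything u
    avoid u _ = +-cancelˡ-≤ k k _ (begin
      k + k                                       ≡⟨ trans (cong (k +_) (sym (+-identityʳ k))) (*-comm 2 k) ⟩
      k * 2                                       ≤⟨ *-monoʳ-≤ k (≤-trans two (≤-reflexive (sym (count≡ j)))) ⟩
      k * blocks f                                ≤⟨ outside-block f (idem j) k (lower j) u ⟩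
      k + ∑ᶠ (λ v → 𝟙 (¬? (f u ≟ f v)))           ≤⟨ +-monoʳ-≤ k (∑ᶠ-mono (λ v → 𝟙-mono (¬? (f u ≟ f v)) (size f v ∈ᴿ? everything ×-dec ¬? (f u ≟ f v)) (in-all v ,_))) ⟩
      k + outside f everything u                  ∎)
      where open ≤-Reasoning
    arith : ∀ {a g} → a * k ≤ 2 * g + a * (2 * d) → n ≤ a → n * n ≤ 1024 * E * g
    arith {a} {g} h₁ h₂ = ≤-trans (*-monoˡ-≤ n h₂) (+-cancelˡ-≤ (a * n) _ _ (begin
      a * n + a * n                                    ≤⟨ +-mono-≤ (*-monoʳ-≤ a (<⇒≤ k-large)) (*-monoʳ-≤ a (<⇒≤ k-large)) ⟩
      a * (256 * E * k) + a * (256 * E * k)            ≡⟨ e₁ a E k ⟩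
      512 * E * (a * k)                                ≤⟨ *-monoʳ-≤ (512 * E) h₁ ⟩
      512 * E * (2 * g + a * (2 * d))                  ≡⟨ e₂ a E g d ⟩
      a * (1024 * E * d) + 1024 * E * g                ≤⟨ +-monoˡ-≤ (1024 * E * g) (*-monoʳ-≤ a d-small) ⟩
      a * n + 1024 * E * g                             ∎))
      where
      open ≤-Reasoning
      e₁ : ∀ a E k → a * (256 * E * k) + a * (256 * E * k) ≡ 512 * E * (a * k)
      e₁ = solve-∀
      e₂ : ∀ a E g d → 512 * E * (2 * g + a * (2 * d)) ≡ a * (1024 * E * d) + 1024 * E * g
      e₂ = solve-∀

  final-drift : ∀ {p} k d (P : Pools (Edge n) s (suc p)) σ → n < 256 * E * k → 1024 * E * d ≤ n → Ledger P (used σ) → FinalInv k σ →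
                n * c * ∑ (choices P) (λ y → while-alive d excess (step final (heads y) σ)) ≤
                (n * c ∸ 1) * (suc p ^ s * while-alive d excess σ)
  final-drift {p} k d P σ k-large d-small ledger inv = drift-alive final P σ excess d (n * c) (n * c ∸ 1) λ alive →
    drift-step final P σ excess 1 (n * c) 1 drop (λ x → ≤-refl) (rate alive (2 ≤? count σ))
    where
    open FinalInv inv
    open Sound sound
    open ≤-Reasoning
    acc : ℕ
    acc = #accepting final P σ
    drop : ∀ x → Accepts final σ x → 1 + excess (accept x σ) ≤ excess σ
    drop x a with 2 ≤? count σ
    ... | yes two = ≤-reflexive (m+[n∸m]≡n (∸-monoˡ-≤ 1 two))
    -- With a single block no edge crosses, so no row is accepted.
    ... | no few  = contradiction (one-block (label σ zero) (idem zero) (≤-trans (≤-reflexive (count≡ zero)) (s≤s⁻¹ (≰⇒> few))) _ _) (proj₁ (a zero))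
    rate : Alive d σ → Dec (2 ≤ count σ) → 1 * (suc p ^ s * excess σ) ≤ n * c * (1 * acc)
    rate alive (no few)  = ≤-trans (≤-reflexive (trans (*-identityˡ _) (trans (cong (suc p ^ s *_) (m≤n⇒m∸n≡0 (s≤s⁻¹ (≰⇒> few)))) (*-zeroʳ (suc p ^ s))))) z≤n
    rate alive (yes two) = begin
      1 * (suc p ^ s * excess σ)      ≡⟨ *-identityˡ _ ⟩
      suc p ^ s * excess σ            ≤⟨ *-mono-≤ (accepting-lower final P σ ledger (final-edges k d P σ k-large d-small ledger inv alive two))
                                           (≤-trans (m∸n≤m (count σ) 1) (≤-trans (≤-reflexive (sym (count≡ zero))) (blocks≤n (label σ zero)))) ⟩
      b ^ s * acc * n                 ≤⟨ *-monoˡ-≤ n (b^s≤c acc) ⟩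
      c * acc * n                     ≡⟨ regroup c acc n ⟩
      n * c * (1 * acc)               ∎
      where
      regroup : ∀ c a n → c * a * n ≡ n * c * (1 * a)
      regroup = solve-∀

-- Elementary inequalities for powers

-- These are the first two terms of the binomial expansion.
bernoulli : ∀ z k v → z ^ v * (z + suc v * k) ≤ (z + k) ^ suc v
bernoulli z k zero    = ≤-reflexive (base z k)
  where
  base : ∀ z k → 1 * (z + 1 * k) ≡ (z + k) * 1
  base = solve-∀
bernoulli z k (suc v) = begin
  z * Z * (z + suc (suc v) * k)                          ≤⟨ m≤m+n _ (Z * (k * (suc v * k))) ⟩
  z * Z * (z + suc (suc v) * k) + Z * (k * (suc v * k))  ≡⟨ expand z Z k v ⟩
  (z + k) * (Z * (z + suc v * k))                        ≤⟨ *-monoʳ-≤ (z + k) (bernoulli z k v) ⟩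
  (z + k) ^ suc (suc v)                                  ∎
  where
  open ≤-Reasoning
  Z : ℕ
  Z = z ^ v
  expand : ∀ z Z k v → z * Z * (z + suc (suc v) * k) + Z * (k * (suc v * k)) ≡ (z + k) * (Z * (z + suc v * k))
  expand = solve-∀

-- For k < a, with z = a - k: (1 + k/z)^w is at least 1 + wk/z, hence at least 1 + a/z, which is at
-- least 2.
halving : ∀ a k w → 1 ≤ a → a ≤ w * k → 2 * (a ∸ k) ^ w ≤ a ^ w
halving a k zero    1≤a a≤wk = contradiction a≤wk (<⇒≱ 1≤a)
halving a k (suc v) 1≤a a≤wk = cases (≤-total k a)
  where
  open ≤-Reasoning
  z : ℕ
  z = a ∸ k
  double : ∀ z Z → 2 * (z * Z) ≡ Z * (z + z)
  double = solve-∀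
  cases : k ≤ a ⊎ a ≤ k → 2 * (a ∸ k) ^ suc v ≤ a ^ suc v
  cases (inj₂ a≤k) = ≤-trans (≤-reflexive (cong (λ x → 2 * x ^ suc v) (m≤n⇒m∸n≡0 a≤k))) z≤n
  cases (inj₁ k≤a) = begin
    2 * (z * z ^ v)                ≡⟨ double z (z ^ v) ⟩
    z ^ v * (z + z)                ≤⟨ *-monoʳ-≤ (z ^ v) (+-monoʳ-≤ z (≤-trans (m∸n≤m a k) a≤wk)) ⟩
    z ^ v * (z + suc v * k)        ≤⟨ bernoulli z k v ⟩
    (z + k) ^ suc v                ≡⟨ cong (_^ suc v) (m∸n+n≡m k≤a) ⟩
    a ^ suc v                      ∎

^-distribʳ-* : ∀ m n h → (m * n) ^ h ≡ m ^ h * n ^ h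
^-distribʳ-* m n zero    = refl
^-distribʳ-* m n (suc h) = trans (cong (m * n *_) (^-distribʳ-* m n h)) (interchange m n (m ^ h) (n ^ h))
  where
  interchange : ∀ a b c d → a * b * (c * d) ≡ a * c * (b * d)
  interchange = solve-∀

halving-^ : ∀ {x y} w h → 2 * x ^ w ≤ y ^ w → 2 ^ h * x ^ (w * h) ≤ y ^ (w * h)
halving-^ {x} {y} w h le = begin
  2 ^ h * x ^ (w * h)       ≡⟨ cong (2 ^ h *_) (^-*-assoc x w h) ⟨
  2 ^ h * (x ^ w) ^ h       ≡⟨ ^-distribʳ-* 2 (x ^ w) h ⟨
  (2 * x ^ w) ^ h           ≤⟨ ^-monoˡ-≤ h le ⟩
  (y ^ w) ^ h               ≡⟨ ^-*-assoc y w h ⟩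
  y ^ (w * h)               ∎
  where open ≤-Reasoning

^-pos : ∀ {a} m → 1 ≤ a → 1 ≤ a ^ m
^-pos {suc a} m _ = m^n>0 (suc a) m

cancel-pos : ∀ {a x y} → 1 ≤ a → a * x ≤ a * y → x ≤ y
cancel-pos {suc a} _ = *-cancelˡ-≤ (suc a)

-- Repeated contraction and the schedule of stages

module _ {n s} (Inv : State n s → Set) (Φ : State n s → ℕ) (π : Strategy n s) (a k : ℕ)
         (closed : ∀ x σ → Inv σ → Inv (step π x σ))
         (drift : ∀ {p} (P : Pools (Edge n) s (suc p)) σ → Ledger P (used σ) → Inv σ →
                  a * ∑ (choices P) (λ y → Φ (step π (heads y) σ)) ≤ (a ∸ k) * (suc p ^ s * Φ σ)) where

  -- Since `a ≤ w * k`, every `w` rows halve the expected potential, so `h` such windows bring it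
  -- from at most 2^h / Z down to 1 / Z. The failure bound of the rest thus rises by a single unit,
  -- from δ / Z to (δ + 1) / Z.
  window : ∀ (f : State n s → ℕ) Z δ rest w h → 1 ≤ a → a ≤ w * k →
    (∀ p (P : Pools (Edge n) s p) σ → length rest ≤ p → Ledger P (used σ) → Inv σ →
       Z * ∑ (outcomes p P) (λ ω → f (run rest ω σ)) ≤ #outcomes s p * (δ + Z * Φ σ)) →
    ∀ p (P : Pools (Edge n) s p) σ → length (replicate (w * h) π ++ rest) ≤ p → Ledger P (used σ) → Inv σ → Z * Φ σ ≤ 2 ^ h →
    Z * ∑ (outcomes p P) (λ ω → f (run (replicate (w * h) π ++ rest) ω σ)) ≤ #outcomes s p * suc δ
  window f Z δ rest w h 1≤a a≤wk base p P σ len ledger inv small = cancel-pos (^-pos m 1≤a) (begin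
    a ^ m * (Z * S)                                       ≤⟨ subst (λ l → a ^ l * (Z * S) ≤ T * (a ^ l * δ + (a ∸ k) ^ l * (Z * Φ σ))) (length-replicate m) decay ⟩
    T * (a ^ m * δ + (a ∸ k) ^ m * (Z * Φ σ))             ≤⟨ *-monoʳ-≤ T (+-monoʳ-≤ (a ^ m * δ) (*-monoʳ-≤ ((a ∸ k) ^ m) small)) ⟩
    T * (a ^ m * δ + (a ∸ k) ^ m * 2 ^ h)                 ≤⟨ *-monoʳ-≤ T (+-monoʳ-≤ (a ^ m * δ) (≤-trans (≤-reflexive (*-comm _ (2 ^ h))) (halving-^ w h (halving a k w 1≤a a≤wk)))) ⟩
    T * (a ^ m * δ + a ^ m)                               ≡⟨ collect T (a ^ m) δ ⟩
    a ^ m * (T * suc δ)                                   ∎)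
    where
    open ≤-Reasoning
    m T S : ℕ
    m = w * h
    T = #outcomes s p
    S = ∑ (outcomes p P) (λ ω → f (run (replicate m π ++ rest) ω σ))
    collect : ∀ T A δ → T * (A * δ + A) ≡ A * (T * suc δ)
    collect = solve-∀
    decay : a ^ length (replicate m π) * (Z * S) ≤ T * (a ^ length (replicate m π) * δ + (a ∸ k) ^ length (replicate m π) * (Z * Φ σ))
    decay = supermartingale Inv Φ (_≡ π) 0 a (a ∸ k)
      (λ { _ x σ refl → closed x σ }) (λ { _ P σ refl _ → drift P σ })
      f Z δ rest (λ p P σ len → base p P σ (≤-trans (m≤m+n _ 0) len))
      (replicate m π) (All.replicate⁺ m refl) p P σ
      (≤-trans (≤-reflexive (trans (cong (length (replicate m π) +_) (+-identityʳ _)) (sym (length-++ (replicate m π))))) len) ledger inv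

⌊⌋-lower : ∀ ρ → ρ ≤ 1 + 2 * ⌊ ρ /2⌋
⌊⌋-lower zero          = z≤n
⌊⌋-lower (suc zero)    = ≤-refl
⌊⌋-lower (suc (suc ρ)) = ≤-trans (s≤s (s≤s (⌊⌋-lower ρ))) (≤-reflexive (shift ⌊ ρ /2⌋))
  where
  shift : ∀ h → 2 + (1 + 2 * h) ≡ 1 + 2 * suc h
  shift = solve-∀

2*⌊⌋-upper : ∀ ρ → 2 * ⌊ ρ /2⌋ ≤ ρ
2*⌊⌋-upper ρ = ≤-trans (+-monoʳ-≤ ⌊ ρ /2⌋ (≤-trans (≤-reflexive (+-identityʳ _)) (⌊n/2⌋≤⌈n/2⌉ ρ))) (≤-reflexive (⌊n/2⌋+⌈n/2⌉≡n ρ))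

≤8*⌊⌋ : ∀ ρ → 2 ≤ ρ → ρ ≤ 8 * ⌊ ρ /2⌋
≤8*⌊⌋ (suc zero) (s≤s ())
≤8*⌊⌋ (suc (suc ρ)) _ = ≤-trans (s≤s (s≤s (⌊⌋-lower ρ))) (≤-trans (m≤m+n _ (5 + 6 * ⌊ ρ /2⌋)) (≤-reflexive (collect ⌊ ρ /2⌋)))
  where
  collect : ∀ h → 2 + (1 + 2 * h) + (5 + 6 * h) ≡ 8 * suc h
  collect = solve-∀

module Schedule (t n : ℕ) (1≤n : 1 ≤ n) (h d Z : ℕ) where
  open Stage t n
  open Rates t n

  -- `i` bounds the number of stages left, and `ρ` stands for n / k through `n ≤ ρ * k`. It is only
  -- halved while `k` grows eightfold: this leaves room for rounding, and the lengths still form a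
  -- geometric sum.
  schedule : ℕ → ℕ → ℕ → List (Strategy n s)
  schedule zero    k ρ = replicate (c * n * h) final
  schedule (suc i) k ρ =
    if does (256 * E * k ≤? n) then replicate (c * ρ * h) (stage k) ++ schedule i (8 * k) ⌊ ρ /2⌋
    else replicate (c * n * h) final

  length-schedule : ∀ i k ρ → length (schedule i k ρ) ≤ 2 * (c * ρ * h) + c * n * h
  length-schedule zero    k ρ = ≤-trans (≤-reflexive (length-replicate (c * n * h))) (m≤n+m _ _)
  length-schedule (suc i) k ρ = cases (256 * E * k ≤? n)
    where
    open ≤-Reasoning
    cases : (D : Dec (256 * E * k ≤ n)) →
            length (if does D then replicate (c * ρ * h) (stage k) ++ schedule i (8 * k) ⌊ ρ /2⌋ else replicate (c * n * h) final) ≤ 2 * (c * ρ * h) + c * n * h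
    cases (no  _) = ≤-trans (≤-reflexive (length-replicate (c * n * h))) (m≤n+m _ _)
    cases (yes _) = begin
      length (replicate (c * ρ * h) (stage k) ++ schedule i (8 * k) ⌊ ρ /2⌋)  ≡⟨ trans (length-++ (replicate (c * ρ * h) (stage k))) (cong (_+ length (schedule i (8 * k) ⌊ ρ /2⌋)) (length-replicate (c * ρ * h))) ⟩
      c * ρ * h + length (schedule i (8 * k) ⌊ ρ /2⌋)           ≤⟨ +-monoʳ-≤ (c * ρ * h) (length-schedule i (8 * k) ⌊ ρ /2⌋) ⟩
      c * ρ * h + (2 * (c * ⌊ ρ /2⌋ * h) + c * n * h)           ≡⟨ e₁ c ρ h ⌊ ρ /2⌋ n ⟩
      c * ρ * h + c * (2 * ⌊ ρ /2⌋) * h + c * n * h             ≤⟨ +-monoˡ-≤ (c * n * h) (+-monoʳ-≤ (c * ρ * h) (*-monoˡ-≤ h (*-monoʳ-≤ c (2*⌊⌋-upper ρ)))) ⟩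
      c * ρ * h + c * ρ * h + c * n * h                         ≡⟨ e₂ c ρ h n ⟩
      2 * (c * ρ * h) + c * n * h                               ∎
      where
      e₁ : ∀ c ρ h x n → c * ρ * h + (2 * (c * x * h) + c * n * h) ≡ c * ρ * h + c * (2 * x) * h + c * n * h
      e₁ = solve-∀
      e₂ : ∀ c ρ h n → c * ρ * h + c * ρ * h + c * n * h ≡ 2 * (c * ρ * h) + c * n * h
      e₂ = solve-∀

  unfinished : State n s → ℕ
  unfinished σ = 𝟙 (2 ≤? count σ)

  failure : State n s → ℕ
  failure = while-alive d unfinished

  failure≤1 : ∀ σ → failure σ ≤ 1
  failure≤1 σ = ≤-trans (while-alive-≤ d unfinished σ) (𝟙≤1 (2 ≤? count σ))

  #failures : ∀ p → List (Strategy n s) → Pools (Edge n) s p → State n s → ℕ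
  #failures p πs P σ = ∑ (outcomes p P) (λ ω → failure (run πs ω σ))

  module _ (d-small : 1024 * E * d ≤ n) (Z-small : Z * (2 * s * n) ≤ 2 ^ h) where

    1≤c : 1 ≤ c
    1≤c = ≤-trans (^-pos {b} s (*-mono-≤ {1} {1024} (s≤s z≤n) (*-mono-≤ 1≤E 1≤E))) (≤-trans (≤-reflexive (sym (*-identityʳ (b ^ s)))) (≤-trans (b^s≤c 1) (≤-reflexive (*-identityʳ c))))

    1≤nc : 1 ≤ n * c
    1≤nc = *-mono-≤ 1≤n 1≤c

    final-phase : ∀ k p P σ → n < 256 * E * k → length (replicate (c * n * h) final) ≤ p → Ledger P (used σ) → FinalInv k σ →
                  Z * #failures p (replicate (c * n * h) final) P σ ≤ #outcomes s p * 1
    final-phase k p P σ k-large len ledger inv = subst (λ πs → Z * #failures p πs P σ ≤ #outcomes s p * 1) (++-identityʳ (replicate (c * n * h) final))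
      (window (FinalInv k) (while-alive d excess) final (n * c) 1 (final-closed k)
        (λ P σ ledger inv → final-drift k d P σ k-large d-small ledger inv)
        failure Z 0 [] (c * n) h 1≤nc (≤-reflexive (trans (*-comm n c) (sym (*-identityʳ (c * n)))))
        base p P σ (≤-trans (≤-reflexive (cong length (++-identityʳ (replicate (c * n * h) final)))) len) ledger inv
        (≤-trans (*-monoʳ-≤ Z (≤-trans (while-alive-≤ d excess σ) excess-≤)) Z-small))
      where
      open FinalInv inv
      open Sound sound
      excess-≤ : excess σ ≤ 2 * s * n
      excess-≤ = ≤-trans (m∸n≤m (count σ) 1) (≤-trans (≤-trans (≤-reflexive (sym (count≡ zero))) (blocks≤n (label σ zero))) (m≤n*m n (2 * s)))
      base : ∀ p (P : Pools (Edge n) s p) σ → 0 ≤ p → Ledger P (used σ) → FinalInv k σ →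
             Z * #failures p [] P σ ≤ #outcomes s p * (0 + Z * while-alive d excess σ)
      base p P σ _ _ _ = begin
        Z * #failures p [] P σ                            ≡⟨ cong (Z *_) (trans (∑-const (outcomes p P) (failure σ)) (cong (_* failure σ) (length-outcomes p P))) ⟩
        Z * (#outcomes s p * failure σ)                   ≡⟨ x[yz]≡y[xz] Z (#outcomes s p) (failure σ) ⟩
        #outcomes s p * (Z * failure σ)                   ≤⟨ *-monoʳ-≤ (#outcomes s p) (*-monoʳ-≤ Z (*-monoʳ-≤ (𝟙 (alive? d σ)) (𝟙-≤ (2 ≤? count σ) (∸-monoˡ-≤ 1)))) ⟩
        #outcomes s p * (Z * while-alive d excess σ)      ∎
        where
        open ≤-Reasoning

    potential-≤ : ∀ k σ → StageInv k σ → potential k σ ≤ 2 * s * n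
    potential-≤ k σ inv = cases (undone? k σ (worst k σ))
      where
      open StageInv inv
      open Sound sound
      double : ∀ s n → s * (n + n) ≡ 2 * s * n
      double = solve-∀
      cases : Dec (Undone k σ (worst k σ)) → potential k σ ≤ 2 * s * n
      cases (yes un) = ≤-trans (≤-reflexive (potential-undone k σ un)) (≤-trans (*-monoʳ-≤ s (+-monoˡ-≤ n
        (≤-trans (≤-reflexive (cong (k *_) (sym (count≡ zero)))) (blocks-min (label σ zero) (idem zero) k (lower zero))))) (≤-reflexive (double s n)))
      cases (no d) = ≤-trans (≤-reflexive (potential-done k σ d)) (≤-trans (∑ᶠ-mono (λ j → mass≤n (label σ j) (small k)))
        (≤-trans (≤-reflexive (∑ᶠ-const {s} n)) (*-monoˡ-≤ n (m≤n*m s 2))))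

    -- Each stage, and likewise the final phase, adds at most 1 / Z to the failure probability.
    schedule-failures : ∀ i k ρ → n < 8 ^ i * k → 1 ≤ k → n ≤ ρ * k → ∀ p P σ → length (schedule i k ρ) ≤ p → Ledger P (used σ) → Sound σ →
                        (∀ j v → k ≤ size (label σ j) v) → (∀ j v → size (label σ j) v < 16 * k) →
                        Z * #failures p (schedule i k ρ) P σ ≤ #outcomes s p * suc i
    schedule-failures zero    k ρ n<k 1≤k n≤ρk p P σ len ledger snd lo hi =
      final-phase k p P σ (≤-trans n<k (≤-trans (≤-reflexive (*-identityˡ k)) (≤-trans (≤-reflexive (sym (*-identityˡ k))) (*-monoˡ-≤ k (*-mono-≤ {1} {256} (s≤s z≤n) 1≤E))))) len ledger (record { sound = snd ; lower = lo })
    schedule-failures (suc i) k ρ n<k 1≤k n≤ρk p P σ len ledger snd lo hi = cases (256 * E * k ≤? n) len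
      where
      πs : List (Strategy n s)
      πs = schedule i (8 * k) ⌊ ρ /2⌋
      module _ (k-small : 256 * E * k ≤ n) where
        2≤ρ : 2 ≤ ρ
        2≤ρ = cancel-pos 1≤k (≤-trans (≤-reflexive (*-comm k 2)) (≤-trans (*-monoˡ-≤ k (*-mono-≤ {2} {256} (m≤m+n 2 254) 1≤E)) (≤-trans k-small (≤-trans n≤ρk (≤-reflexive (*-comm ρ k))))))
        n≤ρ′k′ : n ≤ ⌊ ρ /2⌋ * (8 * k)
        n≤ρ′k′ = ≤-trans n≤ρk (≤-trans (*-monoˡ-≤ k (≤8*⌊⌋ ρ 2≤ρ)) (≤-reflexive (swap₃ ⌊ ρ /2⌋ k)))
          where
          swap₃ : ∀ x k → 8 * x * k ≡ x * (8 * k)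
          swap₃ = solve-∀
        128k≤n : 128 * k ≤ n
        128k≤n = ≤-trans (*-monoˡ-≤ k (≤-trans (m≤m+n 128 128) (m≤m*n 256 E {{>-nonZero 1≤E}}))) k-small
        base : ∀ p (P : Pools (Edge n) s p) σ → length πs ≤ p → Ledger P (used σ) → StageInv k σ →
               Z * #failures p πs P σ ≤ #outcomes s p * (suc i + Z * while-alive d (potential k) σ)
        base p P σ len ledger inv = base-cases (alive? d σ) (potential k σ) refl
          where
          open ≤-Reasoning
          open StageInv inv
          T S : ℕ
          T = #outcomes s p
          S = #failures p πs P σ
          base-cases : Dec (Alive d σ) → ∀ φ → potential k σ ≡ φ → Z * S ≤ T * (suc i + Z * while-alive d (potential k) σ)
          base-cases (no dead) _ _ = ≤-trans (≤-reflexive (trans (cong (Z *_) (trans (∑-cong (outcomes p P) (λ ω → while-alive-run d unfinished πs ω σ dead)) (∑-zero (outcomes p P)))) (*-zeroʳ Z))) z≤n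
          base-cases (yes alive) zero eq = ≤-trans
            (schedule-failures i (8 * k) ⌊ ρ /2⌋
              (≤-trans n<k (≤-reflexive (trans (cong (_* k) (*-comm 8 (8 ^ i))) (*-assoc (8 ^ i) 8 k))))
              (≤-trans 1≤k (m≤n*m k 8)) n≤ρ′k′ p P σ len ledger sound (stage-complete k σ 1≤n inv eq)
              (λ j v → ≤-trans (upper j v) (≤-reflexive (*-assoc 16 8 k))))
            (*-monoʳ-≤ T (m≤m+n (suc i) _))
          -- The stage is incomplete: the trivial bound 1 on the failure is paid for by the
          -- potential, which is at least 1.
          base-cases (yes alive) (suc φ) eq = begin
            Z * S                         ≤⟨ *-monoʳ-≤ Z (∑-run-≤ πs p P failure σ failure≤1) ⟩
            Z * T                         ≡⟨ *-comm Z T ⟩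
            T * Z                         ≤⟨ *-monoʳ-≤ T (≤-trans (m≤m*n Z (suc φ)) (≤-trans (≤-reflexive (cong (Z *_) (sym (trans (while-alive-alive d (potential k) σ alive) eq)))) (m≤n+m _ (suc i)))) ⟩
            T * (suc i + Z * while-alive d (potential k) σ)  ∎
      cases : (D : Dec (256 * E * k ≤ n)) → let πs′ = if does D then replicate (c * ρ * h) (stage k) ++ πs else replicate (c * n * h) final in
              length πs′ ≤ p → Z * #failures p πs′ P σ ≤ #outcomes s p * suc (suc i)
      cases (yes k-small) len = window (StageInv k) (while-alive d (potential k)) (stage k) (n * c) k (stage-closed k (128k≤n k-small))
        (λ P σ ledger inv → stage-drift k d P σ k-small d-small ledger inv)
        failure Z (suc i) πs (c * ρ) h 1≤nc
        (≤-trans (*-monoˡ-≤ c n≤ρk) (≤-reflexive (rearrange ρ k c))) (base k-small) p P σ len ledger inv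
        (≤-trans (*-monoʳ-≤ Z (≤-trans (while-alive-≤ d (potential k) σ) (potential-≤ k σ inv))) Z-small)
        where
        inv : StageInv k σ
        inv = enter-stage k σ snd lo hi
        rearrange : ∀ ρ k c → ρ * k * c ≡ c * ρ * k
        rearrange = solve-∀
      cases (no k-large) len = ≤-trans (final-phase k p P σ (≰⇒> k-large) len ledger (record { sound = snd ; lower = lo })) (*-monoʳ-≤ (#outcomes s p) (s≤s z≤n))

-- Tail bound for the used degree

∑-𝟙-pick : ∀ {n} (v : Fin n) → ∑ᶠ (λ u → 𝟙 (v ≟ u)) ≡ 1
∑-𝟙-pick v = trans (∑-cong (allFin _) (λ u → 𝟙-cong (v ≟ u) (u ≟ v) sym sym)) (∑ᶠ-𝟙≟ v)

incident≤1 : ∀ {n} (v : Fin n) (e : Edge n) → incident v e ≤ 1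
incident≤1 v ((x , y) , lt) with v ≟ x | v ≟ y
... | yes refl | yes refl = contradiction refl (<⇒≢ lt)
... | yes _    | no _     = ≤-refl
... | no _     | yes _    = ≤-refl
... | no _     | no _     = z≤n

∑-incident-pool : ∀ {n s p} (P : Pools (Edge n) s p) us → Ledger P us → ∀ j v → ∑ (toList (lookup P j)) (incident v) ≤ n
∑-incident-pool {n} P us ledger j v = begin
  ∑ (toList (lookup P j)) (incident v)                                      ≤⟨ m≤m+n _ _ ⟩
  ∑ (toList (lookup P j)) (incident v) + ∑ us (λ x → incident v (lookup x j))  ≡⟨ ledger j (incident v) ⟩
  ∑ (allEdges n) (incident v)                                               ≤⟨ m≤m+n _ (∑ᶠ (λ u → 𝟙 (v ≟ u))) ⟩
  ∑ (allEdges n) (incident v) + ∑ᶠ (λ u → 𝟙 (v ≟ u))                        ≡⟨ ∑-allEdges n (λ u _ → 𝟙 (v ≟ u)) ⟩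
  ∑ᶠ (λ u → ∑ᶠ {n} (λ _ → 𝟙 (v ≟ u)))                                       ≡⟨ trans (∑-cong (allFin n) (λ u → ∑ᶠ-const {n} (𝟙 (v ≟ u)))) (∑-*ˡ (allFin n) n _) ⟩
  n * ∑ᶠ (λ u → 𝟙 (v ≟ u))                                                  ≡⟨ trans (cong (n *_) (∑-𝟙-pick v)) (*-identityʳ n) ⟩
  n                                                                         ∎
  where open ≤-Reasoning

2^-≤ : ∀ {i} → i ≤ 1 → 2 ^ i ≤ 1 + i
2^-≤ z≤n       = ≤-refl
2^-≤ (s≤s z≤n) = ≤-refl

-- In colour `j` at most `n` of the `suc p` edges in the pool meet `v`, so the exponential of the
-- degree doubles with probability at most 1 / x.
degree-drift : ∀ {n s} (j : Fin s) (v : Fin n) x (π : Strategy n s) {p} (P : Pools (Edge n) s (suc p)) σ → n * x ≤ p → Ledger P (used σ) →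
               x * ∑ (choices P) (λ y → 2 ^ degree (used (step π (heads y) σ)) j v) ≤ suc x * (suc p ^ s * 2 ^ degree (used σ) j v)
degree-drift {n} {s} j v x π {p} P σ nx≤p ledger = *-cancelˡ-≤ (suc p) (begin
  suc p * (x * ∑ (choices P) (λ y → 2 ^ degree (used (step π (heads y) σ)) j v))
    ≤⟨ *-monoʳ-≤ (suc p) (*-monoʳ-≤ x (∑-mono (choices P) (λ y _ → grow y))) ⟩
  suc p * (x * ∑ (choices P) (λ y → (1 + incident v (lookup (heads y) j)) * Φ))
    ≡⟨ cong (λ z → suc p * (x * z)) (∑-*ʳ (choices P) Φ _) ⟩
  suc p * (x * (∑ (choices P) (λ y → 1 + incident v (lookup (heads y) j)) * Φ))
    ≡⟨ e₁ (suc p) x _ Φ ⟩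
  x * (suc p * ∑ (choices P) (λ y → 1 + incident v (lookup (heads y) j))) * Φ
    ≡⟨ cong (λ z → x * z * Φ) (∑-choices-at P j (λ e → 1 + incident v e)) ⟩
  x * (D * ∑ (toList (lookup P j)) (λ e → 1 + incident v e)) * Φ
    ≤⟨ *-monoˡ-≤ Φ (*-monoʳ-≤ x (*-monoʳ-≤ D total)) ⟩
  x * (D * (suc p + n)) * Φ
    ≡⟨ e₂ x D (suc p) n Φ ⟩
  (x * suc p + n * x) * (D * Φ)
    ≤⟨ *-monoˡ-≤ (D * Φ) (+-monoʳ-≤ (x * suc p) (≤-trans nx≤p (n≤1+n p))) ⟩
  (x * suc p + suc p) * (D * Φ)
    ≡⟨ e₃ x (suc p) (D * Φ) ⟩
  suc p * (suc x * (D * Φ)) ∎)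
  where
  open ≤-Reasoning
  D Φ : ℕ
  D = suc p ^ s
  Φ = 2 ^ degree (used σ) j v
  grow : ∀ y → 2 ^ degree (used (step π (heads y) σ)) j v ≤ (1 + incident v (lookup (heads y) j)) * Φ
  grow y = ≤-trans (≤-reflexive (trans (cong (λ us → 2 ^ degree us j v) (step-used π (heads y) σ)) (^-distribˡ-+-* 2 (incident v (lookup (heads y) j)) _)))
             (*-monoˡ-≤ Φ (2^-≤ (incident≤1 v (lookup (heads y) j))))
  total : ∑ (toList (lookup P j)) (λ e → 1 + incident v e) ≤ suc p + n
  total = ≤-trans (≤-reflexive (trans (∑-+ (toList (lookup P j)) _ _) (cong (_+ ∑ (toList (lookup P j)) (incident v)) (trans (∑-const (toList (lookup P j)) 1) (trans (*-identityʳ _) (length-toList (lookup P j)))))))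
            (+-monoʳ-≤ (suc p) (∑-incident-pool P (used σ) ledger j v))
  e₁ : ∀ q x S Φ → q * (x * (S * Φ)) ≡ x * (q * S) * Φ
  e₁ = solve-∀
  e₂ : ∀ x D q n Φ → x * (D * (q + n)) * Φ ≡ (x * q + n * x) * (D * Φ)
  e₂ = solve-∀
  e₃ : ∀ x q Y → (x * q + q) * Y ≡ q * (suc x * Y)
  e₃ = solve-∀

-- Telescoping with x = w + y: the factors of (1 + 1/x)^w are at most 1 + 1/i for i = y, ..., x - 1,
-- whose product is x / y.
growth : ∀ w y → suc (w + y) ^ w * y ≤ (w + y) ^ w * (w + y)
growth zero    y = ≤-refl
growth (suc w) y = begin
  suc x * suc x ^ w * y               ≡⟨ e₁ (suc x) (suc x ^ w) y ⟩
  suc x ^ w * (suc x * y)             ≤⟨ *-monoʳ-≤ (suc x ^ w) (≤-trans (+-monoˡ-≤ (x * y) (m≤n+m y (suc w))) (≤-reflexive (sym (*-suc x y)))) ⟩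
  suc x ^ w * (x * suc y)             ≡⟨ e₂ (suc x ^ w) x (suc y) ⟩
  x * (suc x ^ w * suc y)             ≤⟨ *-monoʳ-≤ x (subst (λ z → suc z ^ w * suc y ≤ z ^ w * z) (+-suc w y) (growth w (suc y))) ⟩
  x * (x ^ w * x)                     ≡⟨ *-assoc x (x ^ w) x ⟨
  x * x ^ w * x                       ∎
  where
  open ≤-Reasoning
  x : ℕ
  x = suc w + y
  e₁ : ∀ a b c → a * b * c ≡ b * (a * c)
  e₁ = solve-∀
  e₂ : ∀ a b c → a * (b * c) ≡ b * (a * c)
  e₂ = solve-∀

growth-2 : ∀ w → 1 ≤ w → suc (w + w) ^ w ≤ 2 * (w + w) ^ w
growth-2 w 1≤w = cancel-pos 1≤w (begin
  w * suc (w + w) ^ w          ≡⟨ *-comm w _ ⟩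
  suc (w + w) ^ w * w          ≤⟨ growth w w ⟩
  (w + w) ^ w * (w + w)        ≡⟨ double w ((w + w) ^ w) ⟩
  w * (2 * (w + w) ^ w)        ∎)
  where
  open ≤-Reasoning
  double : ∀ w X → X * (w + w) ≡ w * (2 * X)
  double = solve-∀

-- The exponent is padded to the full multiple `w * h`, where each window of `w` factors contributes
-- at most 2.
growth-^ : ∀ w h m → 1 ≤ w → m ≤ w * h → suc (w + w) ^ m ≤ 2 ^ h * (w + w) ^ m
growth-^ w h m 1≤w m≤wh = cancel-pos (^-pos r (≤-trans 1≤w (m≤m+n w w))) (begin
  x ^ r * suc x ^ m                ≤⟨ *-monoˡ-≤ (suc x ^ m) (^-monoˡ-≤ r (n≤1+n x)) ⟩
  suc x ^ r * suc x ^ m            ≡⟨ trans (sym (^-distribˡ-+-* (suc x) r m)) (cong (suc x ^_) (m∸n+n≡m m≤wh)) ⟩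
  suc x ^ (w * h)                  ≡⟨ ^-*-assoc (suc x) w h ⟨
  (suc x ^ w) ^ h                  ≤⟨ ^-monoˡ-≤ h (growth-2 w 1≤w) ⟩
  (2 * x ^ w) ^ h                  ≡⟨ trans (^-distribʳ-* 2 (x ^ w) h) (cong (2 ^ h *_) (^-*-assoc x w h)) ⟩
  2 ^ h * x ^ (w * h)              ≡⟨ cong (2 ^ h *_) (trans (cong (x ^_) (sym (m∸n+n≡m m≤wh))) (^-distribˡ-+-* x r m)) ⟩
  2 ^ h * (x ^ r * x ^ m)          ≡⟨ e (2 ^ h) (x ^ r) (x ^ m) ⟩
  x ^ r * (2 ^ h * x ^ m)          ∎)
  where
  open ≤-Reasoning
  x r : ℕ
  x = w + w
  r = w * h ∸ m
  e : ∀ a b c → a * (b * c) ≡ b * (a * c)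
  e = solve-∀

-- Exponential Markov inequality. While at least `n * (w + w)` rows are left, the expected value of
-- 2^degree grows at most by the factor 1 + 1/(2w) per row, hence at most doubles in `w` rows.
high-degree : ∀ {n s} (j : Fin s) (v : Fin n) d w h πs p (P : Pools (Edge n) s p) σ → 1 ≤ w → length πs ≤ w * h →
              length πs + n * (w + w) ≤ p → Ledger P (used σ) → used σ ≡ [] →
              2 ^ d * ∑ (outcomes p P) (λ ω → 𝟙 (d <? degree (used (run πs ω σ)) j v)) ≤ 2 ^ h * #outcomes s p
high-degree {n} {s} j v d w h πs p P σ 1≤w short room ledger fresh = cancel-pos (^-pos m (≤-trans 1≤w (m≤m+n w w))) (begin
  x ^ m * (2 ^ d * ∑ (outcomes p P) (λ ω → 𝟙 (d <? deg (run πs ω σ))))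
    ≡⟨ cong (x ^ m *_) (∑-*ˡ (outcomes p P) (2 ^ d) _) ⟨
  x ^ m * ∑ (outcomes p P) (λ ω → 2 ^ d * 𝟙 (d <? deg (run πs ω σ)))
    ≤⟨ *-monoʳ-≤ (x ^ m) (∑-mono (outcomes p P) (λ ω _ → markov (deg (run πs ω σ)))) ⟩
  x ^ m * ∑ (outcomes p P) (λ ω → Φ (run πs ω σ))
    ≤⟨ subst (λ πs′ → x ^ m * ∑ (outcomes p P) (λ ω → Φ (run πs′ ω σ)) ≤ T * suc x ^ m) (++-identityʳ πs) bound ⟩
  T * suc x ^ m
    ≤⟨ *-monoʳ-≤ T (growth-^ w h m 1≤w short) ⟩
  T * (2 ^ h * x ^ m)
    ≡⟨ rotate T (2 ^ h) (x ^ m) ⟩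
  x ^ m * (2 ^ h * T) ∎)
  where
  open ≤-Reasoning
  x m T : ℕ
  x = w + w
  m = length πs
  T = #outcomes s p
  deg Φ : State n s → ℕ
  deg σ = degree (used σ) j v
  Φ σ = 2 ^ deg σ
  rotate : ∀ a b c → a * (b * c) ≡ c * (b * a)
  rotate = solve-∀
  markov : ∀ D → 2 ^ d * 𝟙 (d <? D) ≤ 2 ^ D
  markov D = cases (d <? D)
    where
    cases : (q : Dec (d < D)) → 2 ^ d * 𝟙 q ≤ 2 ^ D
    cases (yes lt) = ≤-trans (≤-reflexive (*-identityʳ (2 ^ d))) (^-monoʳ-≤ 2 (<⇒≤ lt))
    cases (no _)   = ≤-trans (≤-reflexive (*-zeroʳ (2 ^ d))) z≤n
  Φσ≡1 : Φ σ ≡ 1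
  Φσ≡1 = cong (λ us → 2 ^ degree us j v) fresh
  bound : x ^ m * ∑ (outcomes p P) (λ ω → Φ (run (πs ++ []) ω σ)) ≤ T * suc x ^ m
  bound = begin
    x ^ m * ∑ (outcomes p P) (λ ω → Φ (run (πs ++ []) ω σ))          ≡⟨ cong (x ^ m *_) (*-identityˡ _) ⟨
    x ^ m * (1 * ∑ (outcomes p P) (λ ω → Φ (run (πs ++ []) ω σ)))
      ≤⟨ supermartingale (λ _ → ⊤) Φ (λ _ → ⊤) (n * x) x (suc x) _ (λ π P σ _ q≤p ledger _ → degree-drift j v x π P σ q≤p ledger)
           Φ 1 0 [] (λ p P σ _ _ _ → ≤-reflexive (base p P σ)) πs (All.universal (λ _ → tt) πs) p P σ room ledger tt ⟩
    T * (x ^ m * 0 + suc x ^ m * (1 * Φ σ))                          ≡⟨ cong (λ φ → T * (x ^ m * 0 + suc x ^ m * (1 * φ))) Φσ≡1 ⟩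
    T * (x ^ m * 0 + suc x ^ m * 1)                                  ≡⟨ cong (T *_) (cong₂ _+_ (*-zeroʳ (x ^ m)) (*-identityʳ (suc x ^ m))) ⟩
    T * suc x ^ m                                                    ∎
    where
    base : ∀ p (P : Pools (Edge n) s p) σ → 1 * ∑ (outcomes p P) (λ ω → Φ (run [] ω σ)) ≡ #outcomes s p * (0 + 1 * Φ σ)
    base p P σ = trans (*-identityˡ _) (trans (∑-const (outcomes p P) (Φ σ)) (cong₂ _*_ (length-outcomes p P) (sym (*-identityˡ (Φ σ)))))

-- Logarithms and auxiliary facts on lists and vectors

n<2^[1+log₂n] : ∀ n → n < 2 ^ suc ⌊log₂ n ⌋
n<2^[1+log₂n] n = ≰⇒> λ le → 1+n≰n (≤-trans (≤-reflexive (sym (⌊log₂[2^n]⌋≡n (suc ⌊log₂ n ⌋)))) (⌊log₂⌋-mono-≤ le))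

2^log₂n≤n : ∀ n → 1 ≤ n → 2 ^ ⌊log₂ n ⌋ ≤ n
2^log₂n≤n = <-rec (λ n → 1 ≤ n → 2 ^ ⌊log₂ n ⌋ ≤ n) go
  where
  2^-pred : ∀ l → 2 ^ l ≤ 2 * 2 ^ (l ∸ 1)
  2^-pred zero    = s≤s z≤n
  2^-pred (suc l) = ≤-refl
  go : ∀ n → (∀ {m} → m < n → 1 ≤ m → 2 ^ ⌊log₂ m ⌋ ≤ m) → 1 ≤ n → 2 ^ ⌊log₂ n ⌋ ≤ n
  go (suc zero)    rec _ = ≤-refl
  go n@(suc (suc m)) rec _ = begin
    2 ^ ⌊log₂ n ⌋                ≤⟨ 2^-pred ⌊log₂ n ⌋ ⟩
    2 * 2 ^ (⌊log₂ n ⌋ ∸ 1)      ≡⟨ cong (λ l → 2 * 2 ^ l) (⌊log₂⌊n/2⌋⌋≡⌊log₂n⌋∸1 n) ⟨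
    2 * 2 ^ ⌊log₂ ⌊ n /2⌋ ⌋      ≤⟨ *-monoʳ-≤ 2 (rec (⌊n/2⌋<n (suc m)) (s≤s z≤n)) ⟩
    2 * ⌊ n /2⌋                  ≤⟨ 2*⌊⌋-upper n ⟩
    n                            ∎
    where open ≤-Reasoning

square≤2^ : ∀ i → (4 + i) * (4 + i) ≤ 2 ^ (4 + i)
square≤2^ zero    = ≤-refl
square≤2^ (suc i) = begin
  (5 + i) * (5 + i)                          ≤⟨ m≤m+n _ (7 + 6 * i + i * i) ⟩
  (5 + i) * (5 + i) + (7 + 6 * i + i * i)    ≡⟨ e i ⟩
  2 * ((4 + i) * (4 + i))                    ≤⟨ *-monoʳ-≤ 2 (square≤2^ i) ⟩
  2 ^ (5 + i)                                ∎
  where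
  open ≤-Reasoning
  e : ∀ i → (5 + i) * (5 + i) + (7 + 6 * i + i * i) ≡ 2 * ((4 + i) * (4 + i))
  e = solve-∀

m*m≤2^m : ∀ m → 4 ≤ m → m * m ≤ 2 ^ m
m*m≤2^m m 4≤m = subst (λ m → m * m ≤ 2 ^ m) (m+[n∸m]≡n 4≤m) (square≤2^ (m ∸ 4))

vector-of : ∀ {A : Set} (xs : List A) {m} → length xs ≡ m → ∃ λ (v : Vec A m) → toList v ≡ xs
vector-of xs refl = fromList xs , toList∘fromList xs

All-toList : ∀ {A : Set} {Q : A → Set} {m} (v : Vec A m) → (∀ j → Q (lookup v j)) → All Q (toList v)
All-toList []      h = []
All-toList (x ∷ v) h = h zero ∷ All-toList v (h ∘ suc)

lookup-toList : ∀ {A : Set} {Q : A → Set} {m} (v : Vec A m) → All Q (toList v) → ∀ j → Q (lookup v j)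
lookup-toList (x ∷ v) (q ∷ qs) zero    = q
lookup-toList (x ∷ v) (q ∷ qs) (suc j) = lookup-toList v qs j

length-filter-+ : ∀ {A : Set} {Q : A → Set} (Q? : ∀ x → Dec (Q x)) (R? : ∀ x → Dec (¬ Q x)) xs →
                  length (filter Q? xs) + ∑ xs (λ x → 𝟙 (R? x)) ≡ length xs
length-filter-+ Q? R? []       = refl
length-filter-+ Q? R? (x ∷ xs) with Q? x
... | yes q = cong suc (trans (cong (λ r → length (filter Q? xs) + (r + _)) (𝟙-no (R? x) (λ ¬q → ¬q q))) (length-filter-+ Q? R? xs))
... | no ¬q = trans (cong (λ r → length (filter Q? xs) + (r + _)) (𝟙-yes (R? x) ¬q)) (trans (+-suc _ _) (cong suc (length-filter-+ Q? R? xs)))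

-- The list of all valid outcomes

module Uniform (n s : ℕ) where

  edges : Vec (Edge n) (N n)
  edges = proj₁ (vector-of (allEdges n) (length-allEdges n))

  toList-edges : toList edges ≡ allEdges n
  toList-edges = proj₂ (vector-of (allEdges n) (length-allEdges n))

  pools : Pools (Edge n) s (N n)
  pools = replicateᵛ s edges

  pools-lookup : ∀ j → toList (lookup pools j) ≡ allEdges n
  pools-lookup j = trans (cong toList (lookup-replicate j edges)) toList-edges

  ledger : Ledger pools []
  ledger j g = trans (+-identityʳ _) (cong (λ xs → ∑ xs g) (pools-lookup j))

  all : List (Outcome n s)
  all = outcomes (N n) pools

  all-unique : Unique all
  all-unique = unique-outcomes (N n) pools (λ j → subst Unique (sym (pools-lookup j)) (unique-allEdges n))

  all-valid : ∀ {ω} → ω ∈ all → Valid ω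
  all-valid {ω} ω∈ = All-toList ω λ j → let perm = subst (toList (lookup ω j) ↭_) (pools-lookup j) (outcomes-sound (N n) pools ω∈ j) in
    Unique-resp-↭ (↭-sym perm) (unique-allEdges n) , λ e → ∈-resp-↭ (↭-sym perm) (∈-allEdges e)

  all-complete : ∀ ω → Valid ω → ω ∈ all
  all-complete ω valid = outcomes-complete (N n) pools ω λ j → subst (toList (lookup ω j) ↭_) (sym (pools-lookup j))
    (let (uniq , complete) = lookup-toList ω valid j in unique-≋ uniq (unique-allEdges n) ∈-allEdges complete)

  -- The good list holds the outcomes on which the strategy succeeds, a decidable subset of those
  -- with small m*. At most 1 / (κ + 1) of all outcomes fall outside it.
  probAtLeast : ∀ κ M (πs : List (Strategy n s)) → length πs ≤ M →
                suc κ * ∑ all (λ ω → 𝟙 (2 ≤? count (run πs ω (initial n s)))) ≤ length all → ProbAtLeast κ n s M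
  probAtLeast κ M πs short few = all , good , all-unique , All.tabulate all-valid , all-complete ,
    Unique.filter⁺ good? all-unique ,
    All.tabulate (λ {ω} ω∈ → let (ω∈all , ok) = ∈-filter⁻ good? ω∈ in all-valid ω∈all , length πs , short , run⇒multiTree πs ω ok) ,
    many
    where
    open ≤-Reasoning
    good? : ∀ ω → Dec (count (run πs ω (initial n s)) ≤ 1)
    good? ω = count (run πs ω (initial n s)) ≤? 1
    good : List (Outcome n s)
    good = filter good? all
    #bad : ℕ
    #bad = ∑ all (λ ω → 𝟙 (¬? (good? ω)))
    split : length good + #bad ≡ length all
    split = length-filter-+ good? (λ ω → ¬? (good? ω)) all
    #bad-few : suc κ * #bad ≤ length good + #bad
    #bad-few = ≤-trans (*-monoʳ-≤ (suc κ) (∑-mono all (λ ω _ → 𝟙-mono (¬? (good? ω)) (2 ≤? count (run πs ω (initial n s))) ≰⇒>)))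
                 (≤-trans few (≤-reflexive (sym split)))
    many : κ * length all ≤ suc κ * length good
    many = begin
      κ * length all                         ≡⟨ cong (κ *_) split ⟨
      κ * (length good + #bad)               ≡⟨ *-distribˡ-+ κ (length good) #bad ⟩
      κ * length good + κ * #bad             ≤⟨ +-monoʳ-≤ (κ * length good) (+-cancelˡ-≤ #bad (κ * #bad) (length good) (≤-trans #bad-few (≤-reflexive (+-comm (length good) #bad)))) ⟩
      κ * length good + length good          ≡⟨ +-comm _ (length good) ⟩
      suc κ * length good                    ∎

-- Choice of parameters and the union bound

module Assembly (t κ n : ℕ) (1≤n : 1 ≤ n) (4≤l : 4 ≤ ⌊log₂ n ⌋)
                (κ-small : 2 * suc κ ≤ ⌊log₂ n ⌋) (s-small : 2 * suc t ≤ ⌊log₂ n ⌋) where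
  open Stage t n

  -- `X` is the power of two with X ≤ n < 2X. The starting potential times `Z` is at most X^5, hence
  -- `h` is `l * 5`. The degree potential grows by at most 2^(480cl), and the further `4 * l` in `d`
  -- makes the tail at most X^(-4). Once `l` exceeds `A`, all losses of order log n are small
  -- against `n`.
  A l X d h : ℕ
  l = ⌊log₂ n ⌋
  X = 2 ^ l
  d = (480 * c + 4) * l
  h = l * 5
  A = 1024 * E * (480 * c + 4) + 120 * c

  Z : ℕ
  Z = 2 * suc κ * (2 + l)

  open Uniform n s
  open Schedule t n 1≤n h d Z

  πs : List (Strategy n s)
  πs = schedule (suc l) 1 n

  origin : State n s
  origin = initial n s

  T : ℕ
  T = #outcomes s (N n)

  module _ (A-small : A ≤ l) where
    open ≤-Reasoning

    l²≤X : l * l ≤ X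
    l²≤X = m*m≤2^m l 4≤l

    1≤l : 1 ≤ l
    1≤l = ≤-trans (s≤s z≤n) 4≤l

    l≤X : l ≤ X
    l≤X = ≤-trans (m≤m*n l l {{>-nonZero 1≤l}}) l²≤X

    2+l≤X : 2 + l ≤ X
    2+l≤X = begin
      2 + l        ≤⟨ +-monoˡ-≤ l (≤-trans (s≤s (s≤s z≤n)) 4≤l) ⟩
      l + l        ≡⟨ cong (l +_) (+-identityʳ l) ⟨
      2 * l        ≤⟨ *-monoˡ-≤ l (≤-trans (s≤s (s≤s z≤n)) 4≤l) ⟩
      l * l        ≤⟨ l²≤X ⟩
      X            ∎

    X≤n : X ≤ n
    X≤n = 2^log₂n≤n n 1≤n

    n≤X² : n ≤ X * X
    n≤X² = ≤-trans (<⇒≤ (n<2^[1+log₂n] n)) (*-monoˡ-≤ X (≤-trans (≤-trans (s≤s (s≤s z≤n)) 4≤l) l≤X))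

    Al≤n : A * l ≤ n
    Al≤n = ≤-trans (*-monoˡ-≤ l A-small) (≤-trans l²≤X X≤n)

    d-small : 1024 * E * d ≤ n
    d-small = ≤-trans (≤-trans (≤-reflexive (sym (*-assoc (1024 * E) (480 * c + 4) l))) (*-monoˡ-≤ l (m≤m+n (1024 * E * (480 * c + 4)) (120 * c)))) Al≤n

    120cl≤n : 120 * c * l ≤ n
    120cl≤n = ≤-trans (*-monoˡ-≤ l (m≤n+m (120 * c) (1024 * E * (480 * c + 4)))) Al≤n

    Z-small : Z * (2 * s * n) ≤ 2 ^ h
    Z-small = begin
      Z * (2 * s * n)                          ≤⟨ *-mono-≤ (*-mono-≤ (≤-trans κ-small l≤X) 2+l≤X) (*-mono-≤ (≤-trans s-small l≤X) n≤X²) ⟩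
      X * X * (X * (X * X))                    ≡⟨ e X ⟩
      X ^ 5                                    ≡⟨ ^-*-assoc 2 l 5 ⟩
      2 ^ h                                    ∎
      where
      e : ∀ X → X * X * (X * (X * X)) ≡ X * (X * (X * (X * (X * 1))))
      e = solve-∀

    short : length πs ≤ 15 * c * n * l
    short = ≤-trans (length-schedule (suc l) 1 n) (≤-reflexive (e c n l))
      where
      e : ∀ c n l → 2 * (c * n * (l * 5)) + c * n * (l * 5) ≡ 15 * c * n * l
      e = solve-∀

    -- The reserve `n * (w + w)` of unexposed rows is then at most n^2 / 8, about a quarter of all
    -- rows, and the schedule of order n log n fits beside it.
    w : ℕ
    w = n / 16

    16w≤n : w * 16 ≤ n
    16w≤n = m/n*n≤m n 16

    16≤n : 16 ≤ n
    16≤n = ≤-trans (^-monoʳ-≤ 2 4≤l) X≤n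

    1≤w : 1 ≤ w
    1≤w = ≤-trans (≤-reflexive (sym (n/n≡1 16))) (/-monoˡ-≤ 16 16≤n)

    n≤32w : n ≤ 32 * w
    n≤32w = begin
      n                  ≤⟨ ≤-trans (≤-reflexive (m≡m%n+[m/n]*n n 16)) (+-monoˡ-≤ (w * 16) (<⇒≤ (m%n<n n 16))) ⟩
      suc w * 16         ≤⟨ *-monoˡ-≤ 16 (+-monoˡ-≤ w 1≤w) ⟩
      (w + w) * 16       ≡⟨ e w ⟩
      32 * w             ∎
      where
      e : ∀ w → (w + w) * 16 ≡ 32 * w
      e = solve-∀

    room : length πs + n * (w + w) ≤ N n
    room = *-cancelˡ-≤ 8 (+-cancelʳ-≤ (4 * n) _ _ (begin
      8 * (length πs + n * (w + w)) + 4 * n       ≤⟨ +-monoˡ-≤ (4 * n) (*-monoʳ-≤ 8 (+-monoˡ-≤ (n * (w + w)) short)) ⟩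
      8 * (15 * c * n * l + n * (w + w)) + 4 * n  ≡⟨ e₁ c n l w ⟩
      n * (120 * c * l) + n * (w * 16) + n * 4    ≤⟨ +-mono-≤ (+-mono-≤ (*-monoʳ-≤ n 120cl≤n) (*-monoʳ-≤ n 16w≤n)) (*-monoʳ-≤ n (≤-trans (m≤m+n 4 12) 16≤n)) ⟩
      n * n + n * n + n * n                       ≤⟨ m≤m+n _ (n * n) ⟩
      n * n + n * n + n * n + n * n               ≡⟨ e₂ (n * n) ⟩
      4 * (n * n)                                 ≡⟨ cong (4 *_) (edge-count n) ⟨
      4 * (2 * N n + n)                           ≡⟨ e₃ (N n) n ⟩
      8 * N n + 4 * n                             ∎))
      where
      e₁ : ∀ c n l w → 8 * (15 * c * n * l + n * (w + w)) + 4 * n ≡ n * (120 * c * l) + n * (w * 16) + n * 4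
      e₁ = solve-∀
      e₂ : ∀ q → q + q + q + q ≡ 4 * q
      e₂ = solve-∀
      e₃ : ∀ M n → 4 * (2 * M + n) ≡ 8 * M + 4 * n
      e₃ = solve-∀

    #failing : ℕ
    #failing = #failures (N n) πs pools origin

    failing-few : 2 * suc κ * #failing ≤ T
    failing-few = *-cancelʳ-≤ _ _ (2 + l) (begin
      2 * suc κ * #failing * (2 + l)          ≡⟨ swap₃ (2 * suc κ) #failing (2 + l) ⟩
      Z * #failing                            ≤⟨ schedule-failures d-small Z-small (suc l) 1 n n<8^ ≤-refl (≤-reflexive (sym (*-identityʳ n))) (N n) pools origin
                                                   (≤-trans (m≤m+n _ _) room) ledger (sound-initial n s)
                                                   (λ j v → ≤-reflexive (sym (∑ᶠ-𝟙≟ v))) (λ j v → ≤-trans (≤-reflexive (cong suc (∑ᶠ-𝟙≟ v))) (m≤m+n 2 14)) ⟩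
      T * (2 + l)                             ∎)
      where
      swap₃ : ∀ a b c → a * b * c ≡ a * c * b
      swap₃ = solve-∀
      n<8^ : n < 8 ^ suc l * 1
      n<8^ = ≤-trans (n<2^[1+log₂n] n) (≤-trans (^-monoˡ-≤ (suc l) (m≤m+n 2 6)) (≤-reflexive (sym (*-identityʳ _))))

    #overloaded : Fin s → Fin n → ℕ
    #overloaded j v = ∑ all (λ ω → 𝟙 (d <? degree (used (run πs ω origin)) j v))

    overloaded-few : ∀ j v → X ^ 4 * #overloaded j v ≤ T
    overloaded-few j v = cancel-pos (^-pos {2} h′ (s≤s z≤n)) (begin
      2 ^ h′ * (X ^ 4 * #overloaded j v)      ≡⟨ *-assoc (2 ^ h′) (X ^ 4) _ ⟨
      2 ^ h′ * X ^ 4 * #overloaded j v        ≡⟨ cong (_* #overloaded j v) (trans (cong (2 ^ h′ *_) (^-*-assoc 2 l 4)) (trans (sym (^-distribˡ-+-* 2 h′ (l * 4))) (cong (2 ^_) (e₁ c l)))) ⟩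
      2 ^ d * #overloaded j v                 ≤⟨ high-degree j v d w h′ πs (N n) pools origin 1≤w short′ room ledger refl ⟩
      2 ^ h′ * T                              ∎)
      where
      h′ : ℕ
      -- The schedule has at most 15cnl rows and `w` is at least n / 32, so this many windows of `w`
      -- rows cover it.
      h′ = 480 * c * l
      e₁ : ∀ c l → 480 * c * l + l * 4 ≡ (480 * c + 4) * l
      e₁ = solve-∀
      short′ : length πs ≤ w * h′
      short′ = begin
        length πs                    ≤⟨ short ⟩
        15 * c * n * l               ≤⟨ *-monoˡ-≤ l (*-monoʳ-≤ (15 * c) n≤32w) ⟩
        15 * c * (32 * w) * l        ≡⟨ e₂ c w l ⟩
        w * h′                       ∎
        where
        e₂ : ∀ c w l → 15 * c * (32 * w) * l ≡ w * (480 * c * l)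
        e₂ = solve-∀

    #dead : ℕ
    #dead = ∑ᶠ (λ j → ∑ᶠ (#overloaded j))

    -- Union bound over the `s * n` pairs of a colour and a vertex, against the tail X^(-4).
    dead-few : 2 * suc κ * #dead ≤ T
    dead-few = cancel-pos {s * n} (*-mono-≤ {1} {s} (s≤s z≤n) 1≤n) (begin
      s * n * (2 * suc κ * #dead)             ≡⟨ e₁ s n (2 * suc κ) #dead ⟩
      2 * suc κ * (s * n) * #dead             ≤⟨ *-monoˡ-≤ #dead (*-mono-≤ (≤-trans κ-small l≤X) (*-mono-≤ (≤-trans (m≤n*m s 2) (≤-trans s-small l≤X)) n≤X²)) ⟩
      X * (X * (X * X)) * #dead               ≡⟨ cong (_* #dead) (e₂ X) ⟩
      X ^ 4 * #dead                           ≡⟨ trans (sym (∑-*ˡ (allFin s) (X ^ 4) _)) (∑-cong (allFin s) (λ j → sym (∑-*ˡ (allFin n) (X ^ 4) _))) ⟩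
      ∑ᶠ (λ j → ∑ᶠ (λ v → X ^ 4 * #overloaded j v))   ≤⟨ ∑ᶠ-mono (λ j → ∑ᶠ-mono (overloaded-few j)) ⟩
      ∑ᶠ {s} (λ j → ∑ᶠ {n} (λ v → T))         ≡⟨ trans (∑ᶠ-const {s} _) (trans (cong (s *_) (∑ᶠ-const {n} T)) (sym (*-assoc s n T))) ⟩
      s * n * T                               ∎)
      where
      e₁ : ∀ s n k D → s * n * (k * D) ≡ k * (s * n) * D
      e₁ = solve-∀
      e₂ : ∀ X → X * (X * (X * X)) ≡ X * (X * (X * (X * 1)))
      e₂ = solve-∀

    -- An unfinished run is either alive, and then counted by `failure`, or dead, and then some
    -- vertex has a used degree above `d`.
    bad-split : ∀ (ω : Outcome n s) → 𝟙 (2 ≤? count (run πs ω origin)) ≤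
                      failure (run πs ω origin) + ∑ᶠ (λ j → ∑ᶠ (λ v → 𝟙 (d <? degree (used (run πs ω origin)) j v)))
    bad-split ω = cases (alive? d σ)
      where
      σ : State n s
      σ = run πs ω origin
      over : Fin s → Fin n → ℕ
      over j v = 𝟙 (d <? degree (used σ) j v)
      cases : Dec (Alive d σ) → 𝟙 (2 ≤? count σ) ≤ failure σ + ∑ᶠ (λ j → ∑ᶠ (over j))
      cases (yes alive) = ≤-trans (≤-reflexive (sym (while-alive-alive d unfinished σ alive))) (m≤m+n _ _)
      cases (no dead) with ¬∀⟶∃¬ s (λ j → ∀ v → degree (used σ) j v ≤ d) (λ j → all? (λ v → degree (used σ) j v ≤? d)) dead
      ... | j , dead-j with ¬∀⟶∃¬ n (λ v → degree (used σ) j v ≤ d) (λ v → degree (used σ) j v ≤? d) dead-j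
      ...   | v , big = begin
        𝟙 (2 ≤? count σ)                       ≤⟨ 𝟙≤1 (2 ≤? count σ) ⟩
        1                                      ≡⟨ 𝟙-yes (d <? degree (used σ) j v) (≰⇒> big) ⟨
        over j v                               ≤⟨ ≤∑ᶠ (over j) v ⟩
        ∑ᶠ (over j)                            ≤⟨ ≤∑ᶠ (λ j → ∑ᶠ (over j)) j ⟩
        ∑ᶠ (λ j → ∑ᶠ (over j))                 ≤⟨ m≤n+m _ (failure σ) ⟩
        failure σ + ∑ᶠ (λ j → ∑ᶠ (over j))     ∎

    bad-few : suc κ * ∑ all (λ ω → 𝟙 (2 ≤? count (run πs ω origin))) ≤ length all
    bad-few = *-cancelˡ-≤ 2 (begin
      2 * (suc κ * ∑ all (λ ω → 𝟙 (2 ≤? count (run πs ω origin))))   ≡⟨ *-assoc 2 (suc κ) _ ⟨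
      2 * suc κ * ∑ all (λ ω → 𝟙 (2 ≤? count (run πs ω origin)))     ≤⟨ *-monoʳ-≤ (2 * suc κ) (≤-trans (∑-mono all (λ ω _ → bad-split ω)) (≤-reflexive (trans (∑-+ all _ _) (cong (#failing +_) exchange)))) ⟩
      2 * suc κ * (#failing + #dead)                                ≡⟨ *-distribˡ-+ (2 * suc κ) #failing #dead ⟩
      2 * suc κ * #failing + 2 * suc κ * #dead                      ≤⟨ +-mono-≤ failing-few dead-few ⟩
      T + T                                                         ≡⟨ cong (T +_) (+-identityʳ T) ⟨
      2 * T                                                         ≡⟨ cong (2 *_) (length-outcomes (N n) pools) ⟨
      2 * length all                                                ∎)
      where
      exchange : ∑ all (λ ω → ∑ᶠ (λ j → ∑ᶠ (λ v → 𝟙 (d <? degree (used (run πs ω origin)) j v)))) ≡ #dead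
      exchange = trans (∑-comm all (allFin s) _) (∑-cong (allFin s) (λ j → ∑-comm all (allFin n) _))

    whp : ProbAtLeast κ n s (15 * c * n * l)
    whp = probAtLeast κ (15 * c * n * l) πs short bad-few

theorem1 : (s : ℕ) → 2 ≤ s →
    ∃[ C ] ((k : ℕ) → ∃[ n₀ ] ((n : ℕ) → n₀ ≤ n →
    ProbAtLeast k n s (C * n * ⌊log₂ n ⌋)))
-- 15 = 2 * 5 + 5: all stages together cost at most twice the first one, the final phase costs as
-- much as the first stage, and `h` is 5 log₂ n.
theorem1 (suc t) 2≤s = 15 * timeFactor t , λ k → 2 ^ threshold k , λ n n₀≤n →
  let l-large : threshold k ≤ ⌊log₂ n ⌋
      l-large = ≤-trans (≤-reflexive (sym (⌊log₂[2^n]⌋≡n (threshold k)))) (⌊log₂⌋-mono-≤ n₀≤n)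
  in Assembly.whp t k n (≤-trans (^-pos {2} (threshold k) (s≤s z≤n)) n₀≤n)
       (≤-trans (m≤m+n 4 _) l-large)
       (≤-trans (≤-trans (m≤m+n (2 * suc k) _) (m≤n+m _ 4)) l-large)
       (≤-trans (≤-trans (m≤m+n (2 * suc t) _) (≤-trans (m≤n+m _ (2 * suc k)) (m≤n+m _ 4))) l-large)
       (≤-trans (≤-trans (m≤n+m A (2 * suc t)) (≤-trans (m≤n+m _ (2 * suc k)) (m≤n+m _ 4))) l-large)
  where
  A : ℕ
  A = 1024 * massRatio t * (480 * timeFactor t + 4) + 120 * timeFactor t
  threshold : ℕ → ℕ
  threshold k = 4 + (2 * suc k + (2 * suc t + A))
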